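{- Let $G=(L\cup R,E)$ be a bipartite graph with $n=|L|+|R|$ and $m=|E|$. Then the algorithm IPS (described in the context) enumerates all maximal bicliques in $G$ in $O(m\cdot\alpha^n+n\cdot\beta)$ time, where $\alpha$ ($\approx 1.3954$) is the largest positive real root of $x^4-2x-1=0$ and $\beta$ is the number of maximal bicliques in $G$.
   Context: Graphs. $G=(L\cup R,E)$ is an unweighted undirected bipartite graph with disjoint vertex sides $L,R$ and $E\subseteq L\times R$. All subgraphs are induced; for $V_L\subseteq L$, $V_R\subseteq R$, $G[V_L\cup V_R]$ is the induced subgraph. For an induced subgraph $H$, $L(H)$ and $R(H)$ are its left and right sides. A biclique is an induced subgraph $G[V_L\cup V_R]$ in which every $u\in V_L$ is adjacent to every $v\in V_R$; it is maximal if no other biclique of $G$ contains it. A bipartite graph is a 2-biplex if every vertex (on either side) has at most 2 non-neighbors on the opposite side. Problem. Given $G$ and integers $\tau_L,\tau_R\ge 1$, output all maximal bicliques $H$ of $G$ with $|L(H)|\ge\tau_L$ and $|R(H)|\ge\tau_R$. Enumerating all maximal bicliques means $\tau_L=\tau_R=1$ (so bicliques have both sides non-empty), and $\beta$ counts these. Notation. For a vertex set $Z$, $Z_L=Z\cap L$ and $Z_R=Z\cap R$. For a vertex $v$ and a set $Y$ of vertices on the side opposite to $v$, $\overline d(v,Y)$ is the number of vertices of $Y$ not adjacent to $v$. Algorithm IPS. It is a recursive procedure on branches $B=(S,C,X)$ (partial biclique, candidate set, exclusion set), started from $(\emptyset,L\cup R,\emptyset)$. At a branch $(S,C,X)$: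 1. Termination: if $G[S\cup C]$ is a 2-biplex and $X=\emptyset$, output all maximal bicliques of $G[S\cup C]$ (satisfying the size constraints) and return. This is done by a dedicated procedure for 2-biplexes: each connected component of the bipartite complement is an isolated vertex, a simple path or a simple cycle, and the maximal bicliques are obtained as maximal independent sets of the complement, by combining maximal independent sets of its components; the cost on a 2-biplex with $n'$ vertices, $m'$ edges and $\beta'$ maximal bicliques is $O(m'+n'\beta')$. 2. Pruning: return if (P1) $|S_L|+|C_L|<\tau_L$ or $|S_R|+|C_R|<\tau_R$; or (P2) some $v\in X_L$ is adjacent to all of $C_R$, or some $v\in X_R$ is adjacent to all of $C_L$. 3. Pivot selection: let $C'=C_L'\cup C_R'$ with $$C_L'=\{v\in C_L: \overline d(v,X_R)=0\ \wedge\ \overline d(v,C_R)\le 2\},\qquad C_R'=\{v\in C_R: \overline d(v,X_L)=0\ \wedge\ \overline d(v,C_L)\le 2\}.$$ A vertex $v\in C\cup X$ is a candidate pivot if (C1) $v\in (C\setminus C')\cup X$; or (C2) $v\in C_L'$ has at least one non-neighbor in $C_R\setminus C_R'$, or $v\in C_R'$ has at least one non-neighbor in $C_L\setminus C_L'$. The pivot $v^*$ is a candidate pivot with the minimum number of non-neighbors in $C$ on its opposite side; ties are broken in favour of vertices of $X$, and otherwise arbitrarily. 4. Branching: let $v_1,v_2,\dots$ be the list consisting of $v^*$ (if $v^*\in C$) followed by the non-neighbors of $v^*$ in $C$ on the side opposite to $v^*$ (in an order chosen by the algorithm). For each $i$, recurse on $$S_i=S\cup\{v_i\},\quad C_i=C\setminus\{v_1,\dots,v_i\},\quad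 X_i=X\cup\{v_1,\dots,v_{i-1}\},$$ after removing from $C_i$ and $X_i$ all vertices on the side opposite to $v_i$ that are not adjacent to $v_i$. Running time is worst-case time, including the time to output the bicliques. -}

module Defs where

open import Data.Bool using (Bool; true; false; not; if_then_else_; _∧_; _∨_; T)
open import Data.Fin using (Fin)
import Data.Fin.Properties as Fin
open import Data.Fin.Subset using (Subset; ∣_∣) renaming (_∈_ to _∈ˢ_)
open import Data.Integer using (+_)
open import Data.List using (List; []; _∷_; _++_; map; length; lookup; null; allFin; filterᵇ; cartesianProduct)
open import Data.List.Membership.Propositional using (_∈_)
open import Data.List.Relation.Binary.Permutation.Propositional using (_↭_)
open import Data.List.Relation.Unary.All using (All)
open import Data.List.Relation.Unary.Unique.Propositional using (Unique)
open import Data.Nat using (ℕ; zero; suc; _+_; _*_; _≤_; _≤ᵇ_; _<ᵇ_; _≡ᵇ_)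
open import Data.Product using (∃; _×_; _,_; proj₁; proj₂)
open import Data.Rational as ℚ using (ℚ; 0ℚ; 1ℚ; +-*-rawSemiring)
open import Data.Sum using (_⊎_; inj₁; inj₂)
import Data.Sum.Properties as Sum
open import Data.Unit using (⊤; tt)
open import Function using (_⇔_; _∘_)
open import Relation.Binary.PropositionalEquality using (_≡_)
open import Relation.Nullary using (does)
open import Algebra.Definitions.RawSemiring +-*-rawSemiring public using () renaming (_^_ to _^ℚ_)

------------------------------------------------------------------------
-- Real numbers

-- A real number is a Cauchy sequence of rationals.  Arithmetic on reals is
-- pointwise arithmetic on sequences, and the relations below compare limits,
-- so no operation on ℝ itself is needed to state polynomial (in)equalities.

Sequence : Set
Sequence = ℕ → ℚ

IsCauchy : Sequence → Set
IsCauchy x = ∀ ε → 0ℚ ℚ.< ε → ∃ λ N → ∀ i j → N ≤ i → N ≤ j → ℚ.∣ x i ℚ.- x j ∣ ℚ.< ε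

record ℝ : Set where
  field
    approx : Sequence
    cauchy : IsCauchy approx

open ℝ public

infix 4 _≤ᴿ_ _≈ᴿ_

_≤ᴿ_ : Sequence → Sequence → Set
x ≤ᴿ y = ∀ ε → 0ℚ ℚ.< ε → ∃ λ N → ∀ i → N ≤ i → x i ℚ.≤ y i ℚ.+ ε

_≈ᴿ_ : Sequence → Sequence → Set
x ≈ᴿ y = (x ≤ᴿ y) × (y ≤ᴿ x)

Positive : Sequence → Set
Positive x = ∃ λ ε → 0ℚ ℚ.< ε × ∃ λ N → ∀ i → N ≤ i → ε ℚ.≤ x i

fromℕ : ℕ → ℚ
fromℕ k = + k ℚ./ 1

const : ℚ → Sequence
const q _ = q

IsPositiveRoot : ℝ → Set
IsPositiveRoot x = Positive (approx x) × ((λ i → p (approx x i)) ≈ᴿ const 0ℚ)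
  where
  p : ℚ → ℚ
  p q = q ^ℚ 4 ℚ.- fromℕ 2 ℚ.* q ℚ.- 1ℚ

IsLargestPositiveRoot : ℝ → Set
IsLargestPositiveRoot x = IsPositiveRoot x × (∀ y → IsPositiveRoot y → approx y ≤ᴿ approx x)

------------------------------------------------------------------------
-- Enumeration and cardinality

Enumerates : {A : Set} → (A → Set) → List A → Set
Enumerates P xs = Unique xs × (∀ x → x ∈ xs ⇔ P x)

HasCardinality : {A : Set} → (A → Set) → ℕ → Set
HasCardinality P k = ∃ λ xs → Enumerates P xs × length xs ≡ k

------------------------------------------------------------------------
-- Bipartite graphs and bicliques

record BipartiteGraph : Set where
  field
    ∣L∣ ∣R∣ : ℕ
    edge    : Fin ∣L∣ → Fin ∣R∣ → Bool

module _ (G : BipartiteGraph) where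
  open BipartiteGraph G

  Vertex : Set
  Vertex = Fin ∣L∣ ⊎ Fin ∣R∣

  vertices : List Vertex
  vertices = map inj₁ (allFin ∣L∣) ++ map inj₂ (allFin ∣R∣)

  order-of : ℕ
  order-of = ∣L∣ + ∣R∣

  isLeft isRight : Vertex → Bool
  isLeft (inj₁ _) = true
  isLeft (inj₂ _) = false
  isRight = not ∘ isLeft

  -- True only for vertices on opposite sides, so that counting over a set Y
  -- counts over the part of Y opposite to v.
  nonAdjacent : Vertex → Vertex → Bool
  nonAdjacent (inj₁ u) (inj₂ w) = not (edge u w)
  nonAdjacent (inj₂ w) (inj₁ u) = not (edge u w)
  nonAdjacent _        _        = false

  d̄ : Vertex → List Vertex → ℕ
  d̄ v Y = length (filterᵇ (nonAdjacent v) Y)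

  isEdge : Vertex × Vertex → Bool
  isEdge (inj₁ u , inj₂ w) = edge u w
  isEdge _                 = false

  -- Edges of the subgraph induced by a duplicate-free list of vertices; an
  -- edge is counted once because isEdge wants its left endpoint first.
  edgeCount : List Vertex → ℕ
  edgeCount W = length (filterᵇ isEdge (cartesianProduct W W))

  size : ℕ
  size = edgeCount vertices

  IsTwoBiplex : List Vertex → Set
  IsTwoBiplex W = All (λ v → d̄ v W ≤ 2) W

  -- An induced subgraph, given by its left and right sides.
  Subgraph : Set
  Subgraph = Subset ∣L∣ × Subset ∣R∣

  _∈ᴳ_ : Vertex → Subgraph → Set
  inj₁ u ∈ᴳ (A , B) = u ∈ˢ A
  inj₂ w ∈ᴳ (A , B) = w ∈ˢ B

  _⊆ᴳ_ : Subgraph → Subgraph → Set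
  H ⊆ᴳ H′ = ∀ v → v ∈ᴳ H → v ∈ᴳ H′

  IsBiclique : Subgraph → Set
  IsBiclique (A , B) = ∀ u w → u ∈ˢ A → w ∈ˢ B → T (edge u w)

  IsBicliqueOf : List Vertex → Subgraph → Set
  IsBicliqueOf W H = IsBiclique H × (∀ v → v ∈ᴳ H → v ∈ W)

  -- H is a maximal biclique of the subgraph induced by W.
  IsMaximalBicliqueOf : List Vertex → Subgraph → Set
  IsMaximalBicliqueOf W H =
    IsBicliqueOf W H × (∀ H′ → IsBicliqueOf W H′ → H ⊆ᴳ H′ → H′ ≡ H)

  IsLargeMaximalBicliqueOf : (τL τR : ℕ) → List Vertex → Subgraph → Set
  IsLargeMaximalBicliqueOf τL τR W H =
    IsMaximalBicliqueOf W H × τL ≤ ∣ proj₁ H ∣ × τR ≤ ∣ proj₂ H ∣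

------------------------------------------------------------------------
-- Computations with a step count

infix 5 _⧗_

record Timed (A : Set) : Set where
  constructor _⧗_
  field
    value : A
    time  : ℕ

open Timed public

return : {A : Set} → A → Timed A
return a = a ⧗ 0

infixl 1 _>>=_ _>>_

_>>=_ : {A B : Set} → Timed A → (A → Timed B) → Timed B
(a ⧗ s) >>= f = value (f a) ⧗ (s + time (f a))

_>>_ : {A B : Set} → Timed A → Timed B → Timed B
m >> k = m >>= λ _ → k

tick : Timed ⊤
tick = tt ⧗ 1

ticks : ℕ → Timed ⊤
ticks k = tt ⧗ k

-- Every list cell visited costs one step, on top of the cost of the work done
-- at it.  An adjacency query, a vertex comparison, arithmetic and comparison
-- of numbers and the construction of a cell are constant-time, and only a
-- bounded number of them is covered by each step.

filterᵀ : {A : Set} → (A → Timed Bool) → List A → Timed (List A)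
filterᵀ p [] = tick >> return []
filterᵀ p (x ∷ xs) = do
  tick
  b  ← p x
  ys ← filterᵀ p xs
  return (if b then x ∷ ys else ys)

mapᵀ : {A B : Set} → (A → Timed B) → List A → Timed (List B)
mapᵀ f [] = tick >> return []
mapᵀ f (x ∷ xs) = do
  tick
  y  ← f x
  ys ← mapᵀ f xs
  return (y ∷ ys)

appendᵀ : {A : Set} → List A → List A → Timed (List A)
appendᵀ [] ys = tick >> return ys
appendᵀ (x ∷ xs) ys = do
  tick
  zs ← appendᵀ xs ys
  return (x ∷ zs)

lengthᵀ : {A : Set} → List A → Timed ℕ
lengthᵀ [] = tick >> return 0
lengthᵀ (x ∷ xs) = do
  tick
  k ← lengthᵀ xs
  return (suc k)

countᵀ : {A : Set} → (A → Timed Bool) → List A → Timed ℕ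
countᵀ p xs = do
  ys ← filterᵀ p xs
  lengthᵀ ys

-- All entries with the least second component.
minimalᵀ : {A : Set} → List (A × ℕ) → Timed (List (A × ℕ))
minimalᵀ [] = tick >> return []
minimalᵀ {A} ((x , d) ∷ xs) = do
  tick
  ys ← minimalᵀ xs
  return (extend ys)
  where
  extend : List (A × ℕ) → List (A × ℕ)
  extend [] = (x , d) ∷ []
  extend ((y , e) ∷ ys) =
    if d <ᵇ e then (x , d) ∷ []
    else if e <ᵇ d then (y , e) ∷ ys
    else (x , d) ∷ (y , e) ∷ ys

------------------------------------------------------------------------
-- What the description of IPS leaves open

-- A procedure for 2-biplexes.  The number b of maximal bicliques in the time
-- bound includes those with an empty side or of small size; the summand 1
-- allows for a constant cost on the empty graph.
record TwoBiplexProcedure : Set where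
  field
    run     : (G : BipartiteGraph) (τL τR : ℕ) → List (Vertex G) → Timed (List (Subgraph G))
    correct : ∀ G τL τR W → Unique W → IsTwoBiplex G W →
              Enumerates (IsLargeMaximalBicliqueOf G τL τR W) (value (run G τL τR W))
    κ       : ℕ
    bounded : ∀ G τL τR W → Unique W → IsTwoBiplex G W →
              ∀ b → HasCardinality (IsMaximalBicliqueOf G W) b →
              time (run G τL τR W) ≤ κ * (1 + edgeCount G W + length W * b)

record Branch (G : BipartiteGraph) : Set where
  constructor ⟨_,_,_⟩
  field
    S C X : List (Vertex G)

-- The choices are functions of the branch.  No branch occurs twice in an
-- execution, so this covers all ways of making them.  Below, each choice is
-- charged one step per element chosen from or arranged.
record Implementation : Set where
  field
    twoBiplex : TwoBiplexProcedure
    -- which of the tied pivots v ∷ vs to use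
    breakTie  : (G : BipartiteGraph) → Branch G →
                (v : Vertex G) (vs : List (Vertex G)) → Fin (suc (length vs))
    -- in which order to branch on the non-neighbours of the pivot
    arrange   : (G : BipartiteGraph) → Branch G → List (Vertex G) → List (Vertex G)
    arrange-↭ : ∀ G B vs → arrange G B vs ↭ vs

------------------------------------------------------------------------
-- Algorithm IPS

module IPS (impl : Implementation) (G : BipartiteGraph) (τL τR : ℕ) where
  open Implementation impl

  private
    V : Set
    V = Vertex G

  data Pivot : Set where
    none   : Pivot
    fromC  : V → Pivot
    fromX  : V → Pivot

  data Action : Set where
    output : List (Subgraph G) → Action
    prune  : Action
    branch : List (Branch G) → Action

  d̄ᵀ : V → List V → Timed ℕ
  d̄ᵀ v Y = countᵀ (λ w → return (nonAdjacent G v w)) Y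

  d̄-satisfiesᵀ : (ℕ → Bool) → List V → V → Timed Bool
  d̄-satisfiesᵀ p Y v = do
    d ← d̄ᵀ v Y
    return (p d)

  withDegreeᵀ : List V → V → Timed (V × ℕ)
  withDegreeᵀ Y v = do
    d ← d̄ᵀ v Y
    return (v , d)

  twoBiplex?ᵀ : List V → Timed Bool
  twoBiplex?ᵀ W = do
    bad ← filterᵀ (d̄-satisfiesᵀ (2 <ᵇ_) W) W
    return (null bad)

  tooSmall?ᵀ : List V → Timed Bool
  tooSmall?ᵀ SC = do
    l ← countᵀ (λ v → return (isLeft G v)) SC
    r ← countᵀ (λ v → return (isRight G v)) SC
    return ((l <ᵇ τL) ∨ (r <ᵇ τR))

  nonMaximal?ᵀ : (C X : List V) → Timed Bool
  nonMaximal?ᵀ C X = do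
    dominating ← filterᵀ (d̄-satisfiesᵀ (_≡ᵇ 0) C) X
    return (not (null dominating))

  -- membership of v ∈ C in C′
  inC′?ᵀ : (C X : List V) → V → Timed Bool
  inC′?ᵀ C X v = do
    x ← d̄ᵀ v X
    c ← d̄ᵀ v C
    return ((x ≡ᵇ 0) ∧ (c ≤ᵇ 2))

  notInC′?ᵀ : (C X : List V) → V → Timed Bool
  notInC′?ᵀ C X v = do
    b ← inC′?ᵀ C X v
    return (not b)

  pivotᵀ : Branch G → Timed Pivot
  pivotᵀ B@(⟨ S , C , X ⟩) = do
    C′    ← filterᵀ (inC′?ᵀ C X) C
    C∖C′  ← filterᵀ (notInC′?ᵀ C X) C
    C2    ← filterᵀ (d̄-satisfiesᵀ (1 ≤ᵇ_) C∖C′) C′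
    candC ← appendᵀ C∖C′ C2
    degC  ← mapᵀ (withDegreeᵀ C) candC
    degX  ← mapᵀ (withDegreeᵀ C) X
    minC  ← minimalᵀ degC
    minX  ← minimalᵀ degX
    choose minC minX
    where
    pick : V → List V → V
    pick v vs = lookup (v ∷ vs) (breakTie G B v vs)

    pickᵀ : (V → Pivot) → V × ℕ → List (V × ℕ) → Timed Pivot
    pickᵀ from (v , _) ps = do
      vs ← mapᵀ (λ p → return (proj₁ p)) ps
      ticks (length vs)
      return (from (pick v vs))

    choose : (minC minX : List (V × ℕ)) → Timed Pivot
    choose []               []               = return none
    choose (p ∷ ps)         []               = pickᵀ fromC p ps
    choose []               (q ∷ qs)         = pickᵀ fromX q qs
    choose ((v , d) ∷ ps)   ((w , e) ∷ qs)   =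
      if e ≤ᵇ d then pickᵀ fromX (w , e) qs else pickᵀ fromC (v , d) ps

  nonNeighboursᵀ : Branch G → V → Timed (List V)
  nonNeighboursᵀ B@(⟨ S , C , X ⟩) v = do
    vs ← filterᵀ (λ w → return (nonAdjacent G v w)) C
    ticks (length vs)
    return (arrange G B vs)

  _≟ⱽ_ : V → V → Bool
  v ≟ⱽ w = does (Sum.≡-dec Fin._≟_ Fin._≟_ v w)

  -- In the i-th round C and X are C ∖ {v₁,…,vᵢ₋₁} and X ∪ {v₁,…,vᵢ₋₁}.
  childrenᵀ : (S C X : List V) → List V → Timed (List (Branch G))
  childrenᵀ S C X [] = tick >> return []
  childrenᵀ S C X (v ∷ vs) = do
    tick
    C⁻   ← filterᵀ (λ w → return (not (v ≟ⱽ w))) C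
    Cᵢ   ← filterᵀ (λ w → return (not (nonAdjacent G v w))) C⁻
    Xᵢ   ← filterᵀ (λ w → return (not (nonAdjacent G v w))) X
    rest ← childrenᵀ S C⁻ (v ∷ X) vs
    return (⟨ v ∷ S , Cᵢ , Xᵢ ⟩ ∷ rest)

  branchListᵀ : Branch G → Pivot → Timed (List V)
  branchListᵀ B none      = return []
  branchListᵀ B (fromX v) = nonNeighboursᵀ B v
  branchListᵀ B (fromC v) = do
    vs ← nonNeighboursᵀ B v
    return (v ∷ vs)

  -- The work done at a branch, without its recursive calls.
  stepᵀ : Branch G → Timed Action
  stepᵀ B@(⟨ S , C , X ⟩) = do
    tick
    SC       ← appendᵀ S C
    biplex   ← twoBiplex?ᵀ SC
    if biplex ∧ null X then (terminate SC) else do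
      small    ← tooSmall?ᵀ SC
      nonMax   ← nonMaximal?ᵀ C X
      if small ∨ nonMax then return prune else do
        pivot ← pivotᵀ B
        vs    ← branchListᵀ B pivot
        Bs    ← childrenᵀ S C X vs
        return (branch Bs)
    where
    terminate : List V → Timed Action
    terminate SC = do
      Hs ← TwoBiplexProcedure.run twoBiplex G τL τR SC
      return (output Hs)

  -- B ⇓ Hs ⧗ t : the call on B finishes after t steps, having output Hs.
  -- The rules are deterministic.
  infix 4 _⇓_ _⇓*_

  data _⇓_ : Branch G → Timed (List (Subgraph G)) → Set
  data _⇓*_ : List (Branch G) → Timed (List (Subgraph G)) → Set

  data _⇓_ where
    outputs  : ∀ {B Hs t} → stepᵀ B ≡ output Hs ⧗ t → B ⇓ Hs ⧗ t
    prunes   : ∀ {B t} → stepᵀ B ≡ prune ⧗ t → B ⇓ [] ⧗ t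
    branches : ∀ {B Bs Hs t t′} → stepᵀ B ≡ branch Bs ⧗ t → Bs ⇓* Hs ⧗ t′ → B ⇓ Hs ⧗ t + t′

  data _⇓*_ where
    []  : [] ⇓* [] ⧗ 0
    _∷_ : ∀ {B Bs Hs Hs′ t t′} → B ⇓ Hs ⧗ t → Bs ⇓* Hs′ ⧗ t′ → (B ∷ Bs) ⇓* (Hs ++ Hs′) ⧗ t + t′

-- The first summand of the time pays for building the initial candidate set.
Executes : Implementation → (G : BipartiteGraph) (τL τR : ℕ) → List (Subgraph G) → ℕ → Set
Executes impl G τL τR Hs t =
  ∃ λ t′ → (⟨ [] , vertices G , [] ⟩ ⇓ Hs ⧗ t′) × t ≡ order-of G + t′
  where open IPS impl G τL τR

{-# OPTIONS --safe #-}

-- The branches of an execution are counted with a measure that gives 8 to every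
-- candidate with a non-neighbour in C ∪ X and 4 to every vertex of X.  Whatever
-- pivot is chosen, the measures of the children drop by amounts d for which the
-- sum of ρ^(- d) is below 1, where ρ⁸ ≈ 1.394 is slightly less than α; the tight
-- cases, with a pivot of degree two, are paid for by a child that contains a
-- vertex of degree at most one and therefore branches cheaply in the next step.
-- So there are at most 64 ρ⁸ⁿ unpruned branches, and since ρ⁸ < α the polynomial
-- cost of a branch is absorbed by αⁿ, even when m is much smaller than n².
--
-- For correctness, C ∪ X is at every branch the set of all vertices outside S
-- that are adjacent to S, and a maximal biclique containing S inside S ∪ C must
-- contain the pivot or one of its non-neighbours in C.  The bicliques listed at
-- different leaves are therefore distinct and maximal in G, so that listing them
-- costs O(n β), apart from at most two with an empty side at each leaf.

module Submission where

open import Defs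
open import Data.Bool using (Bool; true; false; not; _∧_; _∨_; T)
open import Data.Bool.ListAction using (all)
open import Data.Bool.Properties using (T-≡; T-∧)
open import Data.Empty using (⊥; ⊥-elim)
open import Data.Fin using (Fin)
import Data.Fin.Properties as Fin
import Data.Fin.Subset as Subset
open import Data.Fin.Subset using (Subset; ∣_∣; _∪_; ⁅_⁆)
import Data.Fin.Subset.Properties as Subset
open import Data.Integer as ℤ using (+_)
import Data.Integer.Properties as ℤ
open import Data.List using (List; []; _∷_; _++_; length; map; filterᵇ; null; lookup; allFin; cartesianProduct)
open import Data.List.Properties using (length-++; length-map; length-tabulate)
import Data.List.Membership.DecPropositional as DecMembership
open import Data.List.Membership.Propositional using (_∈_; _∉_; find)
open import Data.List.Membership.Propositional.Properties using (∈-∃++; ∈-++⁺ˡ; ∈-++⁺ʳ; ∈-++⁻; ∈-map⁺; ∈-map⁻; ∈-lookup; ∈-allFin)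
open import Data.List.Relation.Binary.Permutation.Propositional using (_↭_; ↭-sym; ↭⇒↭ₛ)
open import Data.List.Relation.Binary.Permutation.Propositional.Properties using (↭-length; ∈-resp-↭)
import Data.List.Relation.Binary.Permutation.Setoid.Properties as Permutation
open import Data.List.Relation.Binary.Pointwise using (Pointwise; []; _∷_)
open import Data.List.Relation.Binary.Subset.Propositional using (_⊆_)
open import Data.List.Relation.Unary.All as All using (All; []; _∷_)
open import Data.List.Relation.Unary.AllPairs using ([]; _∷_)
open import Data.List.Relation.Unary.Any as Any using (here; there)
open import Data.List.Relation.Unary.Unique.Propositional using (Unique)
import Data.List.Relation.Unary.Unique.Propositional.Properties as Unique
open import Data.Nat as ℕ using (ℕ; zero; suc; _≤_; _<_; _+_; _*_; _∸_; _^_; _≤ᵇ_; _<ᵇ_; _≡ᵇ_; z≤n; s≤s)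
open import Data.Nat.ListAction using (sum)
import Data.Nat.Properties as ℕ
import Data.Nat.Solver as ℕSolver
open import Data.Product using (∃; _×_; _,_; proj₁; proj₂)
open import Data.Rational as ℚ using (ℚ; 0ℚ; 1ℚ; ½)
import Data.Rational.Properties as ℚ
import Data.Rational.Solver as ℚSolver
import Data.Rational.Unnormalised as ℚᵘ
import Data.Rational.Unnormalised.Properties as ℚᵘ
open import Data.Sum as Sum using (_⊎_; inj₁; inj₂)
import Data.Sum.Properties as Sum
open import Data.Unit using (tt)
open import Data.Vec using (tabulate)
import Data.Vec.Properties as Vec
open import Function using (_∘_; _⇔_; mk⇔; case_of_; Equivalence)
open import Relation.Binary.PropositionalEquality using (_≡_; _≢_; refl; sym; trans; cong; cong₂; subst; subst₂; setoid)
open import Relation.Nullary using (¬_; Dec; does; yes; no; contradiction)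
open import Relation.Nullary.Decidable using (toWitness; dec-true; dec-false)

-- Rational arithmetic

-- The quartic is the recurrence of a degree-two pivot whose three children lose three, three and
-- four candidates: 2α⁻³ + α⁻⁴ = 1, or (24, 24, 32) in eighths of a candidate. Reaching it without
-- improvement gives αⁿ times a polynomial in n, which is not O(m αⁿ), since m may stay 1 while n
-- grows. So every branching has to beat the quartic strictly. Two effects stand in the way. An
-- earlier sibling that becomes excluded keeps half its weight. And a vertex of C′ with a single
-- non-neighbour need not be a candidate pivot, so a sibling of a degree-two pivot can have degree
-- one. The remedy is always the same: a pivot is a candidate because it or a non-neighbour of it
-- lies outside C′, and that vertex has either a non-neighbour in X or degree at least three, which
-- makes some child lose more. All weights are powers of 1303 and 1250 with denominators cleared, so
-- that each branching vector of fixed length is checked by evaluation.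

toℚᵘ-fromℕ : ∀ k → ℚ.toℚᵘ (fromℕ k) ℚᵘ.≃ ℚᵘ.mkℚᵘ (+ k) 0
toℚᵘ-fromℕ k = ℚ.toℚᵘ-fromℚᵘ (ℚᵘ.mkℚᵘ (+ k) 0)

fromℕ-+ : ∀ a b → fromℕ (a + b) ≡ fromℕ a ℚ.+ fromℕ b
fromℕ-+ a b = ℚ.toℚᵘ-injective (begin
  ℚ.toℚᵘ (fromℕ (a + b))                       ≈⟨ toℚᵘ-fromℕ (a + b) ⟩
  ℚᵘ.mkℚᵘ (+ (a + b)) 0                        ≡⟨ cong (λ z → ℚᵘ.mkℚᵘ z 0)
                                                    (sym (cong₂ ℤ._+_ (ℤ.*-identityʳ (+ a)) (ℤ.*-identityʳ (+ b)))) ⟩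
  ℚᵘ.mkℚᵘ (+ a) 0 ℚᵘ.+ ℚᵘ.mkℚᵘ (+ b) 0         ≈⟨ ℚᵘ.+-cong (toℚᵘ-fromℕ a) (toℚᵘ-fromℕ b) ⟨
  ℚ.toℚᵘ (fromℕ a) ℚᵘ.+ ℚ.toℚᵘ (fromℕ b)       ≈⟨ ℚ.toℚᵘ-homo-+ (fromℕ a) (fromℕ b) ⟨
  ℚ.toℚᵘ (fromℕ a ℚ.+ fromℕ b)                 ∎)
  where open ℚᵘ.≃-Reasoning

fromℕ-* : ∀ a b → fromℕ (a * b) ≡ fromℕ a ℚ.* fromℕ b
fromℕ-* a b = ℚ.toℚᵘ-injective (begin
  ℚ.toℚᵘ (fromℕ (a * b))                       ≈⟨ toℚᵘ-fromℕ (a * b) ⟩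
  ℚᵘ.mkℚᵘ (+ (a * b)) 0                        ≡⟨ cong (λ z → ℚᵘ.mkℚᵘ z 0) (ℤ.pos-* a b) ⟩
  ℚᵘ.mkℚᵘ (+ a) 0 ℚᵘ.* ℚᵘ.mkℚᵘ (+ b) 0         ≈⟨ ℚᵘ.*-cong (toℚᵘ-fromℕ a) (toℚᵘ-fromℕ b) ⟨
  ℚ.toℚᵘ (fromℕ a) ℚᵘ.* ℚ.toℚᵘ (fromℕ b)       ≈⟨ ℚ.toℚᵘ-homo-* (fromℕ a) (fromℕ b) ⟨
  ℚ.toℚᵘ (fromℕ a ℚ.* fromℕ b)                 ∎)
  where open ℚᵘ.≃-Reasoning

fromℕ-mono-≤ : ∀ {a b} → a ≤ b → fromℕ a ℚ.≤ fromℕ b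
fromℕ-mono-≤ {a} {b} a≤b = ℚ.toℚᵘ-cancel-≤
  (ℚᵘ.≤-respʳ-≃ (ℚᵘ.≃-sym (toℚᵘ-fromℕ b)) (ℚᵘ.≤-respˡ-≃ (ℚᵘ.≃-sym (toℚᵘ-fromℕ a))
    (ℚᵘ.*≤* (ℤ.*-monoʳ-≤-nonNeg (+ 1) (ℤ.+≤+ a≤b)))))

0≤fromℕ : ∀ a → 0ℚ ℚ.≤ fromℕ a
0≤fromℕ a = fromℕ-mono-≤ {0} {a} z≤n

fromℕ-^ : ∀ a n → fromℕ (a ^ n) ≡ fromℕ a ^ℚ n
fromℕ-^ a zero    = refl
fromℕ-^ a (suc n) = trans (fromℕ-* a (a ^ n)) (cong (fromℕ a ℚ.*_) (fromℕ-^ a n))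

*-mono-≤ : ∀ {a b c d} → 0ℚ ℚ.≤ a → a ℚ.≤ b → 0ℚ ℚ.≤ c → c ℚ.≤ d → a ℚ.* c ℚ.≤ b ℚ.* d
*-mono-≤ {a} {b} {c} {d} 0≤a a≤b 0≤c c≤d = ℚ.≤-trans
  (ℚ.*-monoˡ-≤-nonNeg a {{ℚ.nonNegative 0≤a}} c≤d)
  (ℚ.*-monoʳ-≤-nonNeg d {{ℚ.nonNegative (ℚ.≤-trans 0≤c c≤d)}} a≤b)

^-mono-≤ : ∀ {a b} n → 0ℚ ℚ.≤ a → a ℚ.≤ b → 0ℚ ℚ.≤ a ^ℚ n × a ^ℚ n ℚ.≤ b ^ℚ n
^-mono-≤ zero    0≤a a≤b = toWitness {a? = 0ℚ ℚ.≤? 1ℚ} _ , ℚ.≤-refl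
^-mono-≤ {a} {b} (suc n) 0≤a a≤b = let (p , q) = ^-mono-≤ n 0≤a a≤b in
  subst (ℚ._≤ a ℚ.* a ^ℚ n) (ℚ.*-zeroˡ 0ℚ) (*-mono-≤ ℚ.≤-refl 0≤a ℚ.≤-refl p) , *-mono-≤ 0≤a a≤b p q

p≤q⇒0≤q-p : ∀ {p q} → p ℚ.≤ q → 0ℚ ℚ.≤ q ℚ.- p
p≤q⇒0≤q-p {p} {q} p≤q = subst (ℚ._≤ q ℚ.- p) (ℚ.+-inverseʳ p) (ℚ.+-monoˡ-≤ (ℚ.- p) p≤q)

-- For ε = (n + 1)/(d + 1) the multiplier d + 2 exceeds the denominator.
archimedean : ∀ ε → 0ℚ ℚ.< ε → ∃ λ k → 1ℚ ℚ.< fromℕ (suc k) ℚ.* ε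
archimedean ε@(ℚ.mkℚ (+ suc n) d _) _ = suc d , ℚ.toℚᵘ-cancel-<
  (ℚᵘ.<-respʳ-≃ (ℚᵘ.≃-sym (ℚᵘ.≃-trans (ℚ.toℚᵘ-homo-* (fromℕ (suc (suc d))) ε)
      (ℚᵘ.*-congʳ (toℚᵘ-fromℕ (suc (suc d))))))
    (ℚᵘ.*<* (ℤ.+<+ bound)))
  where
  bound : 1 * (1 * suc d) < (suc (suc d) * suc n) * 1
  bound = begin-strict
    1 * (1 * suc d)           ≡⟨ trans (ℕ.*-identityˡ _) (ℕ.*-identityˡ _) ⟩
    suc d                     <⟨ ℕ.n<1+n (suc d) ⟩
    suc (suc d)               ≤⟨ ℕ.m≤m*n (suc (suc d)) (suc n) ⟩
    suc (suc d) * suc n       ≡⟨ ℕ.*-identityʳ _ ⟨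
    (suc (suc d) * suc n) * 1 ∎
    where open ℕ.≤-Reasoning
archimedean (ℚ.mkℚ (+ 0) d c) 0<ε = ⊥-elim (ℚ.<-irrefl (sym (ℚ.↥p≡0⇒p≡0 (ℚ.mkℚ (+ 0) d c) refl)) 0<ε)
archimedean (ℚ.mkℚ (ℤ.-[1+ n ]) d c) 0<ε = ⊥-elim (ℚ.<-asym 0<ε (ℚ.negative⁻¹ (ℚ.mkℚ (ℤ.-[1+ n ]) d c)))

-- The root of the quartic

quartic : ℚ → ℚ
quartic q = q ^ℚ 4 ℚ.- fromℕ 2 ℚ.* q ℚ.- 1ℚ

-- The divided difference of the quartic. On [1, 2] it stays between 1 and 30: the lower bound shows
-- that no root lies further right, the upper one that the values at the approximations tend to 0.
slope : ℚ → ℚ → ℚ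
slope x y = (((y ℚ.* y ℚ.* y ℚ.+ y ℚ.* y ℚ.* x) ℚ.+ y ℚ.* x ℚ.* x) ℚ.+ x ℚ.* x ℚ.* x) ℚ.- fromℕ 2

quartic-slope : ∀ x y → quartic y ≡ quartic x ℚ.+ (y ℚ.- x) ℚ.* slope x y
quartic-slope = solve 2 (λ x y →
    y :* (y :* (y :* (y :* con 1ℚ))) :- con (fromℕ 2) :* y :- con 1ℚ
    := (x :* (x :* (x :* (x :* con 1ℚ))) :- con (fromℕ 2) :* x :- con 1ℚ)
       :+ (y :- x) :* ((((y :* y :* y :+ y :* y :* x) :+ y :* x :* x) :+ x :* x :* x) :- con (fromℕ 2))) refl
  where open ℚSolver.+-*-Solver

cube-mono : ∀ {a x y z} → 0ℚ ℚ.≤ a → a ℚ.≤ x → a ℚ.≤ y → a ℚ.≤ z → a ℚ.* a ℚ.* a ℚ.≤ x ℚ.* y ℚ.* z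
cube-mono {a} 0≤a ax ay az = *-mono-≤ (subst (ℚ._≤ a ℚ.* a) (ℚ.*-zeroˡ 0ℚ) (*-mono-≤ ℚ.≤-refl 0≤a ℚ.≤-refl 0≤a))
  (*-mono-≤ 0≤a ax 0≤a ay) 0≤a az

0≤1 : 0ℚ ℚ.≤ 1ℚ
0≤1 = toWitness {a? = 0ℚ ℚ.≤? 1ℚ} _

cube-mono′ : ∀ {b x y z} → 1ℚ ℚ.≤ x → 1ℚ ℚ.≤ y → 1ℚ ℚ.≤ z → x ℚ.≤ b → y ℚ.≤ b → z ℚ.≤ b →
             x ℚ.* y ℚ.* z ℚ.≤ b ℚ.* b ℚ.* b
cube-mono′ {b} {x} {y} {z} 1x 1y 1z xb yb zb = *-mono-≤
  (subst (ℚ._≤ x ℚ.* y) (ℚ.*-zeroˡ 0ℚ) (*-mono-≤ ℚ.≤-refl (ℚ.≤-trans 0≤1 1x) ℚ.≤-refl (ℚ.≤-trans 0≤1 1y)))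
  (*-mono-≤ (ℚ.≤-trans 0≤1 1x) xb (ℚ.≤-trans 0≤1 1y) yb) (ℚ.≤-trans 0≤1 1z) zb

slope-lower : ∀ {x y} → 1ℚ ℚ.≤ x → 1ℚ ℚ.≤ y → 1ℚ ℚ.≤ slope x y
slope-lower 1≤x 1≤y = ℚ.≤-trans (toWitness {a? = 1ℚ ℚ.≤? slope 1ℚ 1ℚ} _)
  (ℚ.+-monoˡ-≤ (ℚ.- fromℕ 2) (ℚ.+-mono-≤ (ℚ.+-mono-≤ (ℚ.+-mono-≤
    (cube-mono 0≤1 1≤y 1≤y 1≤y) (cube-mono 0≤1 1≤y 1≤y 1≤x)) (cube-mono 0≤1 1≤y 1≤x 1≤x)) (cube-mono 0≤1 1≤x 1≤x 1≤x)))

slope-upper : ∀ {x y} → 1ℚ ℚ.≤ x → 1ℚ ℚ.≤ y → x ℚ.≤ fromℕ 2 → y ℚ.≤ fromℕ 2 → slope x y ℚ.≤ fromℕ 30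
slope-upper 1≤x 1≤y x≤2 y≤2 = ℚ.≤-trans
  (ℚ.+-monoˡ-≤ (ℚ.- fromℕ 2) (ℚ.+-mono-≤ (ℚ.+-mono-≤ (ℚ.+-mono-≤
    (cube-mono′ 1≤y 1≤y 1≤y y≤2 y≤2 y≤2) (cube-mono′ 1≤y 1≤y 1≤x y≤2 y≤2 x≤2))
    (cube-mono′ 1≤y 1≤x 1≤x y≤2 x≤2 x≤2)) (cube-mono′ 1≤x 1≤x 1≤x x≤2 x≤2 x≤2)))
  (toWitness {a? = slope (fromℕ 2) (fromℕ 2) ℚ.≤? fromℕ 30} _)

quartic-lower : ∀ {x y} → 1ℚ ℚ.≤ x → x ℚ.≤ y → quartic x ℚ.+ (y ℚ.- x) ℚ.≤ quartic y
quartic-lower {x} {y} 1≤x x≤y = subst₂ ℚ._≤_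
  (cong (quartic x ℚ.+_) (ℚ.*-identityʳ (y ℚ.- x))) (sym (quartic-slope x y))
  (ℚ.+-monoʳ-≤ (quartic x) (ℚ.*-monoˡ-≤-nonNeg (y ℚ.- x) {{ℚ.nonNegative (p≤q⇒0≤q-p x≤y)}}
    (slope-lower 1≤x (ℚ.≤-trans 1≤x x≤y))))

quartic-upper : ∀ {x y} → 1ℚ ℚ.≤ x → x ℚ.≤ y → y ℚ.≤ fromℕ 2 →
                quartic y ℚ.≤ quartic x ℚ.+ (y ℚ.- x) ℚ.* fromℕ 30
quartic-upper {x} {y} 1≤x x≤y y≤2 = subst (ℚ._≤ quartic x ℚ.+ (y ℚ.- x) ℚ.* fromℕ 30) (sym (quartic-slope x y))
  (ℚ.+-monoʳ-≤ (quartic x) (ℚ.*-monoˡ-≤-nonNeg (y ℚ.- x) {{ℚ.nonNegative (p≤q⇒0≤q-p x≤y)}}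
    (slope-upper 1≤x (ℚ.≤-trans 1≤x x≤y) (ℚ.≤-trans x≤y y≤2) y≤2)))

-- Length of the bracket after `k` halvings; the first bracket is [1.3953, 1.3955].
width : ℕ → ℚ
width zero    = + 1 ℚ./ 5000
width (suc k) = ½ ℚ.* width k

halves : ∀ k → width (suc k) ℚ.+ width (suc k) ≡ width k
halves k = solve 1 (λ w → con ½ :* w :+ con ½ :* w := w) refl (width k)
  where open ℚSolver.+-*-Solver

0≤width : ∀ k → 0ℚ ℚ.≤ width k
0≤width zero    = toWitness {a? = 0ℚ ℚ.≤? width 0} _
0≤width (suc k) = subst (ℚ._≤ ½ ℚ.* width k) (ℚ.*-zeroʳ ½)
  (ℚ.*-monoˡ-≤-nonNeg ½ (0≤width k))

p≤p+q : ∀ p {q} → 0ℚ ℚ.≤ q → p ℚ.≤ p ℚ.+ q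
p≤p+q p {q} 0≤q = subst (ℚ._≤ p ℚ.+ q) (ℚ.+-identityʳ p) (ℚ.+-monoʳ-≤ p 0≤q)

-- The weak rate 1/(k + 1) suffices and is the form that `archimedean` can use; it follows from k +
-- 2 ≤ 2 (k + 1).
width-bound : ∀ k → fromℕ (suc k) ℚ.* width k ℚ.≤ 1ℚ
width-bound zero    = toWitness {a? = fromℕ 1 ℚ.* width 0 ℚ.≤? 1ℚ} _
width-bound (suc k) = ℚ.≤-trans step (width-bound k)
  where
  open ℚSolver.+-*-Solver
  eq : ∀ a w → (a ℚ.+ a) ℚ.* (½ ℚ.* w) ≡ a ℚ.* w
  eq = solve 2 (λ a w → (a :+ a) :* (con ½ :* w) := a :* w) refl
  step : fromℕ (suc (suc k)) ℚ.* width (suc k) ℚ.≤ fromℕ (suc k) ℚ.* width k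
  step = subst (fromℕ (suc (suc k)) ℚ.* width (suc k) ℚ.≤_) (eq (fromℕ (suc k)) (width k))
    (ℚ.*-monoʳ-≤-nonNeg (width (suc k)) {{ℚ.nonNegative (0≤width (suc k))}}
      (subst (fromℕ (suc (suc k)) ℚ.≤_) (fromℕ-+ (suc k) (suc k)) (fromℕ-mono-≤ (s≤s (ℕ.m≤n+m (suc k) k)))))

width-small : ∀ ε → 0ℚ ℚ.< ε → ∃ λ k → width k ℚ.< ε
width-small ε 0<ε = let (k , 1<kε) = archimedean ε 0<ε in
  k , ℚ.*-cancelˡ-<-nonNeg (fromℕ (suc k)) {{ℚ.nonNegative (0≤fromℕ (suc k))}} (ℚ.≤-<-trans (width-bound k) 1<kε)

-- The left end of the bracket. Keeping this end makes every approximation, and not only the limit,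
-- at least 1.3953, so that the running time can be compared term by term.
bisect : ℕ → ℚ
bisect zero    = + 13953 ℚ./ 10000
bisect (suc k) with quartic (bisect k ℚ.+ width (suc k)) ℚ.≤? 0ℚ
... | yes _ = bisect k ℚ.+ width (suc k)
... | no  _ = bisect k

module _ (k : ℕ) where
  private
    reassoc : bisect k ℚ.+ width (suc k) ℚ.+ width (suc k) ≡ bisect k ℚ.+ width k
    reassoc = trans (ℚ.+-assoc (bisect k) (width (suc k)) (width (suc k))) (cong (bisect k ℚ.+_) (halves k))

  bisect-mono : bisect k ℚ.≤ bisect (suc k)
  bisect-mono with quartic (bisect k ℚ.+ width (suc k)) ℚ.≤? 0ℚ
  ... | yes _ = p≤p+q (bisect k) (0≤width (suc k))
  ... | no  _ = ℚ.≤-refl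

  bisect-anti : bisect (suc k) ℚ.+ width (suc k) ℚ.≤ bisect k ℚ.+ width k
  bisect-anti with quartic (bisect k ℚ.+ width (suc k)) ℚ.≤? 0ℚ
  ... | yes _ = ℚ.≤-reflexive reassoc
  ... | no  _ = ℚ.≤-trans (p≤p+q _ (0≤width (suc k))) (ℚ.≤-reflexive reassoc)

quartic-bisect≤0 : ∀ k → quartic (bisect k) ℚ.≤ 0ℚ
quartic-bisect≤0 zero = toWitness {a? = quartic (bisect 0) ℚ.≤? 0ℚ} _
quartic-bisect≤0 (suc k) with quartic (bisect k ℚ.+ width (suc k)) ℚ.≤? 0ℚ
... | yes p = p
... | no  _ = quartic-bisect≤0 k

0≤quartic-bisect+width : ∀ k → 0ℚ ℚ.≤ quartic (bisect k ℚ.+ width k)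
0≤quartic-bisect+width zero = toWitness {a? = 0ℚ ℚ.≤? quartic (bisect 0 ℚ.+ width 0)} _
0≤quartic-bisect+width (suc k) with quartic (bisect k ℚ.+ width (suc k)) ℚ.≤? 0ℚ
... | yes _ = subst (λ z → 0ℚ ℚ.≤ quartic z)
    (sym (trans (ℚ.+-assoc (bisect k) (width (suc k)) (width (suc k))) (cong (bisect k ℚ.+_) (halves k))))
    (0≤quartic-bisect+width k)
... | no ¬p = ℚ.<⇒≤ (ℚ.≰⇒> ¬p)

bisect-nested : ∀ {i j} → i ℕ.≤′ j → bisect i ℚ.≤ bisect j × bisect j ℚ.+ width j ℚ.≤ bisect i ℚ.+ width i
bisect-nested ℕ.≤′-refl = ℚ.≤-refl , ℚ.≤-refl
bisect-nested (ℕ.≤′-step {j} i≤j) = let (p , q) = bisect-nested i≤j in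
  ℚ.≤-trans p (bisect-mono j) , ℚ.≤-trans (bisect-anti j) q

bisect-upper : ∀ {i j} → i ≤ j → bisect j ℚ.≤ bisect i ℚ.+ width i
bisect-upper {i} {j} i≤j = ℚ.≤-trans (p≤p+q (bisect j) (0≤width j)) (proj₂ (bisect-nested (ℕ.≤⇒≤′ i≤j)))

bisect-lower : ∀ {i j} → i ≤ j → bisect i ℚ.≤ bisect j
bisect-lower i≤j = proj₁ (bisect-nested (ℕ.≤⇒≤′ i≤j))

difference-bound : ∀ {a w x y} → a ℚ.≤ y → x ℚ.≤ a ℚ.+ w → x ℚ.- y ℚ.≤ w
difference-bound {a} {w} {x} {y} a≤y x≤ = subst (x ℚ.- y ℚ.≤_) (eq a w)
  (ℚ.+-mono-≤ x≤ (ℚ.neg-antimono-≤ a≤y))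
  where
  open ℚSolver.+-*-Solver
  eq : ∀ a w → a ℚ.+ w ℚ.- a ≡ w
  eq = solve 2 (λ a w → a :+ w :- a := w) refl

neg-difference : ∀ x y → ℚ.- (x ℚ.- y) ≡ y ℚ.- x
neg-difference = solve 2 (λ x y → :- (x :- y) := y :- x) refl
  where open ℚSolver.+-*-Solver

bisect-cauchy : IsCauchy bisect
bisect-cauchy ε 0<ε = let (N , w<ε) = width-small ε 0<ε in N , λ i j N≤i N≤j →
  ℚ.≤-<-trans (close N i j N≤i N≤j (ℚ.∣p∣≡p∨∣p∣≡-p (bisect i ℚ.- bisect j))) w<ε
  where
  close : ∀ N i j → N ≤ i → N ≤ j → ℚ.∣ bisect i ℚ.- bisect j ∣ ≡ bisect i ℚ.- bisect j
          ⊎ ℚ.∣ bisect i ℚ.- bisect j ∣ ≡ ℚ.- (bisect i ℚ.- bisect j) → ℚ.∣ bisect i ℚ.- bisect j ∣ ℚ.≤ width N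
  close N i j N≤i N≤j (inj₁ e) = subst (ℚ._≤ width N) (sym e)
    (difference-bound (bisect-lower N≤j) (bisect-upper N≤i))
  close N i j N≤i N≤j (inj₂ e) = subst (ℚ._≤ width N) (sym (trans e (neg-difference (bisect i) (bisect j))))
    (difference-bound (bisect-lower N≤i) (bisect-upper N≤j))

root : ℝ
root = record { approx = bisect ; cauchy = bisect-cauchy }

lower≤bisect : ∀ k → + 13953 ℚ./ 10000 ℚ.≤ bisect k
lower≤bisect k = bisect-lower {0} {k} z≤n

bisect≤upper : ∀ k → bisect k ℚ.≤ + 13955 ℚ./ 10000
bisect≤upper k = ℚ.≤-trans (bisect-upper {0} {k} z≤n)
  (toWitness {a? = bisect 0 ℚ.+ width 0 ℚ.≤? + 13955 ℚ./ 10000} _)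

1≤bisect : ∀ k → 1ℚ ℚ.≤ bisect k
1≤bisect k = ℚ.≤-trans (toWitness {a? = 1ℚ ℚ.≤? + 13953 ℚ./ 10000} _) (lower≤bisect k)

≤⇒≤ᴿ : ∀ {x y : Sequence} → (∀ k → x k ℚ.≤ y k) → x ≤ᴿ y
≤⇒≤ᴿ {x} {y} x≤y ε 0<ε = 0 , λ i _ → ℚ.≤-trans (x≤y i) (p≤p+q (y i) (ℚ.<⇒≤ 0<ε))

-- Since bisect k + width k overshoots the root, - 30 * width k bounds the
-- value at bisect k from below.
quartic-bisect-small : ∀ k → 0ℚ ℚ.≤ quartic (bisect k) ℚ.+ width k ℚ.* fromℕ 30
quartic-bisect-small k = ℚ.≤-trans (0≤quartic-bisect+width k)
  (subst (λ z → quartic (bisect k ℚ.+ width k) ℚ.≤ quartic (bisect k) ℚ.+ z ℚ.* fromℕ 30) (eq (bisect k) (width k))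
    (quartic-upper (1≤bisect k) (p≤p+q (bisect k) (0≤width k))
      (ℚ.≤-trans (proj₂ (bisect-nested {0} (ℕ.≤⇒≤′ {0} {k} z≤n))) (toWitness {a? = bisect 0 ℚ.+ width 0 ℚ.≤? fromℕ 2} _))))
  where
  open ℚSolver.+-*-Solver
  eq : ∀ a w → a ℚ.+ w ℚ.- a ≡ w
  eq = solve 2 (λ a w → a :+ w :- a := w) refl

width-anti : ∀ {i j} → i ℕ.≤′ j → width j ℚ.≤ width i
width-anti ℕ.≤′-refl = ℚ.≤-refl
width-anti (ℕ.≤′-step {j} i≤j) = ℚ.≤-trans
  (subst (width (suc j) ℚ.≤_) (halves j) (p≤p+q (width (suc j)) (0≤width (suc j)))) (width-anti i≤j)

root-isPositiveRoot : IsPositiveRoot root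
root-isPositiveRoot =
  (1ℚ , toWitness {a? = 0ℚ ℚ.<? 1ℚ} _ , 0 , λ i _ → 1≤bisect i) , ≤⇒≤ᴿ quartic-bisect≤0 , vanish
  where
  vanish : const 0ℚ ≤ᴿ (λ i → quartic (bisect i))
  vanish ε 0<ε = let (N , w<ε) = width-small (ε ℚ.* (+ 1 ℚ./ 30)) (subst (ℚ._< ε ℚ.* (+ 1 ℚ./ 30)) (ℚ.*-zeroˡ (+ 1 ℚ./ 30)) (ℚ.*-monoˡ-<-pos (+ 1 ℚ./ 30) 0<ε))
    in N , λ i N≤i → ℚ.≤-trans (quartic-bisect-small i) (ℚ.+-monoʳ-≤ (quartic (bisect i))
         (ℚ.≤-trans (ℚ.*-monoʳ-≤-nonNeg (fromℕ 30) (ℚ.≤-trans (width-anti (ℕ.≤⇒≤′ N≤i)) (ℚ.<⇒≤ w<ε)))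
           (ℚ.≤-reflexive (eq ε))))
    where
    open ℚSolver.+-*-Solver
    eq : ∀ e → e ℚ.* (+ 1 ℚ./ 30) ℚ.* fromℕ 30 ≡ e
    eq = solve 1 (λ e → e :* con (+ 1 ℚ./ 30) :* con (fromℕ 30) := e) refl

-- Beyond the root the quartic grows at least as fast as the identity, so a
-- sequence on which it tends to 0 cannot stay above the root.
root-largest : ∀ y → IsPositiveRoot y → approx y ≤ᴿ bisect
root-largest y (_ , (py≤0 , _)) ε 0<ε =
  let ε/2 = ε ℚ.* ½
      0<ε/2 = subst (ℚ._< ε/2) (ℚ.*-zeroˡ ½) (ℚ.*-monoˡ-<-pos ½ 0<ε)
      (N₁ , w<)  = width-small ε/2 0<ε/2
      (N₂ , py≤) = py≤0 ε/2 0<ε/2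
  in N₁ ℕ.⊔ N₂ , λ i N≤i → case approx y i ℚ.≤? bisect i ℚ.+ ε of λ where
       (yes p) → p
       (no ¬p) → let z = bisect i ℚ.+ width i
                     wi< = ℚ.≤-<-trans (width-anti (ℕ.≤⇒≤′ (ℕ.m⊔n≤o⇒m≤o N₁ N₂ N≤i))) w<
                     z+ε/2<y = ℚ.≤-<-trans (ℚ.≤-reflexive (ℚ.+-assoc (bisect i) (width i) ε/2))
                        (ℚ.≤-<-trans (ℚ.+-monoʳ-≤ (bisect i) (subst (width i ℚ.+ ε/2 ℚ.≤_) (two ε) (ℚ.+-monoˡ-≤ ε/2 (ℚ.<⇒≤ wi<))))
                          (ℚ.≰⇒> ¬p))
                     z≤y = ℚ.≤-trans (p≤p+q z (ℚ.<⇒≤ 0<ε/2)) (ℚ.<⇒≤ z+ε/2<y)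
                     1≤z = ℚ.≤-trans (1≤bisect i) (p≤p+q (bisect i) (0≤width i))
                     ε/2<y-z = subst (ℚ._< approx y i ℚ.- z) (cancel z ε/2) (ℚ.+-monoˡ-< (ℚ.- z) z+ε/2<y)
                     ε/2<py = ℚ.<-≤-trans ε/2<y-z (ℚ.≤-trans (ℚ.≤-reflexive (sym (ℚ.+-identityˡ _)))
                        (ℚ.≤-trans (ℚ.+-monoˡ-≤ (approx y i ℚ.- z) (0≤quartic-bisect+width i)) (quartic-lower 1≤z z≤y)))
                 in ⊥-elim (ℚ.<-irrefl refl (ℚ.<-≤-trans ε/2<py (ℚ.≤-trans (py≤ i (ℕ.m⊔n≤o⇒n≤o N₁ N₂ N≤i)) (ℚ.≤-reflexive (ℚ.+-identityˡ ε/2)))))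
  where
  open ℚSolver.+-*-Solver
  two : ∀ e → e ℚ.* ½ ℚ.+ e ℚ.* ½ ≡ e
  two = solve 1 (λ e → e :* con ½ :+ e :* con ½ := e) refl
  cancel : ∀ z e → z ℚ.+ e ℚ.- z ≡ e
  cancel = solve 2 (λ z e → z :+ e :- z := e) refl

root-isLargest : IsLargestPositiveRoot root
root-isLargest = root-isPositiveRoot , root-largest

-- Reduces the real bound to one between naturals: each `bisect k` is at least 13953/10000, and
-- multiplying by 10000ⁿ clears denominators. The edge count enters through 1 ≤ m alone.
≤ᴿ-bound : ∀ {t c n m b} → 1 ≤ m → t * 10000 ^ n ≤ c * 13953 ^ n + c * b * 10000 ^ n →
           const (fromℕ t) ≤ᴿ (λ k → fromℕ c ℚ.* (fromℕ m ℚ.* (bisect k ^ℚ n) ℚ.+ fromℕ b))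
≤ᴿ-bound {t} {c} {n} {m} {b} 1≤m t≤ = ≤⇒≤ᴿ {const (fromℕ t)} {λ k → fromℕ c ℚ.* (fromℕ m ℚ.* (bisect k ^ℚ n) ℚ.+ fromℕ b)} λ k → ℚ.*-cancelʳ-≤-pos (fromℕ (10000 ^ n)) {{ℚ.positive 0<D}} (begin
  fromℕ t ℚ.* D                                                     ≡⟨ fromℕ-* t (10000 ^ n) ⟨
  fromℕ (t * 10000 ^ n)                                             ≤⟨ fromℕ-mono-≤ t≤ ⟩
  fromℕ (c * 13953 ^ n + c * b * 10000 ^ n)                         ≡⟨ trans (fromℕ-+ (c * 13953 ^ n) (c * b * 10000 ^ n))
                                                                       (cong₂ ℚ._+_ (fromℕ-* c (13953 ^ n)) (trans (fromℕ-* (c * b) (10000 ^ n)) (cong (ℚ._* D) (fromℕ-* c b)))) ⟩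
  fromℕ c ℚ.* fromℕ (13953 ^ n) ℚ.+ fromℕ c ℚ.* fromℕ b ℚ.* D        ≡⟨ cong (λ z → fromℕ c ℚ.* z ℚ.+ fromℕ c ℚ.* fromℕ b ℚ.* D) (power n) ⟩
  fromℕ c ℚ.* ((+ 13953 ℚ./ 10000) ^ℚ n ℚ.* D) ℚ.+ fromℕ c ℚ.* fromℕ b ℚ.* D
                                                                    ≤⟨ ℚ.+-monoˡ-≤ (fromℕ c ℚ.* fromℕ b ℚ.* D)
                                                                       (ℚ.*-monoˡ-≤-nonNeg (fromℕ c) {{ℚ.nonNegative (0≤fromℕ c)}}
                                                                         (ℚ.*-monoʳ-≤-nonNeg D {{ℚ.nonNegative (0≤fromℕ (10000 ^ n))}} (dominated k))) ⟩
  fromℕ c ℚ.* (fromℕ m ℚ.* (bisect k ^ℚ n) ℚ.* D) ℚ.+ fromℕ c ℚ.* fromℕ b ℚ.* D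
                                                                    ≡⟨ factor (fromℕ c) (fromℕ m ℚ.* (bisect k ^ℚ n)) (fromℕ b) D ⟩
  fromℕ c ℚ.* (fromℕ m ℚ.* (bisect k ^ℚ n) ℚ.+ fromℕ b) ℚ.* D         ∎)
  where
  open ℚ.≤-Reasoning
  D : ℚ
  D = fromℕ (10000 ^ n)
  0<D : 0ℚ ℚ.< D
  0<D = ℚ.<-≤-trans (toWitness {a? = 0ℚ ℚ.<? fromℕ 1} _) (fromℕ-mono-≤ (ℕ.m^n>0 10000 n))
  factor : ∀ c x b d → c ℚ.* (x ℚ.* d) ℚ.+ c ℚ.* b ℚ.* d ≡ c ℚ.* (x ℚ.+ b) ℚ.* d
  factor = solve 4 (λ c x b d → c :* (x :* d) :+ c :* b :* d := c :* (x :+ b) :* d) refl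
    where open ℚSolver.+-*-Solver
  interchange : ∀ a b c d → (a ℚ.* b) ℚ.* (c ℚ.* d) ≡ (a ℚ.* c) ℚ.* (b ℚ.* d)
  interchange = solve 4 (λ a b c d → (a :* b) :* (c :* d) := (a :* c) :* (b :* d)) refl
    where open ℚSolver.+-*-Solver
  power : ∀ n → fromℕ (13953 ^ n) ≡ (+ 13953 ℚ./ 10000) ^ℚ n ℚ.* fromℕ (10000 ^ n)
  power zero    = refl
  power (suc n) = begin-equality
    fromℕ (13953 * 13953 ^ n)                                ≡⟨ fromℕ-* 13953 (13953 ^ n) ⟩
    fromℕ 13953 ℚ.* fromℕ (13953 ^ n)                        ≡⟨ cong (fromℕ 13953 ℚ.*_) (power n) ⟩
    q ℚ.* fromℕ 10000 ℚ.* (q ^ℚ n ℚ.* fromℕ (10000 ^ n))      ≡⟨ interchange q (fromℕ 10000) (q ^ℚ n) (fromℕ (10000 ^ n)) ⟩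
    q ^ℚ suc n ℚ.* (fromℕ 10000 ℚ.* fromℕ (10000 ^ n))        ≡⟨ cong (q ^ℚ suc n ℚ.*_) (fromℕ-* 10000 (10000 ^ n)) ⟨
    q ^ℚ suc n ℚ.* fromℕ (10000 * 10000 ^ n)                 ∎
    where
    q : ℚ
    q = + 13953 ℚ./ 10000
  dominated : ∀ k → (+ 13953 ℚ./ 10000) ^ℚ n ℚ.≤ fromℕ m ℚ.* (bisect k ^ℚ n)
  dominated k = subst (ℚ._≤ fromℕ m ℚ.* (bisect k ^ℚ n)) (ℚ.*-identityˡ _)
    (let (p , q) = ^-mono-≤ n (toWitness {a? = 0ℚ ℚ.≤? + 13953 ℚ./ 10000} _) (lower≤bisect k)
     in *-mono-≤ 0≤1 (fromℕ-mono-≤ 1≤m) p q)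

private variable
  A B : Set

-- Duplicate-free lists

-- The pigeonhole principle. It turns every count below, of lost candidates as well as of listed
-- bicliques, into an argument about membership.
Unique-⊆⇒length≤ : {xs ys : List A} → Unique xs → xs ⊆ ys → length xs ≤ length ys
Unique-⊆⇒length≤ {xs = []} _ _ = z≤n
Unique-⊆⇒length≤ {xs = x ∷ xs} (x∉ ∷ u) sub with ∈-∃++ (sub (here refl))
... | as , bs , refl = subst (suc (length xs) ≤_)
    (sym (trans (length-++ as) (trans (ℕ.+-suc (length as) (length bs)) (cong suc (sym (length-++ as))))))
    (s≤s (Unique-⊆⇒length≤ u without))
  where
  without : xs ⊆ as ++ bs
  without {z} z∈xs with ∈-++⁻ as (sub (there z∈xs))
  ... | inj₁ z∈as         = ∈-++⁺ˡ z∈as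
  ... | inj₂ (here refl)  = contradiction refl (All.lookup x∉ z∈xs)
  ... | inj₂ (there z∈bs) = ∈-++⁺ʳ as z∈bs

Unique-++⁺ : {xs ys : List A} → Unique xs → Unique ys → (∀ {x} → x ∈ xs → x ∉ ys) → Unique (xs ++ ys)
Unique-++⁺ u v disjoint = Unique.++⁺ u v (λ (x∈xs , x∈ys) → disjoint x∈xs x∈ys)

Unique-∷⁺ : {x : A} {xs : List A} → x ∉ xs → Unique xs → Unique (x ∷ xs)
Unique-∷⁺ x∉ u = All.tabulate (λ { y∈ refl → x∉ y∈ }) ∷ u

Unique-∷⁻ : {x : A} {xs : List A} → Unique (x ∷ xs) → x ∉ xs
Unique-∷⁻ (x∉ ∷ _) x∈ = All.lookup x∉ x∈ refl

module _ (p : A → Bool) where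

  ∈-filterᵇ⁺ : ∀ {x xs} → x ∈ xs → p x ≡ true → x ∈ filterᵇ p xs
  ∈-filterᵇ⁺ {xs = y ∷ ys} (here refl) px rewrite px = here refl
  ∈-filterᵇ⁺ {xs = y ∷ ys} (there x∈) px with p y
  ... | true  = there (∈-filterᵇ⁺ x∈ px)
  ... | false = ∈-filterᵇ⁺ x∈ px

  ∈-filterᵇ⁻ : ∀ {x} xs → x ∈ filterᵇ p xs → x ∈ xs × p x ≡ true
  ∈-filterᵇ⁻ (y ∷ ys) x∈ with p y in eq
  ∈-filterᵇ⁻ (y ∷ ys) x∈          | false = let (a , b) = ∈-filterᵇ⁻ ys x∈ in there a , b
  ∈-filterᵇ⁻ (y ∷ ys) (here refl) | true  = here refl , eq
  ∈-filterᵇ⁻ (y ∷ ys) (there x∈)  | true  = let (a , b) = ∈-filterᵇ⁻ ys x∈ in there a , b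

  Unique-filterᵇ⁺ : ∀ {xs} → Unique xs → Unique (filterᵇ p xs)
  Unique-filterᵇ⁺ {[]} u = u
  Unique-filterᵇ⁺ {y ∷ ys} u@(_ ∷ u′) with p y
  ... | true  = Unique-∷⁺ (λ y∈ → Unique-∷⁻ u (proj₁ (∈-filterᵇ⁻ ys y∈))) (Unique-filterᵇ⁺ u′)
  ... | false = Unique-filterᵇ⁺ u′

  length-filterᵇ-≤ : ∀ xs → length (filterᵇ p xs) ≤ length xs
  length-filterᵇ-≤ [] = z≤n
  length-filterᵇ-≤ (x ∷ xs) with p x
  ... | true  = s≤s (length-filterᵇ-≤ xs)
  ... | false = ℕ.m≤n⇒m≤1+n (length-filterᵇ-≤ xs)

  length-filterᵇ-none : ∀ xs → length (filterᵇ p xs) ≡ 0 → ∀ {x} → x ∈ xs → p x ≡ false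
  length-filterᵇ-none (y ∷ ys) e x∈ with p y in eq
  length-filterᵇ-none (y ∷ ys) e (here refl) | false = eq
  length-filterᵇ-none (y ∷ ys) e (there x∈)  | false = length-filterᵇ-none ys e x∈

  length-filterᵇ-some : ∀ xs → 1 ≤ length (filterᵇ p xs) → ∃ λ x → x ∈ xs × p x ≡ true
  length-filterᵇ-some (y ∷ ys) le with p y in eq
  ... | true  = y , here refl , eq
  ... | false = let (x , x∈ , px) = length-filterᵇ-some ys le in x , there x∈ , px

  length-filterᵇ-pos : ∀ {x xs} → x ∈ xs → p x ≡ true → 1 ≤ length (filterᵇ p xs)
  length-filterᵇ-pos {xs = xs} x∈ px with filterᵇ p xs | ∈-filterᵇ⁺ x∈ px
  ... | _ ∷ _ | _ = s≤s z≤n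

  filterᵇ-complement : ∀ xs → length (filterᵇ p xs) + length (filterᵇ (λ x → not (p x)) xs) ≡ length xs
  filterᵇ-complement [] = refl
  filterᵇ-complement (x ∷ xs) with p x
  ... | true  = cong suc (filterᵇ-complement xs)
  ... | false = trans (ℕ.+-suc _ _) (cong suc (filterᵇ-complement xs))

filterᵇ-cong : {p q : A → Bool} → (∀ x → p x ≡ q x) → ∀ xs → filterᵇ p xs ≡ filterᵇ q xs
filterᵇ-cong {p = p} {q} e [] = refl
filterᵇ-cong {p = p} {q} e (x ∷ xs) with p x | q x | e x
... | true  | .true  | refl = cong (x ∷_) (filterᵇ-cong e xs)
... | false | .false | refl = filterᵇ-cong e xs

-- Exponential weights

-- N ≤ 64 ρᵐ for ρ = 1303 / 1250.  Here ρ⁸ ≈ 1.39404 is just below the root, and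
-- 64 is large enough for the slack in all uses of admissible.
record Fits (N m : ℕ) : Set where
  constructor fits
  field
    bound : N * 1250 ^ m ≤ 64 * 1303 ^ m


-- N ≤ 64 ρ^(M - d). The witness `m` replaces a truncated subtraction, so that d ≤ M comes with it.
Below : ℕ → ℕ → ℕ → Set
Below N d M = ∃ λ m → m + d ≤ M × Fits N m

^-lift : ∀ {m n} → m ≤ n → 1250 ^ n * 1303 ^ m ≤ 1303 ^ n * 1250 ^ m
^-lift {m} {n} m≤n = begin
  1250 ^ n * 1303 ^ m                    ≡⟨ cong (λ z → 1250 ^ z * 1303 ^ m) n≡ ⟩
  1250 ^ (m + (n ∸ m)) * 1303 ^ m        ≡⟨ cong (_* 1303 ^ m) (ℕ.^-distribˡ-+-* 1250 m (n ∸ m)) ⟩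
  1250 ^ m * 1250 ^ (n ∸ m) * 1303 ^ m   ≤⟨ ℕ.*-monoˡ-≤ (1303 ^ m) (ℕ.*-monoʳ-≤ (1250 ^ m) (ℕ.^-monoˡ-≤ (n ∸ m) (ℕ.≤ᵇ⇒≤ 1250 1303 tt))) ⟩
  1250 ^ m * 1303 ^ (n ∸ m) * 1303 ^ m   ≡⟨ solve 3 (λ x y z → x :* y :* z := z :* y :* x) refl (1250 ^ m) (1303 ^ (n ∸ m)) (1303 ^ m) ⟩
  1303 ^ m * 1303 ^ (n ∸ m) * 1250 ^ m   ≡⟨ cong (_* 1250 ^ m) (ℕ.^-distribˡ-+-* 1303 m (n ∸ m)) ⟨
  1303 ^ (m + (n ∸ m)) * 1250 ^ m        ≡⟨ cong (λ z → 1303 ^ z * 1250 ^ m) n≡ ⟨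
  1303 ^ n * 1250 ^ m                    ∎
  where
  open ℕ.≤-Reasoning
  open ℕSolver.+-*-Solver
  n≡ : n ≡ m + (n ∸ m)
  n≡ = sym (ℕ.m+[n∸m]≡n m≤n)

Fits-mono : ∀ {N m n} → m ≤ n → Fits N m → Fits N n
Fits-mono {N} {m} {n} m≤n f = fits (ℕ.*-cancelʳ-≤ (N * 1250 ^ n) (64 * 1303 ^ n) (1303 ^ m) {{ℕ.m^n≢0 1303 m}} (begin
  N * 1250 ^ n * 1303 ^ m      ≡⟨ ℕ.*-assoc N (1250 ^ n) (1303 ^ m) ⟩
  N * (1250 ^ n * 1303 ^ m)    ≤⟨ ℕ.*-monoʳ-≤ N (^-lift m≤n) ⟩
  N * (1303 ^ n * 1250 ^ m)    ≡⟨ solve 3 (λ x y z → x :* (y :* z) := y :* (x :* z)) refl N (1303 ^ n) (1250 ^ m) ⟩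
  1303 ^ n * (N * 1250 ^ m)    ≤⟨ ℕ.*-monoʳ-≤ (1303 ^ n) (Fits.bound f) ⟩
  1303 ^ n * (64 * 1303 ^ m)   ≡⟨ solve 3 (λ x y z → x :* (y :* z) := y :* x :* z) refl (1303 ^ n) 64 (1303 ^ m) ⟩
  64 * 1303 ^ n * 1303 ^ m     ∎))
  where
  open ℕ.≤-Reasoning
  open ℕSolver.+-*-Solver

Fits-0 : ∀ m → Fits 0 m
Fits-0 m = fits z≤n

Fits-1 : ∀ m → Fits 1 m
Fits-1 m = fits (ℕ.*-mono-≤ {1} {64} (s≤s z≤n) (ℕ.^-monoˡ-≤ m (ℕ.≤ᵇ⇒≤ 1250 1303 tt)))

Below-weaken : ∀ {N d M} e → e ≤ d → Below N d M → Below N e M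
Below-weaken e e≤d (m , m+d≤M , f) = m , ℕ.≤-trans (ℕ.+-monoʳ-≤ m e≤d) m+d≤M , f

Below-step : ∀ {N d M M′} e → M + e ≤ M′ → Below N d M → Below N (e + d) M′
Below-step {N} {d} {M} {M′} e M+e≤M′ (m , m+d≤M , f) = m , (begin
  m + (e + d)  ≡⟨ cong (λ z → m + z) (ℕ.+-comm e d) ⟩
  m + (d + e)  ≡⟨ ℕ.+-assoc m d e ⟨
  m + d + e    ≤⟨ ℕ.+-monoˡ-≤ e m+d≤M ⟩
  M + e        ≤⟨ M+e≤M′ ⟩
  M′           ∎) , f
  where open ℕ.≤-Reasoning

Below⇒≤ : ∀ {N d M} → Below N d M → d ≤ M
Below⇒≤ {d = d} (m , m+d≤M , _) = ℕ.≤-trans (ℕ.m≤n+m d m) m+d≤M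

Below⇒Fits : ∀ {N d M} → Below N d M → Fits N M
Below⇒Fits {N} {d} (m , m+d≤M , f) = Fits-mono (ℕ.≤-trans (ℕ.m≤m+n m d) m+d≤M) f

-- ρ^(- d) scaled by 1303^K · 1250^(- e), which is an integer when e ≤ d ≤ K.
charge : ℕ → ℕ → ℕ → ℕ
charge e K d = 1303 ^ (K ∸ d) * 1250 ^ (d ∸ e)

-- Divided by 64 · 1303^K · 1250^(- e), the second part reads
-- ρ^(- K) / 64 + Σ ρ^(- d) ≤ ρ^(- e), where the first term counts the branch itself.
admissible : ℕ → ℕ → List ℕ → Bool
admissible e K ds = all (λ d → (e ≤ᵇ d) ∧ (d ≤ᵇ K)) ds
  ∧ (1250 ^ (K ∸ e) + 64 * sum (map (charge e K) ds) ≤ᵇ 64 * 1303 ^ (K ∸ e))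

module _ (e K m : ℕ) where
  private
    charged : ∀ {N d} → e ≤ d → d ≤ K → Below N d (m + K) →
              N * 1250 ^ (m + (K ∸ e)) ≤ 1303 ^ m * (64 * charge e K d)
    charged {N} {d} e≤d d≤K (m′ , m′+d≤ , f) = begin
      N * 1250 ^ (m + (K ∸ e))                             ≡⟨ cong (λ z → N * 1250 ^ z) split ⟩
      N * 1250 ^ (m + (K ∸ d) + (d ∸ e))                   ≡⟨ cong (N *_) (ℕ.^-distribˡ-+-* 1250 (m + (K ∸ d)) (d ∸ e)) ⟩
      N * (1250 ^ (m + (K ∸ d)) * 1250 ^ (d ∸ e))          ≡⟨ ℕ.*-assoc N (1250 ^ (m + (K ∸ d))) (1250 ^ (d ∸ e)) ⟨
      N * 1250 ^ (m + (K ∸ d)) * 1250 ^ (d ∸ e)            ≤⟨ ℕ.*-monoˡ-≤ (1250 ^ (d ∸ e)) (Fits.bound (Fits-mono m′≤ f)) ⟩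
      64 * 1303 ^ (m + (K ∸ d)) * 1250 ^ (d ∸ e)           ≡⟨ cong (λ z → 64 * z * 1250 ^ (d ∸ e)) (ℕ.^-distribˡ-+-* 1303 m (K ∸ d)) ⟩
      64 * (1303 ^ m * 1303 ^ (K ∸ d)) * 1250 ^ (d ∸ e)    ≡⟨ solve 4 (λ c x y z → c :* (x :* y) :* z := x :* (c :* (y :* z))) refl
                                                               64 (1303 ^ m) (1303 ^ (K ∸ d)) (1250 ^ (d ∸ e)) ⟩
      1303 ^ m * (64 * charge e K d)                       ∎
      where
      open ℕ.≤-Reasoning
      open ℕSolver.+-*-Solver
      split : m + (K ∸ e) ≡ m + (K ∸ d) + (d ∸ e)
      split = trans (cong (λ z → m + z) (trans (cong (_∸ e) (sym (ℕ.m∸n+n≡m d≤K))) (ℕ.+-∸-assoc (K ∸ d) e≤d)))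
                (sym (ℕ.+-assoc m (K ∸ d) (d ∸ e)))
      m′≤ : m′ ≤ m + (K ∸ d)
      m′≤ = ℕ.≤-trans (ℕ.m+n≤o⇒m≤o∸n m′ m′+d≤) (ℕ.≤-reflexive (ℕ.+-∸-assoc m d≤K))

    charged-sum : ∀ Ns ds → Pointwise (λ N d → Below N d (m + K)) Ns ds →
                  T (all (λ d → (e ≤ᵇ d) ∧ (d ≤ᵇ K)) ds) →
                  sum Ns * 1250 ^ (m + (K ∸ e)) ≤ 1303 ^ m * (64 * sum (map (charge e K) ds))
    charged-sum _ _ [] _ = z≤n
    charged-sum (N ∷ Ns) (d ∷ ds) (b ∷ bs) ok =
      let (dK , oks) = Equivalence.to T-∧ ok
          (ed , dk) = Equivalence.to T-∧ dK
      in begin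
        (N + sum Ns) * R                  ≡⟨ ℕ.*-distribʳ-+ R N (sum Ns) ⟩
        N * R + sum Ns * R                ≤⟨ ℕ.+-mono-≤ (charged {N} (ℕ.≤ᵇ⇒≤ e d ed) (ℕ.≤ᵇ⇒≤ d K dk) b) (charged-sum Ns ds bs oks) ⟩
        1303 ^ m * (64 * charge e K d) + 1303 ^ m * (64 * sum (map (charge e K) ds))
                                          ≡⟨ solve 4 (λ P c x y → P :* (c :* x) :+ P :* (c :* y) := P :* (c :* (x :+ y))) refl
                                               (1303 ^ m) 64 (charge e K d) (sum (map (charge e K) ds)) ⟩
        1303 ^ m * (64 * (charge e K d + sum (map (charge e K) ds))) ∎
      where
      open ℕ.≤-Reasoning
      open ℕSolver.+-*-Solver
      R : ℕ
      R = 1250 ^ (m + (K ∸ e))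

  Fits-branch′ : ∀ {Ns ds} → Pointwise (λ N d → Below N d (m + K)) Ns ds → T (admissible e K ds) →
                 Fits (suc (sum Ns)) (m + (K ∸ e))
  Fits-branch′ {Ns} {ds} bs ok = fits (begin
    R + sum Ns * R                                                   ≤⟨ ℕ.+-mono-≤ unit (charged-sum Ns ds bs (proj₁ oks)) ⟩
    1303 ^ m * 1250 ^ (K ∸ e) + 1303 ^ m * (64 * sum (map (charge e K) ds))
                                                                     ≡⟨ ℕ.*-distribˡ-+ (1303 ^ m) _ _ ⟨
    1303 ^ m * (1250 ^ (K ∸ e) + 64 * sum (map (charge e K) ds))     ≤⟨ ℕ.*-monoʳ-≤ (1303 ^ m) (ℕ.≤ᵇ⇒≤ _ _ (proj₂ oks)) ⟩
    1303 ^ m * (64 * 1303 ^ (K ∸ e))                                 ≡⟨ solve 3 (λ P c x → P :* (c :* x) := c :* (P :* x)) refl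
                                                                          (1303 ^ m) 64 (1303 ^ (K ∸ e)) ⟩
    64 * (1303 ^ m * 1303 ^ (K ∸ e))                                 ≡⟨ cong (64 *_) (ℕ.^-distribˡ-+-* 1303 m (K ∸ e)) ⟨
    64 * 1303 ^ (m + (K ∸ e))                                        ∎)
    where
    open ℕ.≤-Reasoning
    open ℕSolver.+-*-Solver
    R : ℕ
    R = 1250 ^ (m + (K ∸ e))
    oks = Equivalence.to (T-∧ {all (λ d → (e ≤ᵇ d) ∧ (d ≤ᵇ K)) ds}) ok
    -- The branch itself counts 1, against the factor 64 carried by the children.
    unit : R ≤ 1303 ^ m * 1250 ^ (K ∸ e)
    unit = ℕ.≤-trans (ℕ.≤-reflexive (ℕ.^-distribˡ-+-* 1250 m (K ∸ e)))
      (ℕ.*-monoˡ-≤ (1250 ^ (K ∸ e)) (ℕ.^-monoˡ-≤ m (ℕ.≤ᵇ⇒≤ 1250 1303 tt)))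

-- `K` is the largest drop, so K ≤ M can be read off the child that attains it. The offset `e` is
-- the bonus that the branch keeps for its parent.
Below-branch : ∀ e K ds {M Ns} → Pointwise (λ N d → Below N d M) Ns ds → e ≤ K → K ≤ M →
               T (admissible e K ds) → Below (suc (sum Ns)) e M
Below-branch e K ds {M} bs e≤K K≤M ok = (M ∸ K) + (K ∸ e) ,
  ℕ.≤-reflexive (trans (ℕ.+-assoc (M ∸ K) (K ∸ e) e) (trans (cong (λ z → (M ∸ K) + z) (ℕ.m∸n+n≡m e≤K)) (ℕ.m∸n+n≡m K≤M))) ,
  Fits-branch′ e K (M ∸ K) (subst (λ z → Pointwise (λ N d → Below N d z) _ _) (sym (ℕ.m∸n+n≡m K≤M)) bs) ok

-- With j = 5 + i this says (j + 1/64) ρ^(- 8 j) ≤ 1: j children that lose j candidates each are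
-- affordable once j ≥ 5. The case j = 5 is a computation. From j to j + 1 the first factor grows by
-- at most 6/5, whereas ρ⁸ exceeds 6/5.
wide-admissible : ∀ i → 1250 ^ (8 * (5 + i)) * (1 + 64 * (5 + i)) ≤ 64 * 1303 ^ (8 * (5 + i))
wide-admissible i = subst₂ (λ x y → x * (1 + 64 * (5 + i)) ≤ 64 * y) (ℕ.^-*-assoc 1250 8 (5 + i)) (ℕ.^-*-assoc 1303 8 (5 + i)) (go i)
  where
  grow : ∀ a b x y k → 6 * a ≤ 5 * b → x * (1 + 64 * (5 + k)) ≤ 64 * y → a * x * (1 + 64 * (6 + k)) ≤ 64 * (b * y)
  grow a b x y k 6a≤5b ih = ℕ.*-cancelˡ-≤ 5 (begin
    5 * (a * x * (1 + 64 * (6 + k)))        ≡⟨ solve 3 (λ a x k → con 5 :* (a :* x :* (con 1 :+ con 64 :* (con 6 :+ k)))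
                                                  := a :* x :* (con 1925 :+ con 320 :* k)) refl a x k ⟩
    a * x * (1925 + 320 * k)                ≤⟨ ℕ.*-monoʳ-≤ (a * x) (ℕ.+-mono-≤ (ℕ.≤ᵇ⇒≤ 1925 1926 tt) (ℕ.*-monoˡ-≤ k (ℕ.≤ᵇ⇒≤ 320 384 tt))) ⟩
    a * x * (1926 + 384 * k)                ≡⟨ solve 3 (λ a x k → a :* x :* (con 1926 :+ con 384 :* k)
                                                  := con 6 :* a :* (x :* (con 1 :+ con 64 :* (con 5 :+ k)))) refl a x k ⟩
    6 * a * (x * (1 + 64 * (5 + k)))        ≤⟨ ℕ.*-mono-≤ 6a≤5b ih ⟩
    5 * b * (64 * y)                        ≡⟨ solve 2 (λ b y → con 5 :* b :* (con 64 :* y) := con 5 :* (con 64 :* (b :* y))) refl b y ⟩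
    5 * (64 * (b * y))                      ∎)
    where
    open ℕ.≤-Reasoning
    open ℕSolver.+-*-Solver
  go : ∀ i → (1250 ^ 8) ^ (5 + i) * (1 + 64 * (5 + i)) ≤ 64 * (1303 ^ 8) ^ (5 + i)
  go zero    = ℕ.≤ᵇ⇒≤ _ _ tt
  go (suc i) = grow (1250 ^ 8) (1303 ^ 8) ((1250 ^ 8) ^ (5 + i)) ((1303 ^ 8) ^ (5 + i)) i (ℕ.≤ᵇ⇒≤ _ _ tt) (go i)

Below-wide : ∀ i {M Ns} → All (λ N → Below N (8 * (5 + i)) M) Ns → length Ns ≤ 5 + i → 8 * (5 + i) ≤ M →
             Below (suc (sum Ns)) 0 M
Below-wide i {M} {Ns} bs len D≤M = M , ℕ.≤-reflexive (ℕ.+-identityʳ M) , fits (begin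
  suc (sum Ns) * 1250 ^ M                                     ≡⟨ cong (λ z → suc (sum Ns) * 1250 ^ z) M≡ ⟩
  suc (sum Ns) * 1250 ^ (m + D)                               ≡⟨ cong (suc (sum Ns) *_) (ℕ.^-distribˡ-+-* 1250 m D) ⟩
  suc (sum Ns) * (1250 ^ m * 1250 ^ D)                        ≡⟨ solve 3 (λ s x y → (con 1 :+ s) :* (x :* y) := (x :+ s :* x) :* y) refl (sum Ns) (1250 ^ m) (1250 ^ D) ⟩
  (1250 ^ m + sum Ns * 1250 ^ m) * 1250 ^ D                   ≤⟨ ℕ.*-monoˡ-≤ (1250 ^ D) (ℕ.+-mono-≤ (ℕ.^-monoˡ-≤ m (ℕ.≤ᵇ⇒≤ 1250 1303 tt)) (total Ns bs)) ⟩
  (1303 ^ m + length Ns * (64 * 1303 ^ m)) * 1250 ^ D         ≤⟨ ℕ.*-monoˡ-≤ (1250 ^ D) (ℕ.+-monoʳ-≤ (1303 ^ m) (ℕ.*-monoˡ-≤ (64 * 1303 ^ m) len)) ⟩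
  (1303 ^ m + (5 + i) * (64 * 1303 ^ m)) * 1250 ^ D           ≡⟨ solve 3 (λ P j R → (P :+ j :* (con 64 :* P)) :* R := P :* (R :* (con 1 :+ con 64 :* j))) refl (1303 ^ m) (5 + i) (1250 ^ D) ⟩
  1303 ^ m * (1250 ^ D * (1 + 64 * (5 + i)))                  ≤⟨ ℕ.*-monoʳ-≤ (1303 ^ m) (wide-admissible i) ⟩
  1303 ^ m * (64 * 1303 ^ D)                                  ≡⟨ solve 2 (λ x y → x :* (con 64 :* y) := con 64 :* (x :* y)) refl (1303 ^ m) (1303 ^ D) ⟩
  64 * (1303 ^ m * 1303 ^ D)                                  ≡⟨ cong (64 *_) (ℕ.^-distribˡ-+-* 1303 m D) ⟨
  64 * 1303 ^ (m + D)                                         ≡⟨ cong (λ z → 64 * 1303 ^ z) M≡ ⟨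
  64 * 1303 ^ M                                               ∎)
  where
  open ℕ.≤-Reasoning
  open ℕSolver.+-*-Solver
  D m : ℕ
  D = 8 * (5 + i)
  m = M ∸ D
  M≡ : M ≡ m + D
  M≡ = sym (ℕ.m∸n+n≡m D≤M)
  total : ∀ Ns → All (λ N → Below N D M) Ns → sum Ns * 1250 ^ m ≤ length Ns * (64 * 1303 ^ m)
  total [] [] = z≤n
  total (N ∷ Ns) ((m′ , m′+D≤M , f) ∷ bs) = begin
    (N + sum Ns) * 1250 ^ m             ≡⟨ ℕ.*-distribʳ-+ (1250 ^ m) N (sum Ns) ⟩
    N * 1250 ^ m + sum Ns * 1250 ^ m    ≤⟨ ℕ.+-mono-≤ (Fits.bound (Fits-mono (ℕ.m+n≤o⇒m≤o∸n m′ m′+D≤M) f)) (total Ns bs) ⟩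
    64 * 1303 ^ m + length Ns * (64 * 1303 ^ m) ∎


-- Polynomial factors

-- Bernoulli's inequality 1 + n/a ≤ (1 + 1/a)ⁿ without denominators.
bernoulli : ∀ a n → (n + a) * a ^ n ≤ a * suc a ^ n
bernoulli a zero    = ℕ.≤-refl
bernoulli a (suc n) = begin
  (suc n + a) * (a * a ^ n)     ≡⟨ solve 3 (λ n a x → (con 1 :+ n :+ a) :* (a :* x) := ((con 1 :+ n :+ a) :* a) :* x) refl n a (a ^ n) ⟩
  (suc n + a) * a * a ^ n       ≤⟨ ℕ.*-monoˡ-≤ (a ^ n) (ℕ.m≤m+n ((suc n + a) * a) n) ⟩
  ((suc n + a) * a + n) * a ^ n ≡⟨ solve 3 (λ n a x → ((con 1 :+ n :+ a) :* a :+ n) :* x := (con 1 :+ a) :* ((n :+ a) :* x)) refl n a (a ^ n) ⟩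
  suc a * ((n + a) * a ^ n)     ≤⟨ ℕ.*-monoʳ-≤ (suc a) (bernoulli a n) ⟩
  suc a * (a * suc a ^ n)       ≡⟨ solve 3 (λ s a x → s :* (a :* x) := a :* (s :* x)) refl (suc a) a (suc a ^ n) ⟩
  a * (suc a * suc a ^ n)       ∎
  where
  open ℕ.≤-Reasoning
  open ℕSolver.+-*-Solver

^-distribʳ-* : ∀ n x y → (x * y) ^ n ≡ x ^ n * y ^ n
^-distribʳ-* zero    x y = refl
^-distribʳ-* (suc n) x y = trans (cong (x * y *_) (^-distribʳ-* n x y))
  (solve 4 (λ x y a b → x :* y :* (a :* b) := x :* a :* (y :* b)) refl x y (x ^ n) (y ^ n))
  where open ℕSolver.+-*-Solver

^-swap : ∀ a m n → (a ^ m) ^ n ≡ (a ^ n) ^ m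
^-swap a m n = trans (ℕ.^-*-assoc a m n) (trans (cong (a ^_) (ℕ.*-comm m n)) (sym (ℕ.^-*-assoc a n m)))

-- Put ρ = b/a and δ = r/q. From N ≤ A ρ^(8 n) and s ≤ q δⁿ it follows that s⁵ N ≤ A q⁵ (ρ⁸ δ⁵)ⁿ,
-- and the first hypothesis says ρ⁸ δ⁵ ≤ w/u. The bases are variables, so the algebra is done before
-- large numerals appear.
absorb : ∀ a b q r u w A {n s N} .{{_ : ℕ.NonZero (q ^ 5 * a ^ 8)}} → b ^ 8 * (r ^ 5 * u) ≤ w * (q ^ 5 * a ^ 8) →
         N * a ^ (8 * n) ≤ A * b ^ (8 * n) → s * q ^ n ≤ q * r ^ n → s ^ 5 * N * u ^ n ≤ A * q ^ 5 * w ^ n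
absorb a b q r u w A {n} {s} {N} gap N≤ s≤ = ℕ.*-cancelʳ-≤ _ _ ((q ^ 5 * a ^ 8) ^ n) {{ℕ.m^n≢0 (q ^ 5 * a ^ 8) n}} (begin
  s ^ 5 * N * u ^ n * (q ^ 5 * a ^ 8) ^ n
    ≡⟨ cong (s ^ 5 * N * u ^ n *_) (^-distribʳ-* n (q ^ 5) (a ^ 8)) ⟩
  s ^ 5 * N * u ^ n * ((q ^ 5) ^ n * (a ^ 8) ^ n)
    ≡⟨ cong₂ (λ x y → s ^ 5 * N * u ^ n * (x * y)) (^-swap q 5 n) (ℕ.^-*-assoc a 8 n) ⟩
  s ^ 5 * N * u ^ n * ((q ^ n) ^ 5 * a ^ (8 * n))
    ≡⟨ solve 5 (λ x N y z t → x :* N :* y :* (z :* t) := (N :* t) :* (x :* z) :* y) refl (s ^ 5) N (u ^ n) ((q ^ n) ^ 5) (a ^ (8 * n)) ⟩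
  N * a ^ (8 * n) * (s ^ 5 * (q ^ n) ^ 5) * u ^ n
    ≡⟨ cong (λ z → N * a ^ (8 * n) * z * u ^ n) (^-distribʳ-* 5 s (q ^ n)) ⟨
  N * a ^ (8 * n) * (s * q ^ n) ^ 5 * u ^ n
    ≤⟨ ℕ.*-monoˡ-≤ (u ^ n) (ℕ.*-mono-≤ N≤ (ℕ.^-monoˡ-≤ 5 s≤)) ⟩
  A * b ^ (8 * n) * (q * r ^ n) ^ 5 * u ^ n
    ≡⟨ cong₂ (λ x y → A * x * y * u ^ n) (sym (ℕ.^-*-assoc b 8 n)) (trans (^-distribʳ-* 5 q (r ^ n)) (cong (q ^ 5 *_) (^-swap r n 5))) ⟩
  A * (b ^ 8) ^ n * (q ^ 5 * (r ^ 5) ^ n) * u ^ n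
    ≡⟨ solve 5 (λ A x y z t → A :* x :* (y :* z) :* t := A :* y :* (x :* (z :* t))) refl A ((b ^ 8) ^ n) (q ^ 5) ((r ^ 5) ^ n) (u ^ n) ⟩
  A * q ^ 5 * ((b ^ 8) ^ n * ((r ^ 5) ^ n * u ^ n))
    ≡⟨ cong (A * q ^ 5 *_) (trans (cong ((b ^ 8) ^ n *_) (sym (^-distribʳ-* n (r ^ 5) u))) (sym (^-distribʳ-* n (b ^ 8) (r ^ 5 * u)))) ⟩
  A * q ^ 5 * (b ^ 8 * (r ^ 5 * u)) ^ n
    ≤⟨ ℕ.*-monoʳ-≤ (A * q ^ 5) (ℕ.^-monoˡ-≤ n gap) ⟩
  A * q ^ 5 * (w * (q ^ 5 * a ^ 8)) ^ n
    ≡⟨ cong (A * q ^ 5 *_) (^-distribʳ-* n w (q ^ 5 * a ^ 8)) ⟩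
  A * q ^ 5 * (w ^ n * (q ^ 5 * a ^ 8) ^ n)
    ≡⟨ ℕ.*-assoc (A * q ^ 5) (w ^ n) _ ⟨
  A * q ^ 5 * w ^ n * (q ^ 5 * a ^ 8) ^ n ∎)
  where
  open ℕ.≤-Reasoning
  open ℕSolver.+-*-Solver

-- ρ^8 * 1.0001^5 is still below the lower bound 1.3953 of the root.
abstract
  absorbing : ℕ
  absorbing = 64 * 10000 ^ 5

  Fits-absorb : ∀ {N} n → Fits N (8 * n) → suc n ^ 5 * N * 10000 ^ n ≤ absorbing * 13953 ^ n
  Fits-absorb {N} n f = absorb 1250 1303 10000 10001 10000 13953 64 {n} {suc n} {N} (ℕ.≤ᵇ⇒≤ _ _ tt) (Fits.bound f)
    (ℕ.≤-trans (ℕ.*-monoˡ-≤ (10000 ^ n) (ℕ.≤-trans (ℕ.≤-reflexive (ℕ.+-comm 1 n)) (ℕ.+-monoʳ-≤ n (ℕ.≤ᵇ⇒≤ 1 10000 tt)))) (bernoulli 10000 n))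

  1≤absorbing : 1 ≤ absorbing
  1≤absorbing = ℕ.≤ᵇ⇒≤ 1 absorbing tt

not-true : ∀ {b} → not b ≡ true → b ≡ false
not-true {false} _ = refl

not-false : ∀ {b} → b ≡ false → not b ≡ true
not-false refl = refl

true≢false : ∀ {b} → b ≡ true → b ≡ false → ⊥
true≢false refl ()

filterᵇ-++ : ∀ {A : Set} (p : A → Bool) xs ys → filterᵇ p (xs ++ ys) ≡ filterᵇ p xs ++ filterᵇ p ys
filterᵇ-++ p []       ys = refl
filterᵇ-++ p (x ∷ xs) ys with p x
... | true  = cong (x ∷_) (filterᵇ-++ p xs ys)
... | false = filterᵇ-++ p xs ys

-- Children of a branch and the measure

module Branching (G : BipartiteGraph) where

  infix 4 _≟ᵛ_
  _≟ᵛ_ : (v w : Vertex G) → Dec (v ≡ w)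
  _≟ᵛ_ = Sum.≡-dec Fin._≟_ Fin._≟_

  private
    V : Set
    V = Vertex G

    N : V → V → Bool
    N = nonAdjacent G

    d : V → List V → ℕ
    d = d̄ G

  nonAdjacent-sym : ∀ v w → N v w ≡ N w v
  nonAdjacent-sym (inj₁ _) (inj₁ _) = refl
  nonAdjacent-sym (inj₁ _) (inj₂ _) = refl
  nonAdjacent-sym (inj₂ _) (inj₁ _) = refl
  nonAdjacent-sym (inj₂ _) (inj₂ _) = refl

  nonAdjacent-flip : ∀ {v w b} → N v w ≡ b → N w v ≡ b
  nonAdjacent-flip {v} {w} e = trans (nonAdjacent-sym w v) e

  nonAdjacent-irrefl : ∀ v → N v v ≡ false
  nonAdjacent-irrefl (inj₁ _) = refl
  nonAdjacent-irrefl (inj₂ _) = refl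

  nonAdjacent-opposite : ∀ v {w u} → N v w ≡ true → N v u ≡ true → N w u ≡ false
  nonAdjacent-opposite (inj₁ _) {inj₂ _} {inj₂ _} _ _ = refl
  nonAdjacent-opposite (inj₂ _) {inj₁ _} {inj₁ _} _ _ = refl

  d̄-some : ∀ {v} Y → 1 ≤ d v Y → ∃ λ y → y ∈ Y × N v y ≡ true
  d̄-some {v} = length-filterᵇ-some (N v)

  d̄-pos : ∀ {v y Y} → y ∈ Y → N v y ≡ true → 1 ≤ d v Y
  d̄-pos {v} = length-filterᵇ-pos (N v)

  d̄-shrink : ∀ v {z Y Z} → Unique Y → Y ⊆ Z → z ∈ Z → z ∉ Y → N v z ≡ true → suc (d v Y) ≤ d v Z
  d̄-shrink v {z} {Y} {Z} u sub z∈Z z∉Y e = Unique-⊆⇒length≤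
    (Unique-∷⁺ (z∉Y ∘ proj₁ ∘ ∈-filterᵇ⁻ (N v) Y) (Unique-filterᵇ⁺ (N v) u)) included
    where
    included : z ∷ filterᵇ (N v) Y ⊆ filterᵇ (N v) Z
    included (here refl) = ∈-filterᵇ⁺ (N v) z∈Z e
    included (there y∈)  = let (y∈Y , e′) = ∈-filterᵇ⁻ (N v) Y y∈ in ∈-filterᵇ⁺ (N v) (sub y∈Y) e′

  d̄≤1⇒≡ : ∀ v {Y y z} → d v Y ≤ 1 → y ∈ Y → z ∈ Y → N v y ≡ true → N v z ≡ true → y ≡ z
  d̄≤1⇒≡ v {Y} {y} {z} le y∈ z∈ ey ez with y ≟ᵛ z
  ... | yes y≡z = y≡z
  ... | no  y≢z = contradiction (ℕ.≤-trans two le) (ℕ.<-irrefl refl)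
    where
    included : y ∷ z ∷ [] ⊆ filterᵇ (N v) Y
    included (here refl)         = ∈-filterᵇ⁺ (N v) y∈ ey
    included (there (here refl)) = ∈-filterᵇ⁺ (N v) z∈ ez
    two : 2 ≤ d v Y
    two = Unique-⊆⇒length≤ (Unique-∷⁺ (λ { (here e) → y≢z e ; (there ()) }) (Unique-∷⁺ (λ ()) [])) included

  -- `us` holds the siblings already treated, latest first. One filter per sibling reproduces the
  -- rounds of `childrenᵀ`, so that `value-childrenᵀ` is a plain induction.
  without : List V → List V → List V
  without []       C = C
  without (u ∷ us) C = filterᵇ (λ w → not (does (u ≟ᵛ w))) (without us C)

  childC childX : List V → List V → V → List V
  childC C us v = filterᵇ (λ w → not (N v w)) (without (v ∷ us) C)
  childX X us v = filterᵇ (λ w → not (N v w)) (us ++ X)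

  child : List V → List V → List V → List V → V → Branch G
  child S C X us v = ⟨ v ∷ S , childC C us v , childX X us v ⟩

  children : List V → List V → List V → List V → List V → List (Branch G)
  children S C X us []       = []
  children S C X us (v ∷ vs) = child S C X us v ∷ children S C X (v ∷ us) vs

  ∈-without⁻ : ∀ {w C} us → w ∈ without us C → w ∈ C × w ∉ us
  ∈-without⁻ []       w∈ = w∈ , λ ()
  ∈-without⁻ {w} (u ∷ us) w∈ with ∈-filterᵇ⁻ (λ w → not (does (u ≟ᵛ w))) _ w∈
  ... | w∈′ , e = let (w∈C , w∉us) = ∈-without⁻ us w∈′ in w∈C , λ where
    (here w≡u)   → true≢false (dec-true (u ≟ᵛ w) (sym w≡u)) (not-true e)
    (there w∈us) → w∉us w∈us

  ∈-without⁺ : ∀ {w C} us → w ∈ C → w ∉ us → w ∈ without us C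
  ∈-without⁺ []       w∈ w∉ = w∈
  ∈-without⁺ {w} (u ∷ us) w∈ w∉ = ∈-filterᵇ⁺ _ (∈-without⁺ us w∈ (w∉ ∘ there))
    (not-false (dec-false (u ≟ᵛ w) (w∉ ∘ here ∘ sym)))

  Unique-without : ∀ us {C} → Unique C → Unique (without us C)
  Unique-without []       u = u
  Unique-without (v ∷ us) u = Unique-filterᵇ⁺ _ (Unique-without us u)

  ∈-childC⁻ : ∀ {w C us v} → w ∈ childC C us v → w ∈ C × w ≢ v × w ∉ us × N v w ≡ false
  ∈-childC⁻ {w} {C} {us} {v} w∈ =
    let (w∈′ , e)  = ∈-filterᵇ⁻ (λ w → not (N v w)) (without (v ∷ us) C) w∈
        (w∈C , w∉) = ∈-without⁻ (v ∷ us) w∈′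
    in w∈C , w∉ ∘ here , w∉ ∘ there , not-true e

  ∈-childC⁺ : ∀ {w C us v} → w ∈ C → w ≢ v → w ∉ us → N v w ≡ false → w ∈ childC C us v
  ∈-childC⁺ {us = us} {v} w∈C w≢v w∉us e = ∈-filterᵇ⁺ _
    (∈-without⁺ (v ∷ us) w∈C λ { (here w≡v) → w≢v w≡v ; (there w∈us) → w∉us w∈us }) (not-false e)

  ∈-childX⁻ : ∀ {w X us v} → w ∈ childX X us v → (w ∈ us ⊎ w ∈ X) × N v w ≡ false
  ∈-childX⁻ {X = X} {us} {v} w∈ = let (w∈′ , e) = ∈-filterᵇ⁻ (λ w → not (N v w)) (us ++ X) w∈ in ∈-++⁻ us w∈′ , not-true e

  ∈-childX⁺ : ∀ {w X us v} → w ∈ us ⊎ w ∈ X → N v w ≡ false → w ∈ childX X us v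
  ∈-childX⁺ {us = us} (inj₁ w∈) e = ∈-filterᵇ⁺ _ (∈-++⁺ˡ w∈) (not-false e)
  ∈-childX⁺ {us = us} (inj₂ w∈) e = ∈-filterᵇ⁺ _ (∈-++⁺ʳ us w∈) (not-false e)

  Unique-childC : ∀ {C} us v → Unique C → Unique (childC C us v)
  Unique-childC us v u = Unique-filterᵇ⁺ _ (Unique-without (v ∷ us) u)

  childC⊆C : ∀ {C us v} → childC C us v ⊆ C
  childC⊆C {C} {us} {v} w∈ = proj₁ (∈-childC⁻ {us = us} {v} w∈)

  -- A candidate without non-neighbours in C ∪ X is never branched on again, so it
  -- weighs nothing.  An excluded vertex weighs half a candidate: this pays for
  -- pivots of degree one, where one of the two children loses such a vertex.

  living : List V → List V → List V
  living C X = filterᵇ (λ v → 1 ≤ᵇ d v (C ++ X)) C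

  measure : List V → List V → ℕ
  measure C X = 8 * length (living C X) + 4 * length X

  Living : List V → List V → V → Set
  Living C X v = v ∈ C × ∃ λ y → (y ∈ C ⊎ y ∈ X) × N v y ≡ true

  ∈-living⁺ : ∀ {C X v} → Living C X v → v ∈ living C X
  ∈-living⁺ {C} {X} {v} (v∈C , y , y∈ , e) = ∈-filterᵇ⁺ (λ v → 1 ≤ᵇ d v (C ++ X)) v∈C
    (T⇒≡ (ℕ.≤⇒≤ᵇ (d̄-pos {v} {Y = C ++ X} (Sum.[ ∈-++⁺ˡ , ∈-++⁺ʳ C ] y∈) e)))
    where
    T⇒≡ : ∀ {b} → T b → b ≡ true
    T⇒≡ {true} _ = refl

  ∈-living⁻ : ∀ {C X v} → v ∈ living C X → Living C X v
  ∈-living⁻ {C} {X} {v} v∈ =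
    let (v∈C , e) = ∈-filterᵇ⁻ (λ v → 1 ≤ᵇ d v (C ++ X)) C v∈
        (y , y∈ , e′) = d̄-some {v} (C ++ X) (ℕ.≤ᵇ⇒≤ 1 _ (subst T (sym e) tt))
    in v∈C , y , ∈-++⁻ C y∈ , e′

  -- Excluding an earlier sibling revives nobody: that sibling was in `C`, so a candidate that has
  -- it as a non-neighbour was already living.
  living-child : ∀ {C X us v} → us ⊆ C → living (childC C us v) (childX X us v) ⊆ living C X
  living-child {C} {X} {us} {v} us⊆C w∈ with ∈-living⁻ {X = childX X us v} w∈
  ... | w∈′ , y , inj₁ y∈ , e = ∈-living⁺ (childC⊆C {us = us} {v} w∈′ , y , inj₁ (childC⊆C {us = us} {v} y∈) , e)
  ... | w∈′ , y , inj₂ y∈ , e with proj₁ (∈-childX⁻ {us = us} {v} y∈)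
  ...   | inj₁ y∈us = ∈-living⁺ (childC⊆C {us = us} {v} w∈′ , y , inj₁ (us⊆C y∈us) , e)
  ...   | inj₂ y∈X  = ∈-living⁺ (childC⊆C {us = us} {v} w∈′ , y , inj₂ y∈X , e)

  -- us′ are the earlier siblings on the side of v, which move to X; the others
  -- are non-neighbours of v and disappear.  E lists candidates that lose their
  -- last non-neighbour.
  record Drop (C X us us′ E : List V) (v : V) : Set where
    field
      C!       : Unique C
      us!      : Unique us
      us⊆C     : us ⊆ C
      us-split : ∀ {u} → u ∈ us → u ∈ us′ ⊎ N v u ≡ true
      us′!     : Unique us′
      us′⊆us   : us′ ⊆ us
      us′-side : ∀ {u} → u ∈ us′ → N v u ≡ false
      us′-live : ∀ {u} → u ∈ us′ → Living C X u
      v∉us′    : v ∉ us′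
      v-live   : Living C X v
      E!       : Unique E
      E-live   : ∀ {u} → u ∈ E → Living C X u
      E-dead   : ∀ {u} → u ∈ E → ¬ Living (childC C us v) (childX X us v) u
      E-side   : ∀ {u} → u ∈ E → N v u ≡ false
      E∉       : ∀ {u} → u ∈ E → u ≢ v × u ∉ us′

  module _ {C X us us′ E v} (D : Drop C X us us′ E v) where
    open Drop D

    private
      lost : List V
      lost = v ∷ (us′ ++ (E ++ filterᵇ (N v) C))

      lost-! : Unique lost
      lost-! = Unique-∷⁺ v∉ (Unique-++⁺ us′! (Unique-++⁺ E! (Unique-filterᵇ⁺ (N v) C!) E∌) us′∌)
        where
        E∌ : ∀ {x} → x ∈ E → x ∉ filterᵇ (N v) C
        E∌ x∈ x∈′ = true≢false (proj₂ (∈-filterᵇ⁻ (N v) C x∈′)) (E-side x∈)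
        us′∌ : ∀ {x} → x ∈ us′ → x ∉ E ++ filterᵇ (N v) C
        us′∌ x∈ x∈′ with ∈-++⁻ E x∈′
        ... | inj₁ x∈E = proj₂ (E∉ x∈E) x∈
        ... | inj₂ x∈F = true≢false (proj₂ (∈-filterᵇ⁻ (N v) C x∈F)) (us′-side x∈)
        v∉ : v ∉ us′ ++ (E ++ filterᵇ (N v) C)
        v∉ v∈ with ∈-++⁻ us′ v∈
        ... | inj₁ v∈us′ = v∉us′ v∈us′
        ... | inj₂ v∈′ with ∈-++⁻ E v∈′
        ...   | inj₁ v∈E = proj₁ (E∉ v∈E) refl
        ...   | inj₂ v∈F = true≢false (proj₂ (∈-filterᵇ⁻ (N v) C v∈F)) (nonAdjacent-irrefl v)

      lost-live : lost ⊆ living C X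
      lost-live (here refl) = ∈-living⁺ v-live
      lost-live (there u∈) with ∈-++⁻ us′ u∈
      ... | inj₁ u∈us′ = ∈-living⁺ (us′-live u∈us′)
      ... | inj₂ u∈′ with ∈-++⁻ E u∈′
      ...   | inj₁ u∈E = ∈-living⁺ (E-live u∈E)
      ...   | inj₂ u∈F = let (u∈C , e) = ∈-filterᵇ⁻ (N v) C u∈F in
        ∈-living⁺ (u∈C , v , inj₁ (proj₁ v-live) , nonAdjacent-flip {v} e)

      lost-dead : ∀ {u} → u ∈ lost → u ∉ living (childC C us v) (childX X us v)
      lost-dead (here refl) u∈c = proj₁ (proj₂ (∈-childC⁻ {C = C} {us} {v} (proj₁ (∈-living⁻ {X = childX X us v} u∈c)))) refl
      lost-dead (there u∈) u∈c with ∈-++⁻ us′ u∈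
      ... | inj₁ u∈us′ = proj₁ (proj₂ (proj₂ (∈-childC⁻ {C = C} {us} {v} (proj₁ (∈-living⁻ {X = childX X us v} u∈c))))) (us′⊆us u∈us′)
      ... | inj₂ u∈′ with ∈-++⁻ E u∈′
      ...   | inj₁ u∈E = E-dead u∈E (∈-living⁻ {X = childX X us v} u∈c)
      ...   | inj₂ u∈F = true≢false (proj₂ (∈-filterᵇ⁻ (N v) C u∈F))
        (proj₂ (proj₂ (proj₂ (∈-childC⁻ {C = C} {us} {v} (proj₁ (∈-living⁻ {X = childX X us v} u∈c))))))

      -- The vertex `v`, the siblings in `us′`, the list `E` and the non-neighbours of `v` in `C`
      -- are disjoint, were all living, and are not living in the child.
      child-living : length (living (childC C us v) (childX X us v)) + suc (length us′ + (length E + d v C))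
                     ≤ length (living C X)
      child-living = subst (_≤ length (living C X))
        (trans (length-++ L) (cong (λ z → length L + suc z) (trans (length-++ us′) (cong (λ z → length us′ + z) (length-++ E)))))
        (Unique-⊆⇒length≤ (Unique-++⁺ (Unique-filterᵇ⁺ _ (Unique-childC us v C!)) lost-! (λ u∈ u∈′ → lost-dead u∈′ u∈))
          λ u∈ → Sum.[ living-child {C} {X} {us} {v} us⊆C , lost-live ] (∈-++⁻ L u∈))
        where
        L : List V
        L = living (childC C us v) (childX X us v)

      child-excluded : length (childX X us v) + d v X ≤ length us′ + length X
      child-excluded = begin
        length (filterᵇ p (us ++ X)) + d v X                          ≡⟨ cong (λ z → length z + d v X) (filterᵇ-++ p us X) ⟩
        length (filterᵇ p us ++ filterᵇ p X) + d v X                  ≡⟨ cong (_+ d v X) (length-++ (filterᵇ p us)) ⟩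
        length (filterᵇ p us) + length (filterᵇ p X) + d v X          ≡⟨ ℕ.+-assoc (length (filterᵇ p us)) _ _ ⟩
        length (filterᵇ p us) + (length (filterᵇ p X) + d v X)        ≡⟨ cong (λ z → length (filterᵇ p us) + z) (trans (ℕ.+-comm _ (d v X)) (filterᵇ-complement (N v) X)) ⟩
        length (filterᵇ p us) + length X                              ≤⟨ ℕ.+-monoˡ-≤ (length X) (Unique-⊆⇒length≤ (Unique-filterᵇ⁺ p us!) kept) ⟩
        length us′ + length X                                         ∎
        where
        open ℕ.≤-Reasoning
        p : V → Bool
        p w = not (N v w)
        kept : filterᵇ p us ⊆ us′
        kept u∈ with ∈-filterᵇ⁻ p us u∈
        ... | u∈us , e with us-split u∈us
        ...   | inj₁ u∈us′ = u∈us′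
        ...   | inj₂ e′    = contradiction (not-true e) (true≢false e′)

    -- A sibling in `us′` gives up 8 as a candidate and costs 4 as an excluded vertex, hence the net
    -- 4; every other loss counts in full. The proof adds 4 for each such sibling to both sides to
    -- avoid subtraction.
    measure-drop : ∀ {d₀ x₀} → d₀ ≤ d v C → x₀ ≤ d v X →
      measure (childC C us v) (childX X us v) + (8 + 4 * length us′ + 8 * length E + 8 * d₀ + 4 * x₀) ≤ measure C X
    measure-drop {d₀} {x₀} d₀≤ x₀≤ = ℕ.+-cancelʳ-≤ (4 * j) _ _ (begin
      8 * a′ + 4 * x′ + (8 + 4 * j + 8 * e + 8 * d₀ + 4 * x₀) + 4 * j
        ≡⟨ solve 6 (λ a′ x′ j e d x → con 8 :* a′ :+ con 4 :* x′ :+ (con 8 :+ con 4 :* j :+ con 8 :* e :+ con 8 :* d :+ con 4 :* x) :+ con 4 :* j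
             := con 8 :* (a′ :+ (con 1 :+ (j :+ (e :+ d)))) :+ con 4 :* (x′ :+ x)) refl a′ x′ j e d₀ x₀ ⟩
      8 * (a′ + suc (j + (e + d₀))) + 4 * (x′ + x₀)
        ≤⟨ ℕ.+-mono-≤ (ℕ.*-monoʳ-≤ 8 (ℕ.≤-trans (ℕ.+-monoʳ-≤ a′ (s≤s (ℕ.+-monoʳ-≤ j (ℕ.+-monoʳ-≤ e d₀≤)))) child-living))
                      (ℕ.*-monoʳ-≤ 4 (ℕ.≤-trans (ℕ.+-monoʳ-≤ x′ x₀≤) child-excluded)) ⟩
      8 * length (living C X) + 4 * (j + length X)
        ≡⟨ solve 3 (λ a j x → con 8 :* a :+ con 4 :* (j :+ x) := con 8 :* a :+ con 4 :* x :+ con 4 :* j) refl (length (living C X)) j (length X) ⟩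
      measure C X + 4 * j ∎)
      where
      open ℕ.≤-Reasoning
      open ℕSolver.+-*-Solver
      a′ x′ j e : ℕ
      a′ = length (living (childC C us v) (childX X us v))
      x′ = length (childX X us v)
      j = length us′
      e = length E

  -- Even for a count of zero, `Below` with offset `e` demands e ≤ M. This and the next lemma
  -- provide it for pruned branches that are easy.
  Living⇒8≤measure : ∀ {C X v} → Living C X v → 8 ≤ measure C X
  Living⇒8≤measure {C} {X} {v} l = ℕ.≤-trans (ℕ.*-monoʳ-≤ 8 1≤) (ℕ.m≤m+n (8 * length (living C X)) (4 * length X))
    where
    1≤ : 1 ≤ length (living C X)
    1≤ with living C X | ∈-living⁺ l
    ... | _ ∷ _ | _ = s≤s z≤n

  ∈X⇒4≤measure : ∀ {C X x} → x ∈ X → 4 ≤ measure C X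
  ∈X⇒4≤measure {C} {x ∷ X} _ = ℕ.≤-trans (ℕ.*-monoʳ-≤ 4 (s≤s (z≤n {length X}))) (ℕ.m≤n+m (4 * suc (length X)) (8 * length (living C (x ∷ X))))

  measure-initial : ∀ C → measure C [] ≤ 8 * length C
  measure-initial C = ℕ.≤-trans (ℕ.≤-reflexive (ℕ.+-identityʳ _)) (ℕ.*-monoʳ-≤ 8 (length-filterᵇ-≤ _ C))

-- The number of unpruned branches

module Counting (G : BipartiteGraph) where
  open Branching G

  private
    V : Set
    V = Vertex G

    N : V → V → Bool
    N = nonAdjacent G

    d : V → List V → ℕ
    d = d̄ G

  NotC′ : List V → List V → V → Set
  NotC′ C X v = 1 ≤ d v X ⊎ 3 ≤ d v C

  Candidate : List V → List V → V → Set
  Candidate C X v = NotC′ C X v ⊎ ∃ λ z → z ∈ C × N v z ≡ true × NotC′ C X z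

  -- The first property triggers pruning. Each of the others forces a pivot of degree at most one:
  -- an excluded vertex is always a candidate pivot, and a vertex of `C` with a non-neighbour in `X`
  -- is one because it lies outside C′.
  HasDominating HasEasyExcluded HasEasyCandidate : List V → List V → Set
  HasDominating    C X = ∃ λ x → x ∈ X × d x C ≡ 0
  HasEasyExcluded  C X = ∃ λ x → x ∈ X × d x C ≤ 1
  HasEasyCandidate C X = ∃ λ v → v ∈ C × 1 ≤ d v X × d v C ≤ 1

  -- n is the number of unpruned branches below a branch.  The next branching of
  -- an easy branch is cheap; the bonus this gives pays for the branching that
  -- leads to it.
  record Count (C X : List V) (n : ℕ) : Set where
    field
      general       : Below n 0 (measure C X)
      easyCandidate : HasEasyCandidate C X → Below n 1 (measure C X)
      easyExcluded  : HasEasyExcluded C X → Below n 4 (measure C X)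
      dominating    : HasDominating C X → n ≡ 0

  CountOf : Branch G → ℕ → Set
  CountOf B = Count (Branch.C B) (Branch.X B)

  record NonNeighbours (C : List V) (v : V) (vs : List V) : Set where
    field
      unique : Unique vs
      sound  : ∀ {w} → w ∈ vs → w ∈ C × N v w ≡ true
      compl  : ∀ {w} → w ∈ C → N v w ≡ true → w ∈ vs
      len    : length vs ≡ d v C

  Minimal : List V → List V → V → Set
  Minimal C X v = (∀ {x} → x ∈ X → d v C ≤ d x C) × (∀ {y} → y ∈ C → Candidate C X y → d v C ≤ d y C)

  HasEasyCandidate⇒8≤ : ∀ {C X} → HasEasyCandidate C X → 8 ≤ measure C X
  HasEasyCandidate⇒8≤ {X = X} (v , v∈C , 1≤dX , _) =
    let (y , y∈X , e) = d̄-some {v} X 1≤dX in Living⇒8≤measure (v∈C , y , inj₂ y∈X , e)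

  count-0 : ∀ {C X} → Count C X 0
  count-0 {C} {X} = record
    { general       = 0 , z≤n , Fits-0 0
    ; easyCandidate = λ h → 0 , ℕ.≤-trans (s≤s z≤n) (HasEasyCandidate⇒8≤ h) , Fits-0 0
    ; easyExcluded  = λ (x , x∈X , _) → 0 , ∈X⇒4≤measure {C} x∈X , Fits-0 0
    ; dominating    = λ _ → refl
    }

  count-leaf : ∀ {C} → Count C [] 1
  count-leaf {C} = record
    { general       = measure C [] , ℕ.≤-reflexive (ℕ.+-identityʳ _) , Fits-1 (measure C [])
    ; easyCandidate = λ { (_ , _ , () , _) }
    ; easyExcluded  = λ { (_ , () , _) }
    ; dominating    = λ { (_ , () , _) }
    }

  -- Measure drops for the children of one branch

  module Siblings (S C X : List V) (C! : Unique C) (p : V) where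

    M : ℕ
    M = measure C X

    below : ∀ {us us′ E v n b d₀ x₀} → Drop C X us us′ E v → d₀ ≤ d v C → x₀ ≤ d v X →
            Below n b (measure (childC C us v) (childX X us v)) →
            Below n (8 + 4 * length us′ + 8 * length E + 8 * d₀ + 4 * x₀ + b) M
    below D d₀≤ x₀≤ = Below-step _ (measure-drop D d₀≤ x₀≤)

    pivot-drop : Living C X p → Drop C X [] [] [] p
    pivot-drop l = record
      { C! = C! ; us! = [] ; us⊆C = λ () ; us-split = λ () ; us′! = [] ; us′⊆us = λ () ; us′-side = λ () ; us′-live = λ ()
      ; v∉us′ = λ () ; v-live = l ; E! = [] ; E-live = λ () ; E-dead = λ () ; E-side = λ () ; E∉ = λ () }

    record Dead (us us′ E : List V) (v : V) : Set where
      field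
        E!     : Unique E
        E-live : ∀ {u} → u ∈ E → Living C X u
        E-dead : ∀ {u} → u ∈ E → ¬ Living (childC C us v) (childX X us v) u
        E-side : ∀ {u} → u ∈ E → N v u ≡ false
        E∉     : ∀ {u} → u ∈ E → u ≢ v × u ∉ us′

    no-dead : ∀ {us us′ v} → Dead us us′ [] v
    no-dead = record { E! = [] ; E-live = λ () ; E-dead = λ () ; E-side = λ () ; E∉ = λ () }

    module _ (base : List V) (base! : Unique base) (base-p : ∀ {u} → u ∈ base → u ≡ p × p ∈ C) (p∈ : p ∈ C ⊎ p ∈ X) where

      sibling-live : ∀ {w} → w ∈ C → N p w ≡ true → Living C X w
      sibling-live w∈C e = w∈C , p , p∈ , nonAdjacent-flip {p} e

      -- `base` contains the pivot if that was branched on first. The pivot is a non-neighbour of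
      -- `w` and disappears, whereas the earlier siblings in `us′` are on the side of `w` and stay
      -- as excluded vertices.
      sibling-drop : ∀ {us′ E w} → Unique us′ → (∀ {u} → u ∈ us′ → u ∈ C × N p u ≡ true) →
                     w ∉ us′ → w ∈ C → N p w ≡ true → Dead (us′ ++ base) us′ E w → Drop C X (us′ ++ base) us′ E w
      sibling-drop {us′} {E} {w} us′! us′-ok w∉ w∈C e dead = record
        { C! = C!
        ; us! = Unique-++⁺ us′! base! λ u∈ u∈b → true≢false (proj₂ (us′-ok u∈))
            (trans (cong (N p) (proj₁ (base-p u∈b))) (nonAdjacent-irrefl p))
        ; us⊆C = λ u∈ → Sum.[ proj₁ ∘ us′-ok , (λ u∈b → subst (_∈ C) (sym (proj₁ (base-p u∈b))) (proj₂ (base-p u∈b))) ] (∈-++⁻ us′ u∈)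
        ; us-split = λ u∈ → Sum.map₂ (λ u∈b → trans (cong (N w) (proj₁ (base-p u∈b))) (nonAdjacent-flip {p} e)) (∈-++⁻ us′ u∈)
        ; us′! = us′!
        ; us′⊆us = ∈-++⁺ˡ
        ; us′-side = λ u∈ → nonAdjacent-opposite p e (proj₂ (us′-ok u∈))
        ; us′-live = λ u∈ → let (u∈C , e′) = us′-ok u∈ in sibling-live u∈C e′
        ; v∉us′ = w∉
        ; v-live = sibling-live w∈C e
        ; E! = E! ; E-live = E-live ; E-dead = E-dead ; E-side = E-side ; E∉ = E∉
        }
        where open Dead dead

      -- A uniform estimate that forgoes the gain from earlier siblings. It suffices for pivots in
      -- `X` and for pivots of degree at least four.
      all-siblings : ∀ {k x₀} us′ rest {ns} → Pointwise CountOf (children S C X (us′ ++ base) rest) ns →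
        Unique us′ → (∀ {u} → u ∈ us′ → u ∈ C × N p u ≡ true) → Unique rest → (∀ {u} → u ∈ rest → u ∉ us′) →
        (∀ {u} → u ∈ rest → (u ∈ C × N p u ≡ true) × k ≤ d u C × x₀ ≤ d u X) →
        All (λ n → Below n (8 + 8 * k + 4 * x₀) M) ns × length ns ≡ length rest
      all-siblings us′ [] [] _ _ _ _ _ = [] , refl
      all-siblings {k} {x₀} us′ (w ∷ rest) (_∷_ {y = n} c cs) us′! us′-ok rest!@(_ ∷ rest!′) disj rest-ok =
        let ((w∈C , e) , k≤ , x≤) = rest-ok (here refl)
            w∉ = disj (here refl)
            (bs , l) = all-siblings (w ∷ us′) rest cs (Unique-∷⁺ w∉ us′!)
              (λ { (here refl) → w∈C , e ; (there u∈) → us′-ok u∈ }) rest!′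
              (λ { u∈ (here refl) → Unique-∷⁻ rest! u∈ ; u∈ (there u∈′) → disj (there u∈) u∈′ }) (rest-ok ∘ there)
        in Below-weaken {n} (8 + 8 * k + 4 * x₀) bound (below {n = n} (sibling-drop us′! us′-ok w∉ w∈C e no-dead) k≤ x≤ (Count.general c)) ∷ bs
           , cong suc l
        where
        bound : 8 + 8 * k + 4 * x₀ ≤ 8 + 4 * length us′ + 8 * 0 + 8 * k + 4 * x₀ + 0
        bound = begin
          8 + 8 * k + 4 * x₀                          ≤⟨ ℕ.+-monoˡ-≤ (4 * x₀) (ℕ.+-monoˡ-≤ (8 * k) (ℕ.≤-trans (ℕ.m≤m+n 8 (4 * length us′)) (ℕ.≤-reflexive (sym (ℕ.+-identityʳ _))))) ⟩
          8 + 4 * length us′ + 8 * 0 + 8 * k + 4 * x₀ ≡⟨ ℕ.+-identityʳ _ ⟨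
          8 + 4 * length us′ + 8 * 0 + 8 * k + 4 * x₀ + 0 ∎
          where open ℕ.≤-Reasoning

  -- Branching on a pivot of X

  module _ {S C X : List V} (C! : Unique C) {p : V} {vs : List V} (nn : NonNeighbours C p vs) where
    open NonNeighbours nn
    open Siblings S C X C! p

    -- Each non-neighbour of the pivot has a non-neighbour in `X`, so it is a candidate pivot and
    -- has at least the degree of `p`. Its child loses at least itself, that many candidates, and
    -- the excluded vertex `p`, worth 4.
    count-fromX : p ∈ X → Minimal C X p → ¬ HasDominating C X →
                  ∀ {ns} → Pointwise CountOf (children S C X [] vs) ns → Count C X (suc (sum ns))
    count-fromX p∈X (minX , minC) undominated {ns} cs = go vs ns len (proj₁ all′) (proj₂ all′)
      where
      ok : ∀ {u} → u ∈ vs → (u ∈ C × N p u ≡ true) × d p C ≤ d u C × 1 ≤ d u X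
      ok {u} u∈ = let (u∈C , e) = sound u∈ ; 1≤ = d̄-pos {u} p∈X (nonAdjacent-flip {p} e) in (u∈C , e) , minC u∈C (inj₁ (inj₁ 1≤)) , 1≤
      all′ : All (λ n → Below n (8 + 8 * d p C + 4 * 1) M) ns × length ns ≡ length vs
      all′ = all-siblings [] [] (λ ()) (inj₂ p∈X) [] vs cs [] (λ ()) unique (λ _ ()) ok
      -- Once the pivot has degree at least two there is no easy vertex, since it would have been a
      -- better pivot; the bonus fields hold vacuously.
      hard : ∀ {ns k} → d p C ≡ suc (suc k) → Below (suc (sum ns)) 0 M → Count C X (suc (sum ns))
      hard e b = record
        { general       = b
        ; easyCandidate = λ (v , v∈C , 1≤ , d≤1) → contradiction (subst (_≤ 1) e (ℕ.≤-trans (minC v∈C (inj₁ (inj₁ 1≤))) d≤1)) λ { (s≤s ()) }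
        ; easyExcluded  = λ (x , x∈X , d≤1) → contradiction (subst (_≤ 1) e (ℕ.≤-trans (minX x∈X) d≤1)) λ { (s≤s ()) }
        ; dominating    = λ h → contradiction h undominated
        }
      go : ∀ vs ns → length vs ≡ d p C → All (λ n → Below n (8 + 8 * d p C + 4 * 1) M) ns → length ns ≡ length vs →
           Count C X (suc (sum ns))
      go [] ns e bs l = contradiction (p , p∈X , sym e) undominated
      go (_ ∷ []) (n ∷ []) e (b ∷ []) l = record
        { general       = Below-branch 0 20 (20 ∷ []) (b′ ∷ []) z≤n (Below⇒≤ b′) tt
        ; easyCandidate = λ _ → Below-branch 1 20 (20 ∷ []) (b′ ∷ []) (ℕ.≤ᵇ⇒≤ 1 20 tt) (Below⇒≤ b′) tt
        ; easyExcluded  = λ _ → Below-branch 4 20 (20 ∷ []) (b′ ∷ []) (ℕ.≤ᵇ⇒≤ 4 20 tt) (Below⇒≤ b′) tt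
        ; dominating    = λ h → contradiction h undominated
        }
        where
        b′ : Below n 20 M
        b′ = subst (λ z → Below n (8 + 8 * z + 4 * 1) M) (sym e) b
      go (_ ∷ _ ∷ []) (n₁ ∷ n₂ ∷ []) e bs l = hard {n₁ ∷ n₂ ∷ []} (sym e)
        (Below-branch 0 28 (28 ∷ 28 ∷ []) (b₁ ∷ b₂ ∷ []) z≤n (Below⇒≤ b₁) tt)
        where
        bs′ : All (λ n → Below n 28 M) (n₁ ∷ n₂ ∷ [])
        bs′ = subst (λ z → All (λ n → Below n (8 + 8 * z + 4 * 1) M) (n₁ ∷ n₂ ∷ [])) (sym e) bs
        b₁ : Below n₁ 28 M
        b₁ = All.head bs′
        b₂ : Below n₂ 28 M
        b₂ = All.head (All.tail bs′)
      go (_ ∷ _ ∷ _ ∷ []) (n₁ ∷ n₂ ∷ n₃ ∷ []) e bs l = hard {n₁ ∷ n₂ ∷ n₃ ∷ []} (sym e)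
        (Below-branch 0 36 (36 ∷ 36 ∷ 36 ∷ []) (b₁ ∷ b₂ ∷ b₃ ∷ []) z≤n (Below⇒≤ b₁) tt)
        where
        bs′ : All (λ n → Below n 36 M) (n₁ ∷ n₂ ∷ n₃ ∷ [])
        bs′ = subst (λ z → All (λ n → Below n (8 + 8 * z + 4 * 1) M) (n₁ ∷ n₂ ∷ n₃ ∷ [])) (sym e) bs
        b₁ : Below n₁ 36 M
        b₁ = All.head bs′
        b₂ : Below n₂ 36 M
        b₂ = All.head (All.tail bs′)
        b₃ : Below n₃ 36 M
        b₃ = All.head (All.tail (All.tail bs′))
      go vs@(_ ∷ _ ∷ _ ∷ _ ∷ us) (n₁ ∷ ns) e (b ∷ bs) l = hard {n₁ ∷ ns} (sym e)
        (Below-wide (length us) {Ns = n₁ ∷ ns} (All.map (λ {n} → weaken {n}) (b ∷ bs)) (ℕ.≤-trans (ℕ.≤-reflexive l) (ℕ.n≤1+n _)) (Below⇒≤ (weaken {n₁} b)))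
        where
        bound : 8 * (5 + length us) ≤ 8 + 8 * d p C + 4 * 1
        bound = subst (λ z → 8 * (5 + length us) ≤ 8 + 8 * z + 4 * 1) e
          (ℕ.≤-trans (ℕ.≤-reflexive (ℕ.*-suc 8 (4 + length us))) (ℕ.m≤m+n (8 + 8 * (4 + length us)) 4))
        weaken : ∀ {n} → Below n (8 + 8 * d p C + 4 * 1) M → Below n (8 * (5 + length us)) M
        weaken {n} = Below-weaken {n} (8 * (5 + length us)) bound

  -- Branching on a pivot of C

  module _ {S C X : List V} (C! : Unique C) {p : V} (p∈C : p ∈ C) (candidate : Candidate C X p)
           (minX : ∀ {x} → x ∈ X → d p C < d x C) (minC : ∀ {y} → y ∈ C → Candidate C X y → d p C ≤ d y C)
           (undominated : ¬ HasDominating C X) where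
    open Siblings S C X C! p

    private
      base-p : ∀ {u} → u ∈ p ∷ [] → u ≡ p × p ∈ C
      base-p (here u≡p) = u≡p , p∈C

      base! : Unique (p ∷ [])
      base! = Unique-∷⁺ (λ ()) []

      drop : ∀ {us′ E w} → Unique us′ → (∀ {u} → u ∈ us′ → u ∈ C × N p u ≡ true) →
             w ∉ us′ → w ∈ C → N p w ≡ true → Dead (us′ ++ p ∷ []) us′ E w → Drop C X (us′ ++ p ∷ []) us′ E w
      drop = sibling-drop (p ∷ []) base! base-p (inj₁ p∈C)

      live : ∀ {w} → w ∈ C → N p w ≡ true → Living C X w
      live = sibling-live (p ∷ []) base! base-p (inj₁ p∈C)

      p-live : ∀ {w} → w ∈ C → N p w ≡ true → Living C X p
      p-live w∈C e = p∈C , _ , inj₁ w∈C , e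

      positive : ∀ {w} → w ∈ C → N p w ≡ true → 1 ≤ d w C
      positive {w} _ e = d̄-pos {w} p∈C (nonAdjacent-flip {p} e)

      hard : ∀ {n} → 2 ≤ d p C → Below n 0 M → Count C X n
      hard 2≤ b = record
        { general       = b
        ; easyCandidate = λ (v , v∈C , 1≤ , d≤1) → contradiction (ℕ.≤-trans 2≤ (ℕ.≤-trans (minC v∈C (inj₁ (inj₁ 1≤))) d≤1)) λ { (s≤s ()) }
        ; easyExcluded  = λ (x , x∈X , d≤1) → contradiction (ℕ.≤-trans 2≤ (ℕ.≤-trans (ℕ.<⇒≤ (minX x∈X)) d≤1)) λ { (s≤s ()) }
        ; dominating    = λ h → contradiction h undominated
        }

    -- Such a pivot is a candidate only by a non-neighbour in `X`, so its single child loses 8 + 4.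
    count-degree0 : NonNeighbours C p [] → ∀ {ns} → Pointwise CountOf (children S C X [] (p ∷ [])) ns → Count C X (suc (sum ns))
    count-degree0 nn {n ∷ []} (c ∷ []) = record
      { general       = Below-branch 0 12 (12 ∷ []) (b ∷ []) z≤n (Below⇒≤ b) tt
      ; easyCandidate = λ _ → Below-branch 1 12 (12 ∷ []) (b ∷ []) (ℕ.≤ᵇ⇒≤ 1 12 tt) (Below⇒≤ b) tt
      ; easyExcluded  = λ _ → Below-branch 4 12 (12 ∷ []) (b ∷ []) (ℕ.≤ᵇ⇒≤ 4 12 tt) (Below⇒≤ b) tt
      ; dominating    = λ h → contradiction h undominated
      }
      where
      open NonNeighbours nn
      excluded : Candidate C X p → 1 ≤ d p X
      excluded (inj₁ (inj₁ 1≤))         = 1≤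
      excluded (inj₁ (inj₂ 3≤))         = contradiction (subst (3 ≤_) (sym len) 3≤) λ ()
      excluded (inj₂ (z , z∈C , e , _)) = contradiction (compl z∈C e) λ ()
      b : Below n 12 M
      b = let (x , x∈X , e) = d̄-some {p} X (excluded candidate)
          in below {d₀ = 0} {1} (pivot-drop (p∈C , x , inj₂ x∈X , e)) z≤n (excluded candidate) (Count.general c)

    -- The pivot or `w` lies outside C′, so one child loses at least 4 beyond the 16 of two
    -- candidates. The vector (20, 16) leaves room for a bonus of 1 but not of 2. Here the weight of
    -- excluded vertices is indispensable, since ρ⁻¹⁶ + ρ⁻¹⁶ exceeds 1.
    count-degree1 : ∀ {w} → NonNeighbours C p (w ∷ []) → ∀ {ns} → Pointwise CountOf (children S C X [] (p ∷ w ∷ [])) ns → Count C X (suc (sum ns))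
    count-degree1 {w} nn {n₀ ∷ n₁ ∷ []} (c₀ ∷ c₁ ∷ []) = split candidate
      where
      open NonNeighbours nn
      w∈C : w ∈ C
      w∈C = proj₁ (sound (here refl))
      Npw : N p w ≡ true
      Npw = proj₂ (sound (here refl))
      b₀ : ∀ {x₀} → x₀ ≤ d p X → Below n₀ (16 + 4 * x₀ + 0) M
      b₀ x≤ = below {d₀ = 1} (pivot-drop (p-live w∈C Npw)) (ℕ.≤-reflexive len) x≤ (Count.general c₀)
      b₁ : ∀ {d₀ x₀} → d₀ ≤ d w C → x₀ ≤ d w X → Below n₁ (8 + 8 * d₀ + 4 * x₀ + 0) M
      b₁ d≤ x≤ = below (drop [] (λ ()) (λ ()) w∈C Npw no-dead) d≤ x≤ (Count.general c₁)
      easy : Below (suc (n₀ + (n₁ + 0))) 1 M → Count C X (suc (n₀ + (n₁ + 0)))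
      easy b = record
        { general       = Below-weaken 0 z≤n b
        ; easyCandidate = λ _ → b
        -- Ties favour `X`, so a pivot of degree one taken from `C` means that every excluded vertex
        -- has degree at least two.
        ; easyExcluded  = λ (x , x∈X , d≤1) → contradiction (ℕ.≤-trans (minX x∈X) d≤1) (subst (λ z → ¬ z < 1) len λ { (s≤s ()) })
        ; dominating    = λ h → contradiction h undominated
        }
      split : Candidate C X p → Count C X (suc (n₀ + (n₁ + 0)))
      split (inj₁ (inj₁ 1≤)) = easy (Below-branch 1 20 (20 ∷ 16 ∷ []) (b₀ 1≤ ∷ b₁ (positive w∈C Npw) z≤n ∷ []) (s≤s z≤n) (Below⇒≤ (b₀ 1≤)) tt)
      split (inj₁ (inj₂ 3≤)) = contradiction (subst (3 ≤_) (sym len) 3≤) λ { (s≤s ()) }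
      split (inj₂ (z , z∈C , e , z∉C′)) with compl z∈C e
      ... | here refl with z∉C′
      ...   | inj₁ 1≤ = let b = b₁ (positive w∈C Npw) 1≤ in
        easy (Below-branch 1 20 (16 ∷ 20 ∷ []) (b₀ z≤n ∷ b ∷ []) (s≤s z≤n) (Below⇒≤ b) tt)
      ...   | inj₂ 3≤ = let b = b₁ 3≤ z≤n in
        easy (Below-branch 1 32 (16 ∷ 32 ∷ []) (b₀ z≤n ∷ b ∷ []) (s≤s z≤n) (Below⇒≤ b) tt)

    module _ {v₁ v₂ : V} (nn : NonNeighbours C p (v₁ ∷ v₂ ∷ [])) {n₀ n₁ n₂ : ℕ}
             (c₀ : CountOf (child S C X [] p) n₀) (c₁ : CountOf (child S C X (p ∷ []) v₁) n₁)
             (c₂ : CountOf (child S C X (v₁ ∷ p ∷ []) v₂) n₂) where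
      open NonNeighbours nn

      private
        v₁∈C : v₁ ∈ C
        v₁∈C = proj₁ (sound (here refl))
        v₂∈C : v₂ ∈ C
        v₂∈C = proj₁ (sound (there (here refl)))
        Npv₁ : N p v₁ ≡ true
        Npv₁ = proj₂ (sound (here refl))
        Npv₂ : N p v₂ ≡ true
        Npv₂ = proj₂ (sound (there (here refl)))
        v₂≢v₁ : v₂ ≢ v₁
        v₂≢v₁ v₂≡v₁ = Unique-∷⁻ unique (here (sym v₂≡v₁))
        v₂∉v₁ : v₂ ∉ v₁ ∷ []
        v₂∉v₁ (here e) = v₂≢v₁ e
        side : N v₁ v₂ ≡ false
        side = nonAdjacent-opposite p Npv₁ Npv₂

        b₀ : ∀ {x₀} → x₀ ≤ d p X → Below n₀ (24 + 4 * x₀ + 0) M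
        b₀ x≤ = below {d₀ = 2} (pivot-drop (p-live v₁∈C Npv₁)) (ℕ.≤-reflexive len) x≤ (Count.general c₀)

        b₁ : ∀ {E d₀ x₀} → Dead (p ∷ []) [] E v₁ → d₀ ≤ d v₁ C → x₀ ≤ d v₁ X →
             Below n₁ (8 + 8 * length E + 8 * d₀ + 4 * x₀ + 0) M
        b₁ dead d≤ x≤ = below (drop [] (λ ()) (λ ()) v₁∈C Npv₁ dead) d≤ x≤ (Count.general c₁)

        drop₂ : Drop C X (v₁ ∷ p ∷ []) (v₁ ∷ []) [] v₂
        drop₂ = drop (Unique-∷⁺ (λ ()) []) (λ { (here refl) → v₁∈C , Npv₁ }) v₂∉v₁ v₂∈C Npv₂ no-dead

        b₂ : ∀ {d₀ x₀} → d₀ ≤ d v₂ C → x₀ ≤ d v₂ X → Below n₂ (12 + 8 * d₀ + 4 * x₀ + 0) M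
        b₂ d≤ x≤ = below drop₂ d≤ x≤ (Count.general c₂)

        -- In the third child v₁ is excluded and p is no longer a candidate.
        v₁-excluded : v₁ ∈ childX X (v₁ ∷ p ∷ []) v₂
        v₁-excluded = ∈-childX⁺ {us = v₁ ∷ p ∷ []} {v₂} (inj₁ (here refl)) (nonAdjacent-flip {v₁} side)

        v₁-shrinks : suc (d v₁ (childC C (v₁ ∷ p ∷ []) v₂)) ≤ d v₁ C
        v₁-shrinks = d̄-shrink v₁ (Unique-childC (v₁ ∷ p ∷ []) v₂ C!) (childC⊆C {us = v₁ ∷ p ∷ []} {v₂}) p∈C
          (λ p∈ → proj₁ (proj₂ (proj₂ (∈-childC⁻ {C = C} {us = v₁ ∷ p ∷ []} {v₂} p∈))) (there (here refl))) (nonAdjacent-flip {p} Npv₁)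

        2≤d : 2 ≤ d p C
        2≤d = ℕ.≤-reflexive len

        conclude : ∀ K ds → Pointwise (λ n e → Below n e M) (n₀ ∷ n₁ ∷ n₂ ∷ []) ds → K ≤ M → T (admissible 0 K ds) →
                   Count C X (suc (n₀ + (n₁ + (n₂ + 0))))
        conclude K ds bs K≤M ok = hard 2≤d (Below-branch 0 K ds bs z≤n K≤M ok)

        candidate-degree : ∀ {y} → y ∈ C → Candidate C X y → 2 ≤ d y C
        candidate-degree y∈C c = subst (_≤ _) (sym len) (minC y∈C c)

        -- Degree two leaves a non-neighbour in `X` as the only reason. By (C2) both `v₁` and `v₂`
        -- are then candidate pivots, hence of degree at least two.
        pivot∉C′ : NotC′ C X p → Count C X (suc (n₀ + (n₁ + (n₂ + 0))))
        pivot∉C′ (inj₂ 3≤) = contradiction (subst (3 ≤_) (sym len) 3≤) λ { (s≤s (s≤s ())) }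
        pivot∉C′ q@(inj₁ 1≤) = conclude 28 (28 ∷ 24 ∷ 28 ∷ []) (b₀ 1≤ ∷ b₁ no-dead (degree v₁∈C Npv₁) z≤n ∷ b₂ (degree v₂∈C Npv₂) z≤n ∷ []) (Below⇒≤ (b₀ 1≤)) tt
          where
          degree : ∀ {w} → w ∈ C → N p w ≡ true → 2 ≤ d w C
          degree w∈C e = candidate-degree w∈C (inj₂ (p , p∈C , nonAdjacent-flip {p} e , q))

        -- If p is the only non-neighbour of v₂ in C ∪ X, then branching on v₁ isolates v₂.
        v₂-dead : d v₂ C ≤ 1 → ¬ 1 ≤ d v₂ X → Dead (p ∷ []) [] (v₂ ∷ []) v₁
        v₂-dead d≤1 ¬1≤ = record
          { E!     = Unique-∷⁺ (λ ()) []
          ; E-live = λ { (here refl) → live v₂∈C Npv₂ }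
          ; E-dead = λ { (here refl) → dead }
          ; E-side = λ { (here refl) → side }
          ; E∉     = λ { (here refl) → v₂≢v₁ , λ () }
          }
          where
          dead : ¬ Living (childC C (p ∷ []) v₁) (childX X (p ∷ []) v₁) v₂
          dead (_ , y , inj₁ y∈ , e) = let (y∈C , _ , y∉p , _) = ∈-childC⁻ {C = C} {us = p ∷ []} {v₁} y∈ in
            y∉p (here (d̄≤1⇒≡ v₂ d≤1 y∈C p∈C e (nonAdjacent-flip {p} Npv₂)))
          dead (_ , y , inj₂ y∈ , e) with ∈-childX⁻ {us = p ∷ []} {v₁} y∈
          ... | inj₁ (here refl) , e′ = true≢false (nonAdjacent-flip {p} Npv₁) e′
          ... | inj₂ y∈X , _ = ¬1≤ (d̄-pos {v₂} y∈X e)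

        -- The delicate case is a `v₂` of degree one, where the third child drops by only 20. In
        -- exchange, branching on `v₁` removes the last non-neighbour of `v₂`, which adds 8 to the
        -- drop of the second child.
        v₁∉C′ : NotC′ C X v₁ → Count C X (suc (n₀ + (n₁ + (n₂ + 0))))
        v₁∉C′ q with 2 ℕ.≤? d v₂ C
        v₁∉C′ (inj₁ 1≤) | yes 2≤ = let b = b₂ 2≤ z≤n in
          conclude 28 (24 ∷ 28 ∷ 28 ∷ []) (b₀ z≤n ∷ b₁ no-dead (candidate-degree v₁∈C (inj₁ (inj₁ 1≤))) 1≤ ∷ b ∷ []) (Below⇒≤ b) tt
        v₁∉C′ (inj₂ 3≤) | yes 2≤ = let b = b₁ no-dead 3≤ z≤n in
          conclude 32 (24 ∷ 32 ∷ 28 ∷ []) (b₀ z≤n ∷ b ∷ b₂ 2≤ z≤n ∷ []) (Below⇒≤ b) tt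
        v₁∉C′ q | no ¬2≤ = isolated (3 ℕ.≤? d v₁ C)
          where
          d≤1 : d v₂ C ≤ 1
          d≤1 = ℕ.≤-pred (ℕ.≰⇒> ¬2≤)
          isolating : Dead (p ∷ []) [] (v₂ ∷ []) v₁
          isolating = v₂-dead d≤1 λ 1≤ → ¬2≤ (candidate-degree v₂∈C (inj₁ (inj₁ 1≤)))
          isolated : _ → Count C X (suc (n₀ + (n₁ + (n₂ + 0))))
          isolated (yes 3≤) = let b = b₁ isolating 3≤ z≤n in
            conclude 40 (24 ∷ 40 ∷ 20 ∷ []) (b₀ z≤n ∷ b ∷ b₂ (positive v₂∈C Npv₂) z≤n ∷ []) (Below⇒≤ b) tt
          -- The vector (24, 36, 20) is not affordable. In the third child `v₁` is excluded and,
          -- having lost `p`, has degree at most one; the bonus of 4 raises 20 to 24.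
          isolated (no ¬3≤) = let excluded = Sum.fromInj₁ (λ 3≤ → contradiction 3≤ ¬3≤) q ; b = b₁ isolating (candidate-degree v₁∈C (inj₁ q)) excluded in
            conclude 36 (24 ∷ 36 ∷ 24 ∷ []) (b₀ z≤n ∷ b ∷
              below {d₀ = 1} {0} drop₂ (positive v₂∈C Npv₂) z≤n
                (Count.easyExcluded c₂ (v₁ , v₁-excluded , ℕ.≤-pred (ℕ.≤-trans v₁-shrinks (ℕ.≤-pred (ℕ.≰⇒> ¬3≤))))) ∷ []) (Below⇒≤ b) tt

        -- The branching order cannot be chosen, so this mirror image of the previous case needs its
        -- own argument: now the vertex in C′ is the one excluded in the third child.
        v₂∉C′ : ¬ NotC′ C X v₁ → NotC′ C X v₂ → Count C X (suc (n₀ + (n₁ + (n₂ + 0))))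
        v₂∉C′ ¬q₁ q₂ with 2 ℕ.≤? d v₁ C
        -- The pivot is the only non-neighbour of `v₁` in `C`, so `v₁` dominates the third child,
        -- which is pruned.
        ... | no ¬2≤ = subst (λ z → Count C X (suc (n₀ + (n₁ + (z + 0)))))
          (sym (Count.dominating c₂ (v₁ , v₁-excluded , ℕ.n≤0⇒n≡0 (ℕ.≤-pred (ℕ.≤-trans v₁-shrinks (ℕ.≤-pred (ℕ.≰⇒> ¬2≤)))))))
          (hard 2≤d (Below-branch 0 24 (24 ∷ 16 ∷ []) (b₀ z≤n ∷ b₁ no-dead (positive v₁∈C Npv₁) z≤n ∷ []) z≤n (Below⇒≤ (b₀ z≤n)) tt))
        ... | yes 2≤ with 3 ℕ.≤? d v₂ C
        ...   | yes 3≤ = let b = b₂ 3≤ z≤n in conclude 36 (24 ∷ 24 ∷ 36 ∷ []) (b₀ z≤n ∷ b₁ no-dead 2≤ z≤n ∷ b ∷ []) (Below⇒≤ b) tt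
        -- The quartic itself: (24, 24, 32) is too much for any ρ⁸ below the root. In the second
        -- child `v₂` keeps its non-neighbour in `X` but has lost `p`, so it is an easy candidate
        -- and the bonus of 1 turns 24 into 25.
        ...   | no ¬3≤ = conclude 32 (24 ∷ 25 ∷ 32 ∷ []) (b₀ z≤n ∷ below {d₀ = 2} {0} (drop [] (λ ()) (λ ()) v₁∈C Npv₁ no-dead) 2≤ z≤n (Count.easyCandidate c₁ easy) ∷ b ∷ []) (Below⇒≤ b) tt
          where
          1≤ : 1 ≤ d v₂ X
          1≤ = Sum.fromInj₁ (λ 3≤ → contradiction 3≤ ¬3≤) q₂
          b : Below n₂ 32 M
          b = b₂ (candidate-degree v₂∈C (inj₁ q₂)) 1≤
          easy : HasEasyCandidate (childC C (p ∷ []) v₁) (childX X (p ∷ []) v₁)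
          easy with d̄-some {v₂} X 1≤
          ... | x , x∈X , e = v₂ ,
            ∈-childC⁺ {us = p ∷ []} {v₁} v₂∈C v₂≢v₁ (λ { (here v₂≡p) → true≢false (trans (cong (N p) (sym v₂≡p)) Npv₂) (nonAdjacent-irrefl p) }) side ,
            d̄-pos {v₂} (∈-childX⁺ {us = p ∷ []} {v₁} (inj₂ x∈X) v₁x) e ,
            ℕ.≤-pred (ℕ.≤-trans (d̄-shrink v₂ (Unique-childC (p ∷ []) v₁ C!) (childC⊆C {us = p ∷ []} {v₁}) p∈C
              (λ p∈ → proj₁ (proj₂ (proj₂ (∈-childC⁻ {C = C} {us = p ∷ []} {v₁} p∈))) (here refl)) (nonAdjacent-flip {p} Npv₂)) (ℕ.≤-pred (ℕ.≰⇒> ¬3≤)))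
            where
            -- The excluded vertex `x` survives the branching on `v₁`, because `v₁` has no
            -- non-neighbour in `X`.
            v₁x : N v₁ x ≡ false
            v₁x with N v₁ x in e′
            ... | false = refl
            ... | true  = contradiction (inj₁ (d̄-pos {v₁} x∈X e′)) ¬q₁

      count-degree2 : Count C X (suc (n₀ + (n₁ + (n₂ + 0))))
      count-degree2 = split candidate
        where
        split : Candidate C X p → Count C X (suc (n₀ + (n₁ + (n₂ + 0))))
        split (inj₁ q) = pivot∉C′ q
        split (inj₂ (z , z∈C , e , q)) with compl z∈C e
        ... | here refl = v₁∉C′ q
        ... | there (here refl) with 1 ℕ.≤? d v₁ X | 3 ℕ.≤? d v₁ C
        ...   | yes 1≤ | _      = v₁∉C′ (inj₁ 1≤)
        ...   | no _   | yes 3≤ = v₁∉C′ (inj₂ 3≤)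
        ...   | no ¬1≤ | no ¬3≤ = v₂∉C′ Sum.[ ¬1≤ , ¬3≤ ] q

    private
      -- A pivot of degree three or more is outside C′, so all its non-neighbours in `C` are
      -- candidate pivots.
      high-degree : 3 ≤ d p C → ∀ {w} → w ∈ C → N p w ≡ true → d p C ≤ d w C
      high-degree 3≤ w∈C e = minC w∈C (inj₂ (p , p∈C , nonAdjacent-flip {p} e , inj₂ 3≤))

    -- Four children losing 32 each would be too many, since 4 ρ⁻³² exceeds 1. The 4 gained for each
    -- earlier sibling among the non-neighbours gives (32, 32, 36, 40).
    count-degree3 : ∀ {v₁ v₂ v₃} → NonNeighbours C p (v₁ ∷ v₂ ∷ v₃ ∷ []) → ∀ {ns} →
                    Pointwise CountOf (children S C X [] (p ∷ v₁ ∷ v₂ ∷ v₃ ∷ [])) ns → Count C X (suc (sum ns))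
    count-degree3 {v₁} {v₂} {v₃} nn {n₀ ∷ n₁ ∷ n₂ ∷ n₃ ∷ []} (c₀ ∷ c₁ ∷ c₂ ∷ c₃ ∷ []) =
      hard (ℕ.≤-trans (s≤s (s≤s z≤n)) (ℕ.≤-reflexive len)) (Below-branch 0 40 (32 ∷ 32 ∷ 36 ∷ 40 ∷ []) (b₀ ∷ b₁ ∷ b₂ ∷ b₃ ∷ []) z≤n (Below⇒≤ b₃) tt)
      where
      open NonNeighbours nn
      degree : ∀ {w} → w ∈ v₁ ∷ v₂ ∷ v₃ ∷ [] → 3 ≤ d w C
      degree w∈ = let (w∈C , e) = sound w∈ in ℕ.≤-trans (ℕ.≤-reflexive len) (high-degree (ℕ.≤-reflexive len) w∈C e)
      v₁∈ : v₁ ∈ v₁ ∷ v₂ ∷ v₃ ∷ []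
      v₁∈ = here refl
      v₂∈ : v₂ ∈ v₁ ∷ v₂ ∷ v₃ ∷ []
      v₂∈ = there (here refl)
      v₃∈ : v₃ ∈ v₁ ∷ v₂ ∷ v₃ ∷ []
      v₃∈ = there (there (here refl))
      v₁∉ : v₁ ∉ v₂ ∷ v₃ ∷ []
      v₁∉ = Unique-∷⁻ unique
      v₂≢v₃ : v₂ ≢ v₃
      v₂≢v₃ e with _ ∷ u ← unique = Unique-∷⁻ u (here e)
      b₀ : Below n₀ 32 M
      b₀ = below {d₀ = 3} {0} (pivot-drop (p-live (proj₁ (sound v₁∈)) (proj₂ (sound v₁∈)))) (ℕ.≤-reflexive len) z≤n (Count.general c₀)
      b₁ : Below n₁ 32 M
      b₁ = below {d₀ = 3} {0} (drop [] (λ ()) (λ ()) (proj₁ (sound v₁∈)) (proj₂ (sound v₁∈)) no-dead) (degree v₁∈) z≤n (Count.general c₁)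
      b₂ : Below n₂ 36 M
      b₂ = below {d₀ = 3} {0} (drop {v₁ ∷ []} (Unique-∷⁺ (λ ()) []) (λ { (here refl) → sound v₁∈ }) (λ { (here e) → v₁∉ (here (sym e)) })
        (proj₁ (sound v₂∈)) (proj₂ (sound v₂∈)) no-dead) (degree v₂∈) z≤n (Count.general c₂)
      b₃ : Below n₃ 40 M
      b₃ = below {d₀ = 3} {0} (drop {v₂ ∷ v₁ ∷ []} (Unique-∷⁺ (λ { (here e) → v₁∉ (here (sym e)) }) (Unique-∷⁺ (λ ()) []))
        (λ { (here refl) → sound v₂∈ ; (there (here refl)) → sound v₁∈ })
        (λ { (here e) → v₂≢v₃ (sym e) ; (there (here e)) → v₁∉ (there (here (sym e))) })
        (proj₁ (sound v₃∈)) (proj₂ (sound v₃∈)) no-dead) (degree v₃∈) z≤n (Count.general c₃)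

    count-degree≥4 : ∀ {v₁ v₂ v₃ v₄ us} → NonNeighbours C p (v₁ ∷ v₂ ∷ v₃ ∷ v₄ ∷ us) → ∀ {ns} →
                     Pointwise CountOf (children S C X [] (p ∷ v₁ ∷ v₂ ∷ v₃ ∷ v₄ ∷ us)) ns → Count C X (suc (sum ns))
    count-degree≥4 {v₁} {v₂} {v₃} {v₄} {us} nn {n₀ ∷ ns} (c₀ ∷ cs) =
      hard 2≤ (Below-wide (length us) {Ns = n₀ ∷ ns} (All.map (Below-weaken (8 * (5 + length us)) (ℕ.≤-reflexive wide)) (b₀ ∷ proj₁ siblings))
        (s≤s (ℕ.≤-reflexive (proj₂ siblings))) (Below⇒≤ (Below-weaken (8 * (5 + length us)) (ℕ.≤-reflexive wide) b₀)))
      where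
      open NonNeighbours nn
      3≤ : 3 ≤ d p C
      3≤ = ℕ.≤-trans (s≤s (s≤s (s≤s z≤n))) (ℕ.≤-reflexive len)
      2≤ : 2 ≤ d p C
      2≤ = ℕ.≤-trans (s≤s (s≤s z≤n)) 3≤
      wide : 8 * (5 + length us) ≡ 8 + 8 * d p C + 0
      wide = trans (ℕ.*-suc 8 (4 + length us)) (trans (cong (λ z → 8 + 8 * z) len) (sym (ℕ.+-identityʳ _)))
      siblings : All (λ n → Below n (8 + 8 * d p C + 4 * 0) M) ns × length ns ≡ 4 + length us
      siblings = all-siblings (p ∷ []) base! base-p (inj₁ p∈C) [] _ cs [] (λ ()) unique (λ _ ())
        λ u∈ → let (u∈C , e) = sound u∈ in (u∈C , e) , high-degree 3≤ u∈C e , z≤n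
      b₀ : Below n₀ (8 + 8 * d p C + 0) M
      b₀ = Below-weaken (8 + 8 * d p C + 0) (ℕ.≤-reflexive (sym (ℕ.+-identityʳ _)))
        (below {d₀ = d p C} {0} (pivot-drop (p-live (proj₁ (sound (here refl))) (proj₂ (sound (here refl))))) ℕ.≤-refl z≤n (Count.general c₀))

    count-fromC : ∀ {vs} → NonNeighbours C p vs → ∀ {ns} → Pointwise CountOf (children S C X [] (p ∷ vs)) ns → Count C X (suc (sum ns))
    count-fromC {[]}                = count-degree0
    count-fromC {_ ∷ []}            = count-degree1
    count-fromC {_ ∷ _ ∷ []} nn (c₀ ∷ c₁ ∷ c₂ ∷ []) = count-degree2 nn c₀ c₁ c₂
    count-fromC {_ ∷ _ ∷ _ ∷ []}    = count-degree3
    count-fromC {_ ∷ _ ∷ _ ∷ _ ∷ _} = count-degree≥4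


-- Running time of a single step

value-filterᵀ : {p : A → Timed Bool} {q : A → Bool} → (∀ x → value (p x) ≡ q x) →
                ∀ xs → value (filterᵀ p xs) ≡ filterᵇ q xs
value-filterᵀ e [] = refl
value-filterᵀ {p = p} {q} e (x ∷ xs) with value (p x) | e x
... | b | refl with q x
...   | true  = cong (x ∷_) (value-filterᵀ e xs)
...   | false = value-filterᵀ e xs

value-mapᵀ : {f : A → Timed B} {g : A → B} → (∀ x → value (f x) ≡ g x) → ∀ xs → value (mapᵀ f xs) ≡ map g xs
value-mapᵀ e []       = refl
value-mapᵀ e (x ∷ xs) = cong₂ _∷_ (e x) (value-mapᵀ e xs)

value-appendᵀ : (xs ys : List A) → value (appendᵀ xs ys) ≡ xs ++ ys
value-appendᵀ []       ys = refl
value-appendᵀ (x ∷ xs) ys = cong (x ∷_) (value-appendᵀ xs ys)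

value-lengthᵀ : (xs : List A) → value (lengthᵀ xs) ≡ length xs
value-lengthᵀ []       = refl
value-lengthᵀ (x ∷ xs) = cong suc (value-lengthᵀ xs)

value-countᵀ : (p : A → Bool) → ∀ xs → value (countᵀ (λ x → return (p x)) xs) ≡ length (filterᵇ p xs)
value-countᵀ p xs = trans (value-lengthᵀ (value (filterᵀ (λ x → return (p x)) xs))) (cong length (value-filterᵀ {p = λ x → return (p x)} (λ _ → refl) xs))

time-filterᵀ : {p : A → Timed Bool} {k : ℕ} → (∀ x → time (p x) ≤ k) →
               ∀ xs → time (filterᵀ p xs) ≤ suc (length xs) * suc k
time-filterᵀ {k = k} b [] = s≤s z≤n
time-filterᵀ {p = p} {k} b (x ∷ xs) = s≤s (ℕ.+-mono-≤ (b x)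
  (ℕ.≤-trans (ℕ.≤-reflexive (ℕ.+-identityʳ _)) (time-filterᵀ b xs)))

time-mapᵀ : {f : A → Timed B} {k : ℕ} → (∀ x → time (f x) ≤ k) → ∀ xs → time (mapᵀ f xs) ≤ suc (length xs) * suc k
time-mapᵀ b [] = s≤s z≤n
time-mapᵀ b (x ∷ xs) = s≤s (ℕ.+-mono-≤ (b x) (ℕ.≤-trans (ℕ.≤-reflexive (ℕ.+-identityʳ _)) (time-mapᵀ b xs)))

time-appendᵀ : (xs ys : List A) → time (appendᵀ xs ys) ≡ suc (length xs)
time-appendᵀ []       ys = refl
time-appendᵀ (x ∷ xs) ys = cong suc (trans (ℕ.+-identityʳ _) (time-appendᵀ xs ys))

time-lengthᵀ : (xs : List A) → time (lengthᵀ xs) ≡ suc (length xs)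
time-lengthᵀ []       = refl
time-lengthᵀ (x ∷ xs) = cong suc (trans (ℕ.+-identityʳ _) (time-lengthᵀ xs))

time-minimalᵀ : (xs : List (A × ℕ)) → time (minimalᵀ xs) ≡ suc (length xs)
time-minimalᵀ []       = refl
time-minimalᵀ (x ∷ xs) = cong suc (trans (ℕ.+-identityʳ _) (time-minimalᵀ xs))

time-countᵀ : (p : A → Bool) → ∀ xs → time (countᵀ (λ x → return (p x)) xs) ≤ 2 * suc (length xs)
time-countᵀ p xs = ℕ.+-mono-≤
  (ℕ.≤-trans (time-filterᵀ {p = λ x → return (p x)} {0} (λ _ → z≤n) xs) (ℕ.≤-reflexive (ℕ.*-identityʳ _)))
  (ℕ.≤-trans (ℕ.≤-reflexive (time-lengthᵀ (value (filterᵀ (λ x → return (p x)) xs))))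
    (ℕ.≤-trans (s≤s (subst (λ z → length z ≤ length xs) (sym (value-filterᵀ {p = λ x → return (p x)} (λ _ → refl) xs)) (length-filterᵇ-≤ p xs)))
      (ℕ.≤-reflexive (sym (ℕ.+-identityʳ _)))))

record Minimals (xs ys : List (A × ℕ)) : Set where
  field
    included : ys ⊆ xs
    least    : ∀ {x y} → y ∈ ys → x ∈ xs → proj₂ y ≤ proj₂ x
    nonempty : ys ≡ [] → xs ≡ []

T⇒≡true : ∀ {b} → T b → b ≡ true
T⇒≡true {true} _ = refl

≡true⇒T : ∀ {b} → b ≡ true → T b
≡true⇒T refl = tt

<ᵇ-true : ∀ {m n} → (m <ᵇ n) ≡ true → m < n
<ᵇ-true {m} {n} e = ℕ.<ᵇ⇒< m n (≡true⇒T e)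

<ᵇ-false : ∀ {m n} → (m <ᵇ n) ≡ false → n ≤ m
<ᵇ-false {m} {n} e = ℕ.≮⇒≥ λ m<n → true≢false (T⇒≡true (ℕ.<⇒<ᵇ m<n)) e

≤ᵇ-true : ∀ {m n} → (m ≤ᵇ n) ≡ true → m ≤ n
≤ᵇ-true {m} {n} e = ℕ.≤ᵇ⇒≤ m n (≡true⇒T e)

≤ᵇ-false : ∀ {m n} → (m ≤ᵇ n) ≡ false → n < m
≤ᵇ-false {m} {n} e = ℕ.≰⇒> λ m≤n → true≢false (T⇒≡true (ℕ.≤⇒≤ᵇ m≤n)) e

minimalᵀ-minimals : (xs : List (A × ℕ)) → Minimals xs (value (minimalᵀ xs))
minimalᵀ-minimals [] = record { included = λ () ; least = λ () ; nonempty = λ _ → refl }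
minimalᵀ-minimals ((x , d) ∷ xs) with value (minimalᵀ xs) | minimalᵀ-minimals xs
... | [] | ih with refl ← Minimals.nonempty ih refl = record
  { included = λ y∈ → y∈
  ; least    = λ { (here refl) (here refl) → ℕ.≤-refl }
  ; nonempty = λ ()
  }
... | (y , e) ∷ ys | ih with d <ᵇ e in d<e | e <ᵇ d in e<d
...   | true  | _ = record
  { included = λ { (here refl) → here refl }
  ; least    = λ { (here refl) (here refl) → ℕ.≤-refl ; (here refl) (there z∈) → ℕ.≤-trans (ℕ.<⇒≤ (<ᵇ-true d<e)) (Minimals.least ih (here refl) z∈) }
  ; nonempty = λ ()
  }
...   | false | true = record
  { included = there ∘ Minimals.included ih
  ; least    = λ { z∈ (here refl) → ℕ.≤-trans (Minimals.least ih z∈ (Minimals.included ih (here refl))) (ℕ.<⇒≤ (<ᵇ-true e<d))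
                 ; z∈ (there w∈) → Minimals.least ih z∈ w∈ }
  ; nonempty = λ ()
  }
...   | false | false = record
  { included = λ { (here refl) → here refl ; (there z∈) → there (Minimals.included ih z∈) }
  ; least    = λ { (here refl) (here refl) → ℕ.≤-refl
                 ; (here refl) (there w∈) → ℕ.≤-trans (<ᵇ-false e<d) (Minimals.least ih (here refl) w∈)
                 ; (there z∈) (here refl) → ℕ.≤-trans (Minimals.least ih z∈ (Minimals.included ih (here refl))) (<ᵇ-false d<e)
                 ; (there z∈) (there w∈) → Minimals.least ih z∈ w∈ }
  ; nonempty = λ ()
  }

Minimals-length : (xs : List (A × ℕ)) → length (value (minimalᵀ xs)) ≤ length xs
Minimals-length [] = z≤n
Minimals-length ((x , d) ∷ xs) with value (minimalᵀ xs) | Minimals-length xs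
... | [] | _ = s≤s z≤n
... | (y , e) ∷ ys | le with d <ᵇ e | e <ᵇ d
...   | true  | _     = s≤s z≤n
...   | false | true  = ℕ.m≤n⇒m≤1+n le
...   | false | false = s≤s le

-- Values computed at a branch and the choice of the pivot

module Execution (impl : Implementation) (G : BipartiteGraph) (τL τR : ℕ) where
  open Implementation impl
  open IPS impl G τL τR
  open Branching G
  open Counting G

  private
    V : Set
    V = Vertex G

    N : V → V → Bool
    N = nonAdjacent G

    d : V → List V → ℕ
    d = d̄ G

  value-d̄ᵀ : ∀ v Y → value (d̄ᵀ v Y) ≡ d v Y
  value-d̄ᵀ v Y = value-countᵀ (N v) Y

  value-childrenᵀ : ∀ S C X us vs → value (childrenᵀ S (without us C) (us ++ X) vs) ≡ children S C X us vs
  value-childrenᵀ S C X us [] = refl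
  value-childrenᵀ S C X us (v ∷ vs)
    rewrite value-filterᵀ {p = λ w → return (not (v ≟ⱽ w))} {λ w → not (v ≟ⱽ w)} (λ _ → refl) (without us C)
          | value-filterᵀ {p = λ w → return (not (N v w))} {λ w → not (N v w)} (λ _ → refl) (without (v ∷ us) C)
          | value-filterᵀ {p = λ w → return (not (N v w))} {λ w → not (N v w)} (λ _ → refl) (us ++ X)
    = cong (child S C X us v ∷_) (value-childrenᵀ S C X (v ∷ us) vs)

  -- The strict inequality in `fromC` records that ties are broken in favour of `X`.
  data PivotSpec (C X : List V) : Pivot → Set where
    none  : X ≡ [] → (∀ {v} → v ∈ C → ¬ NotC′ C X v) → PivotSpec C X none
    fromC : ∀ {v} → v ∈ C → Candidate C X v → (∀ {x} → x ∈ X → d v C < d x C) →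
            (∀ {y} → y ∈ C → Candidate C X y → d v C ≤ d y C) → PivotSpec C X (fromC v)
    fromX : ∀ {v} → v ∈ X → Minimal C X v → PivotSpec C X (fromX v)

  module _ (C X : List V) where
    inC′ᵇ : V → Bool
    inC′ᵇ v = (d v X ≡ᵇ 0) ∧ (d v C ≤ᵇ 2)

    inC′ᵇ-true : ∀ {v} → inC′ᵇ v ≡ true → ¬ NotC′ C X v
    inC′ᵇ-true {v} e with d v X | d v C ≤ᵇ 2 in e₂
    inC′ᵇ-true {v} e  | zero | true = Sum.[ (λ ()) , (λ 3≤ → ℕ.<-irrefl refl (ℕ.≤-trans 3≤ (≤ᵇ-true e₂))) ]
    inC′ᵇ-true {v} () | zero | false
    inC′ᵇ-true {v} () | suc _ | _

    inC′ᵇ-false : ∀ {v} → inC′ᵇ v ≡ false → NotC′ C X v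
    inC′ᵇ-false {v} e with d v X | d v C ≤ᵇ 2 in e₂
    inC′ᵇ-false {v} () | zero | true
    inC′ᵇ-false {v} e | zero | false = inj₂ (≤ᵇ-false e₂)
    inC′ᵇ-false {v} e | suc _ | _ = inj₁ (s≤s z≤n)

    value-inC′ : ∀ v → value (inC′?ᵀ C X v) ≡ inC′ᵇ v
    value-inC′ v rewrite value-d̄ᵀ v X | value-d̄ᵀ v C = refl

    outside : List V
    outside = filterᵇ (not ∘ inC′ᵇ) C

    candidates : List V
    candidates = outside ++ filterᵇ (λ v → 1 ≤ᵇ d v outside) (filterᵇ inC′ᵇ C)

    C′ᵀ outsideᵀ C2ᵀ candidatesᵀ : List V
    C′ᵀ = value (filterᵀ (inC′?ᵀ C X) C)
    outsideᵀ = value (filterᵀ (notInC′?ᵀ C X) C)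
    C2ᵀ = value (filterᵀ (d̄-satisfiesᵀ (1 ≤ᵇ_) outsideᵀ) C′ᵀ)
    candidatesᵀ = value (appendᵀ outsideᵀ C2ᵀ)

    degreesᵀ : List V → List (V × ℕ)
    degreesᵀ vs = value (mapᵀ (withDegreeᵀ C) vs)

    outsideᵀ≡ : outsideᵀ ≡ outside
    outsideᵀ≡ = value-filterᵀ (λ v → cong not (value-inC′ v)) C

    candidatesᵀ≡ : candidatesᵀ ≡ candidates
    candidatesᵀ≡ = trans (value-appendᵀ outsideᵀ C2ᵀ) (cong₂ _++_ outsideᵀ≡
      (trans (value-filterᵀ {q = λ v → 1 ≤ᵇ d v outsideᵀ} (λ v → cong (1 ≤ᵇ_) (value-d̄ᵀ v outsideᵀ)) C′ᵀ)
        (cong₂ (λ o → filterᵇ (λ v → 1 ≤ᵇ d v o)) outsideᵀ≡ (value-filterᵀ value-inC′ C))))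

    degreesᵀ≡ : ∀ vs → degreesᵀ vs ≡ map (λ v → v , d v C) vs
    degreesᵀ≡ = value-mapᵀ (λ v → cong (v ,_) (value-d̄ᵀ v C))

    ∈-outside⁻ : ∀ {v} → v ∈ outside → v ∈ C × NotC′ C X v
    ∈-outside⁻ {v} v∈ = let (v∈C , e) = ∈-filterᵇ⁻ (not ∘ inC′ᵇ) C v∈ in v∈C , inC′ᵇ-false {v} (not-true e)

    ∈-outside⁺ : ∀ {v} → v ∈ C → NotC′ C X v → v ∈ outside
    ∈-outside⁺ {v} v∈C q with inC′ᵇ v in e
    ... | true  = contradiction q (inC′ᵇ-true {v} e)
    ... | false = ∈-filterᵇ⁺ (not ∘ inC′ᵇ) v∈C (not-false e)

    ∈-candidates⁻ : ∀ {v} → v ∈ candidates → v ∈ C × Candidate C X v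
    ∈-candidates⁻ {v} v∈ with ∈-++⁻ outside v∈
    ... | inj₁ v∈o = let (v∈C , q) = ∈-outside⁻ v∈o in v∈C , inj₁ q
    ... | inj₂ v∈2 =
      let (v∈C′ , e) = ∈-filterᵇ⁻ (λ v → 1 ≤ᵇ d v outside) (filterᵇ inC′ᵇ C) v∈2
          (z , z∈ , Nvz) = d̄-some {v} outside (≤ᵇ-true {1} {d v outside} e)
          (z∈C , q) = ∈-outside⁻ z∈
      in proj₁ (∈-filterᵇ⁻ inC′ᵇ C v∈C′) , inj₂ (z , z∈C , Nvz , q)

    ∈-candidates⁺ : ∀ {v} → v ∈ C → Candidate C X v → v ∈ candidates
    ∈-candidates⁺ v∈C (inj₁ q) = ∈-++⁺ˡ (∈-outside⁺ v∈C q)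
    ∈-candidates⁺ {v} v∈C (inj₂ (z , z∈C , e , q)) with inC′ᵇ v in eq
    ... | false = ∈-++⁺ˡ (∈-filterᵇ⁺ (not ∘ inC′ᵇ) v∈C (not-false eq))
    ... | true  = ∈-++⁺ʳ outside (∈-filterᵇ⁺ (λ v → 1 ≤ᵇ d v outside) (∈-filterᵇ⁺ inC′ᵇ v∈C eq)
                    (T⇒≡true (ℕ.≤⇒≤ᵇ (d̄-pos {v} (∈-outside⁺ z∈C q) e))))

    ∈-candidatesᵀ⁻ : ∀ {v} → v ∈ candidatesᵀ → v ∈ C × Candidate C X v
    ∈-candidatesᵀ⁻ {v} v∈ = ∈-candidates⁻ (subst (v ∈_) candidatesᵀ≡ v∈)

    ∈-candidatesᵀ⁺ : ∀ {v} → v ∈ C → Candidate C X v → v ∈ candidatesᵀ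
    ∈-candidatesᵀ⁺ {v} v∈C c = subst (v ∈_) (sym candidatesᵀ≡) (∈-candidates⁺ v∈C c)

    Least : List V → V → ℕ → Set
    Least vs v k = v ∈ vs × k ≡ d v C × (∀ {w} → w ∈ vs → d v C ≤ d w C)

    minimal-least : ∀ vs {ms v k} → value (minimalᵀ (degreesᵀ vs)) ≡ ms → (v , k) ∈ ms → Least vs v k
    minimal-least vs refl m with ∈-map⁻ (λ v → v , d v C) (subst (_ ∈_) (degreesᵀ≡ vs) (Minimals.included (minimalᵀ-minimals (degreesᵀ vs)) m))
    ... | v , v∈ , refl = v∈ , refl , λ w∈ → Minimals.least (minimalᵀ-minimals (degreesᵀ vs)) m
      (subst (_ ∈_) (sym (degreesᵀ≡ vs)) (∈-map⁺ (λ v → v , d v C) w∈))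

    minimal-[] : ∀ vs → value (minimalᵀ (degreesᵀ vs)) ≡ [] → vs ≡ []
    minimal-[] vs e with vs | Minimals.nonempty (minimalᵀ-minimals (degreesᵀ vs)) e
    ... | [] | _ = refl

  -- Valid for every answer of `breakTie`: of the vertex picked, only its membership in the list of
  -- minima matters.
  picked : ∀ {v : V} {k : ℕ} (ps : List (V × ℕ)) i → ∃ λ j → (lookup (v ∷ value (mapᵀ (λ p → return (proj₁ p)) ps)) i , j) ∈ (v , k) ∷ ps
  picked {v} {k} ps i with ∈-map⁻ proj₁ (subst (lookup (v ∷ value (mapᵀ (λ p → return (proj₁ p)) ps)) i ∈_)
    (cong (v ∷_) (value-mapᵀ {f = λ p → return (proj₁ p)} {proj₁} (λ _ → refl) ps)) (∈-lookup {xs = v ∷ value (mapᵀ (λ p → return (proj₁ p)) ps)} i))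
  ... | (w , j) , m , e = j , subst (λ z → (z , j) ∈ (v , k) ∷ ps) (sym e) m

  pivot-spec : ∀ S C X → PivotSpec C X (value (pivotᵀ ⟨ S , C , X ⟩))
  pivot-spec S C X with value (minimalᵀ (degreesᵀ C X (candidatesᵀ C X))) in eC | value (minimalᵀ (degreesᵀ C X X)) in eX
  ... | [] | [] = none (minimal-[] C X X eX) λ v∈C q →
    contradiction (∈-candidatesᵀ⁺ C X v∈C (inj₁ q)) (subst (_ ∉_) (sym (minimal-[] C X (candidatesᵀ C X) eC)) λ ())
  ... | (v , k) ∷ ps | [] =
    let (j , m) = picked {v} {k} ps (breakTie G ⟨ S , C , X ⟩ v (value (mapᵀ (λ p → return (proj₁ p)) ps)))
        (v∈ , _ , least) = minimal-least C X (candidatesᵀ C X) eC m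
        (v∈C , cand) = ∈-candidatesᵀ⁻ C X v∈
    in fromC v∈C cand (λ x∈X → contradiction x∈X (subst (_ ∉_) (sym (minimal-[] C X X eX)) λ ()))
         (λ y∈C c → least (∈-candidatesᵀ⁺ C X y∈C c))
  ... | [] | (w , l) ∷ qs =
    let (j , m) = picked {w} {l} qs (breakTie G ⟨ S , C , X ⟩ w (value (mapᵀ (λ p → return (proj₁ p)) qs)))
        (w∈ , _ , least) = minimal-least C X X eX m
    in fromX w∈ (least , λ y∈C c → contradiction (∈-candidatesᵀ⁺ C X y∈C c)
         (subst (_ ∉_) (sym (minimal-[] C X (candidatesᵀ C X) eC)) λ ()))
  ... | (v , k) ∷ ps | (w , l) ∷ qs with l ≤ᵇ k in e
  -- The test compared the heads of the two lists, not the vertex picked; since all minima have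
  -- equal degree, the comparison carries over.
  ...   | true =
    let (j , m) = picked {w} {l} qs (breakTie G ⟨ S , C , X ⟩ w (value (mapᵀ (λ p → return (proj₁ p)) qs)))
        (w∈ , _ , least) = minimal-least C X X eX m
        (w₀∈ , l≡ , _) = minimal-least C X X eX (here refl)
        (_ , k≡ , leastC) = minimal-least C X (candidatesᵀ C X) eC (here refl)
    in fromX w∈ (least , λ y∈C c → ℕ.≤-trans (least w₀∈) (ℕ.≤-trans (ℕ.≤-reflexive (sym l≡)) (ℕ.≤-trans (≤ᵇ-true e) (ℕ.≤-trans (ℕ.≤-reflexive k≡)
         (leastC (∈-candidatesᵀ⁺ C X y∈C c))))))
  ...   | false =
    let (j , m) = picked {v} {k} ps (breakTie G ⟨ S , C , X ⟩ v (value (mapᵀ (λ p → return (proj₁ p)) ps)))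
        (v∈ , _ , least) = minimal-least C X (candidatesᵀ C X) eC m
        (v₀∈ , k≡ , _) = minimal-least C X (candidatesᵀ C X) eC (here refl)
        (v∈C , cand) = ∈-candidatesᵀ⁻ C X v∈
        (_ , l≡ , leastX) = minimal-least C X X eX (here refl)
    in fromC v∈C cand (λ x∈X → ℕ.≤-<-trans (least v₀∈) (ℕ.≤-<-trans (ℕ.≤-reflexive (sym k≡)) (ℕ.<-≤-trans (≤ᵇ-false e)
           (ℕ.≤-trans (ℕ.≤-reflexive l≡) (leastX x∈X)))))
         (λ y∈C c → least (∈-candidatesᵀ⁺ C X y∈C c))

∧-true : ∀ {a b} → a ∧ b ≡ true → a ≡ true × b ≡ true
∧-true {true} {true} _ = refl , refl

∨-true : ∀ {a b} → a ∨ b ≡ true → a ≡ true ⊎ b ≡ true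
∨-true {true}  e = inj₁ refl
∨-true {false} e = inj₂ e

∨-false : ∀ {a b} → a ∨ b ≡ false → a ≡ false × b ≡ false
∨-false {false} {false} _ = refl , refl

null-true : ∀ {A : Set} {xs : List A} → null xs ≡ true → xs ≡ []
null-true {xs = []} _ = refl

-- Time and outcome of one step

module Steps (impl : Implementation) (G : BipartiteGraph) (τL τR : ℕ) where
  open Implementation impl
  open IPS impl G τL τR
  open Branching G
  open Counting G
  open Execution impl G τL τR

  private
    V : Set
    V = Vertex G

    N : V → V → Bool
    N = nonAdjacent G

    d : V → List V → ℕ
    d = d̄ G

  module Times (n : ℕ) where
    -- The unit of cost. A step takes at most 64 of them: 48 for the pivot, the branch list and the
    -- children, the rest for the tests before.
    σ : ℕ
    σ = suc n * suc n

    private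
      s : ℕ
      s = suc n

    1≤σ : 1 ≤ σ
    1≤σ = s≤s z≤n

    s≤σ : s ≤ σ
    s≤σ = ℕ.m≤m*n s s

    add : ∀ i j {a b} → a ≤ i * σ → b ≤ j * σ → a + b ≤ (i + j) * σ
    add i j a≤ b≤ = ℕ.≤-trans (ℕ.+-mono-≤ a≤ b≤) (ℕ.≤-reflexive (sym (ℕ.*-distribʳ-+ σ i j)))

    unit : ∀ {a} → a ≤ σ → a ≤ 1 * σ
    unit a≤ = ℕ.≤-trans a≤ (ℕ.≤-reflexive (sym (ℕ.*-identityˡ σ)))

    product : ∀ i j {a b} → a ≤ i * s → b ≤ j * s → a * b ≤ (i * j) * σ
    product i j a≤ b≤ = ℕ.≤-trans (ℕ.*-mono-≤ a≤ b≤)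
      (ℕ.≤-reflexive (solve 3 (λ i j s → (i :* s) :* (j :* s) := (i :* j) :* (s :* s)) refl i j s))
      where open ℕSolver.+-*-Solver

    suc-2n : ∀ {a} → a ≤ n + n → suc a ≤ 2 * s
    suc-2n a≤ = ℕ.≤-trans (s≤s a≤) (ℕ.≤-trans (ℕ.n≤1+n _) (ℕ.≤-reflexive (solve 1 (λ n → con 2 :+ (n :+ n) := con 2 :* (con 1 :+ n)) refl n)))
      where open ℕSolver.+-*-Solver

    lin : ∀ i {a} → a ≤ i * s → a ≤ i * σ
    lin i a≤ = ℕ.≤-trans a≤ (ℕ.*-monoʳ-≤ i s≤σ)

    +0 : ∀ {a b} → a ≤ b → a + 0 ≤ b
    +0 a≤ = ℕ.≤-trans (ℕ.≤-reflexive (ℕ.+-identityʳ _)) a≤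

    time-count : (p : V → Bool) (Y : List V) → length Y ≤ n → time (countᵀ (λ w → return (p w)) Y) ≤ 2 * s
    time-count p Y Y≤ = ℕ.≤-trans (time-countᵀ p Y) (ℕ.*-monoʳ-≤ 2 (s≤s Y≤))

    time-d̄ᵀ : ∀ v Y → length Y ≤ n → time (d̄ᵀ v Y) ≤ 2 * s
    time-d̄ᵀ v Y = time-count (N v) Y

    time-filter : {p : V → Timed Bool} (xs : List V) → length xs ≤ n → (∀ v → time (p v) ≤ 4 * s) → time (filterᵀ p xs) ≤ 5 * σ
    time-filter xs xs≤ b = ℕ.≤-trans (time-filterᵀ b xs) (product 1 5 {suc (length xs)} {suc (4 * s)}
      (ℕ.≤-trans (s≤s xs≤) (ℕ.≤-reflexive (sym (ℕ.*-identityˡ s)))) (ℕ.+-monoˡ-≤ (4 * s) (s≤s {0} {n} z≤n)))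

    time-filter-return : (p : V → Bool) (xs : List V) → time (filterᵀ (λ w → return (p w)) xs) ≤ suc (length xs)
    time-filter-return p xs = ℕ.≤-trans (time-filterᵀ {p = λ w → return (p w)} {0} (λ _ → z≤n) xs) (ℕ.≤-reflexive (ℕ.*-identityʳ _))

    time-d̄-satisfies : ∀ p Y → length Y ≤ n → ∀ v → time (d̄-satisfiesᵀ p Y v) ≤ 4 * s
    time-d̄-satisfies p Y Y≤ v = +0 (ℕ.≤-trans (time-d̄ᵀ v Y Y≤) (ℕ.*-monoˡ-≤ s {2} {4} (s≤s (s≤s z≤n))))

    four : ∀ {a b} → a ≤ 2 * s → b ≤ 2 * s → a + b ≤ 4 * s
    four a≤ b≤ = ℕ.≤-trans (ℕ.+-mono-≤ a≤ b≤) (ℕ.≤-reflexive (sym (ℕ.*-distribʳ-+ s 2 2)))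

    time-inC′ : ∀ C X → length C ≤ n → length X ≤ n → ∀ v → time (inC′?ᵀ C X v) ≤ 4 * s
    time-inC′ C X C≤ X≤ v = four (time-d̄ᵀ v X X≤) (+0 (time-d̄ᵀ v C C≤))

    time-degrees : ∀ i C vs → length C ≤ n → suc (length vs) ≤ i * s → time (mapᵀ (withDegreeᵀ C) vs) ≤ (i * 3) * σ
    time-degrees i C vs C≤ vs≤ = ℕ.≤-trans (time-mapᵀ {f = withDegreeᵀ C} (λ v → +0 (time-d̄ᵀ v C C≤)) vs)
      (product i 3 {suc (length vs)} {suc (2 * s)} vs≤ (ℕ.+-monoˡ-≤ (2 * s) (s≤s {0} {n} z≤n)))

    length-degrees : ∀ C X vs → length (degreesᵀ C X vs) ≡ length vs
    length-degrees C X vs = trans (cong length (degreesᵀ≡ C X vs)) (length-map _ vs)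

    length-outsideᵀ : ∀ C X → length (outsideᵀ C X) ≤ length C
    length-outsideᵀ C X = subst (λ z → length z ≤ length C) (sym (outsideᵀ≡ C X)) (length-filterᵇ-≤ _ C)

    length-C′ᵀ : ∀ C X → length (C′ᵀ C X) ≤ length C
    length-C′ᵀ C X = subst (λ z → length z ≤ length C) (sym (value-filterᵀ (value-inC′ C X) C)) (length-filterᵇ-≤ _ C)

    length-candidatesᵀ : ∀ C X → length C ≤ n → length (candidatesᵀ C X) ≤ n + n
    length-candidatesᵀ C X C≤ = subst (λ z → length z ≤ n + n) (sym (candidatesᵀ≡ C X))
      (ℕ.≤-trans (ℕ.≤-reflexive (length-++ (outside C X)))
        (ℕ.+-mono-≤ (ℕ.≤-trans (length-filterᵇ-≤ _ C) C≤)
          (ℕ.≤-trans (length-filterᵇ-≤ _ (filterᵇ (inC′ᵇ C X) C)) (ℕ.≤-trans (length-filterᵇ-≤ _ C) C≤))))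

    time-pick : (ps : List (V × ℕ)) → suc (length ps) ≤ 2 * s →
                time (mapᵀ (λ p → return (proj₁ p)) ps) + (length (value (mapᵀ (λ p → return (proj₁ p)) ps)) + 0) ≤ 4 * s
    time-pick ps ps≤ = four
      (ℕ.≤-trans (time-mapᵀ {f = λ p → return (proj₁ p)} {0} (λ _ → z≤n) ps) (ℕ.≤-trans (ℕ.≤-reflexive (ℕ.*-identityʳ _)) ps≤))
      (+0 (ℕ.≤-trans (ℕ.≤-reflexive (trans (cong length (value-mapᵀ {f = λ p → return (proj₁ p)} {proj₁} (λ _ → refl) ps)) (length-map proj₁ ps)))
        (ℕ.≤-trans (ℕ.n≤1+n _) ps≤)))

    -- `t` stands for the cost of breaking ties, which depends on the case taken by `choose`.
    time-degreesC-minimal : ∀ C X → length C ≤ n → length X ≤ n → ∀ {t} → t ≤ 4 * σ →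
      time (filterᵀ (inC′?ᵀ C X) C) + (time (filterᵀ (notInC′?ᵀ C X) C)
        + (time (filterᵀ (d̄-satisfiesᵀ (1 ≤ᵇ_) (outsideᵀ C X)) (C′ᵀ C X)) + (time (appendᵀ (outsideᵀ C X) (C2ᵀ C X))
        + (time (mapᵀ (withDegreeᵀ C) (candidatesᵀ C X)) + (time (mapᵀ (withDegreeᵀ C) X)
        + (time (minimalᵀ (degreesᵀ C X (candidatesᵀ C X))) + (time (minimalᵀ (degreesᵀ C X X)) + t))))))) ≤ 32 * σ
    time-degreesC-minimal C X C≤ X≤ t≤ =
      add 5 27 (time-filter C C≤ (time-inC′ C X C≤ X≤))
      (add 5 22 (time-filter C C≤ (λ v → +0 (time-inC′ C X C≤ X≤ v)))
      (add 5 17 (time-filter (C′ᵀ C X) (ℕ.≤-trans (length-C′ᵀ C X) C≤) (time-d̄-satisfies (1 ≤ᵇ_) (outsideᵀ C X) (ℕ.≤-trans (length-outsideᵀ C X) C≤)))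
      (add 1 16 (unit (ℕ.≤-trans (ℕ.≤-reflexive (time-appendᵀ (outsideᵀ C X) (C2ᵀ C X))) (ℕ.≤-trans (s≤s (ℕ.≤-trans (length-outsideᵀ C X) C≤)) s≤σ)))
      (add 6 10 (time-degrees 2 C (candidatesᵀ C X) C≤ (suc-2n (length-candidatesᵀ C X C≤)))
      (add 3 7 (time-degrees 1 C X C≤ (ℕ.≤-trans (s≤s X≤) (ℕ.≤-reflexive (sym (ℕ.*-identityˡ s)))))
      (add 2 5 (lin 2 (ℕ.≤-trans (ℕ.≤-reflexive (trans (time-minimalᵀ (degreesᵀ C X (candidatesᵀ C X))) (cong suc (length-degrees C X (candidatesᵀ C X))))) (suc-2n (length-candidatesᵀ C X C≤))))
      (add 1 4 (unit (ℕ.≤-trans (ℕ.≤-reflexive (trans (time-minimalᵀ (degreesᵀ C X X)) (cong suc (length-degrees C X X)))) (ℕ.≤-trans (s≤s X≤) s≤σ)))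
        t≤)))))))

    time-pivot : ∀ S C X → length C ≤ n → length X ≤ n → time (pivotᵀ ⟨ S , C , X ⟩) ≤ 32 * σ
    time-pivot S C X C≤ X≤ with value (minimalᵀ (degreesᵀ C X (candidatesᵀ C X))) | value (minimalᵀ (degreesᵀ C X X))
                              | sizeC | sizeX
      where
      sizeC : length (value (minimalᵀ (degreesᵀ C X (candidatesᵀ C X)))) ≤ n + n
      sizeC = ℕ.≤-trans (Minimals-length (degreesᵀ C X (candidatesᵀ C X)))
        (ℕ.≤-trans (ℕ.≤-reflexive (length-degrees C X (candidatesᵀ C X))) (length-candidatesᵀ C X C≤))
      sizeX : length (value (minimalᵀ (degreesᵀ C X X))) ≤ n + n
      sizeX = ℕ.≤-trans (Minimals-length (degreesᵀ C X X))
        (ℕ.≤-trans (ℕ.≤-reflexive (length-degrees C X X)) (ℕ.≤-trans X≤ (ℕ.m≤m+n n n)))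
    ... | []     | []     | _   | _   = time-degreesC-minimal C X C≤ X≤ z≤n
    ... | _ ∷ ps | []     | ps≤ | _   = time-degreesC-minimal C X C≤ X≤ (lin 4 (time-pick ps (ℕ.≤-trans ps≤ (ℕ.≤-trans (ℕ.n≤1+n _) (suc-2n ℕ.≤-refl)))))
    ... | []     | _ ∷ qs | _   | qs≤ = time-degreesC-minimal C X C≤ X≤ (lin 4 (time-pick qs (ℕ.≤-trans qs≤ (ℕ.≤-trans (ℕ.n≤1+n _) (suc-2n ℕ.≤-refl)))))
    ... | (_ , k) ∷ ps | (_ , l) ∷ qs | ps≤ | qs≤ with l ≤ᵇ k
    ...   | true  = time-degreesC-minimal C X C≤ X≤ (lin 4 (time-pick qs (ℕ.≤-trans qs≤ (ℕ.≤-trans (ℕ.n≤1+n _) (suc-2n ℕ.≤-refl)))))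
    ...   | false = time-degreesC-minimal C X C≤ X≤ (lin 4 (time-pick ps (ℕ.≤-trans ps≤ (ℕ.≤-trans (ℕ.n≤1+n _) (suc-2n ℕ.≤-refl)))))

    time-nonNeighbours : ∀ S C X v → length C ≤ n → time (nonNeighboursᵀ ⟨ S , C , X ⟩ v) ≤ 2 * σ
    time-nonNeighbours S C X v C≤ = add 1 1
      (unit (ℕ.≤-trans (time-filter-return (N v) C) (ℕ.≤-trans (s≤s C≤) s≤σ)))
      (+0 (unit (ℕ.≤-trans (ℕ.≤-reflexive (cong length (value-filterᵀ {p = λ w → return (N v w)} (λ _ → refl) C)))
        (ℕ.≤-trans (length-filterᵇ-≤ (N v) C) (ℕ.≤-trans C≤ (ℕ.≤-trans (ℕ.n≤1+n n) s≤σ))))))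

    time-branchList : ∀ S C X p → length C ≤ n → time (branchListᵀ ⟨ S , C , X ⟩ p) ≤ 2 * σ
    time-branchList S C X none      C≤ = z≤n
    time-branchList S C X (fromX v) C≤ = time-nonNeighbours S C X v C≤
    time-branchList S C X (fromC v) C≤ = +0 (time-nonNeighbours S C X v C≤)

    -- In each round `X` gains the vertex that `vs` loses, so the sum of their lengths is the
    -- quantity that stays bounded.
    time-children : ∀ m S C X vs → length C ≤ m → length X + length vs ≤ m →
                    time (childrenᵀ S C X vs) ≤ suc (length vs) * (1 + (suc m + (suc m + suc m)))
    time-children m S C X []       C≤ X≤ = s≤s z≤n
    time-children m S C X (v ∷ vs) C≤ X≤ = s≤s (ℕ.≤-trans
      (ℕ.+-mono-≤ (ℕ.≤-trans (time-filter-return (λ w → not (v ≟ⱽ w)) C) (s≤s C≤))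
        (ℕ.+-mono-≤ (ℕ.≤-trans (time-filter-return (λ w → not (N v w)) C⁻) (s≤s C⁻≤))
          (ℕ.+-mono-≤ (ℕ.≤-trans (time-filter-return (λ w → not (N v w)) X) (s≤s (ℕ.≤-trans (ℕ.m≤m+n (length X) _) X≤)))
            (+0 (time-children m S C⁻ (v ∷ X) vs C⁻≤ (ℕ.≤-trans (ℕ.≤-reflexive (sym (ℕ.+-suc (length X) (length vs)))) X≤))))))
      (ℕ.≤-reflexive (solve 2 (λ a r → a :+ (a :+ (a :+ r)) := (a :+ (a :+ a)) :+ r) refl (suc m) (suc (length vs) * (1 + (suc m + (suc m + suc m)))))))
      where
      open ℕSolver.+-*-Solver
      C⁻ : List V
      C⁻ = value (filterᵀ (λ w → return (not (v ≟ⱽ w))) C)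
      C⁻≤ : length C⁻ ≤ m
      C⁻≤ = subst (λ z → length z ≤ m) (sym (value-filterᵀ {p = λ w → return (not (v ≟ⱽ w))} (λ _ → refl) C))
        (ℕ.≤-trans (length-filterᵇ-≤ _ C) C≤)

    time-children-σ : ∀ S C X vs → length C ≤ n → length X ≤ n → length vs ≤ suc n → time (childrenᵀ S C X vs) ≤ 14 * σ
    time-children-σ S C X vs C≤ X≤ vs≤ = ℕ.≤-trans
      (time-children (n + suc n) S C X vs (ℕ.≤-trans C≤ (ℕ.m≤m+n n (suc n))) (ℕ.+-mono-≤ X≤ vs≤))
      (product 2 7 {suc (length vs)} (ℕ.≤-trans (s≤s vs≤) (ℕ.≤-trans (ℕ.+-monoˡ-≤ (suc n) (s≤s (z≤n {n})))
          (ℕ.≤-reflexive (solve 1 (λ s → s :+ s := con 2 :* s) refl s))))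
        (ℕ.≤-trans (ℕ.+-monoˡ-≤ _ (s≤s (z≤n {n}))) (ℕ.≤-reflexive (solve 1 (λ s → s :+ ((s :+ s) :+ ((s :+ s) :+ (s :+ s))) := con 7 :* s) refl s))))
      where open ℕSolver.+-*-Solver

    length-branchList : ∀ S C X p → length C ≤ n → length (value (branchListᵀ ⟨ S , C , X ⟩ p)) ≤ suc n
    length-branchList S C X none      C≤ = z≤n
    length-branchList S C X (fromX v) C≤ = ℕ.≤-trans (ℕ.≤-reflexive (trans (↭-length (arrange-↭ G ⟨ S , C , X ⟩ _))
      (cong length (value-filterᵀ {p = λ w → return (N v w)} (λ _ → refl) C)))) (ℕ.≤-trans (length-filterᵇ-≤ (N v) C) (ℕ.≤-trans C≤ (ℕ.n≤1+n n)))
    length-branchList S C X (fromC v) C≤ = s≤s (ℕ.≤-trans (ℕ.≤-reflexive (trans (↭-length (arrange-↭ G ⟨ S , C , X ⟩ _))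
      (cong length (value-filterᵀ {p = λ w → return (N v w)} (λ _ → refl) C)))) (ℕ.≤-trans (length-filterᵇ-≤ (N v) C) C≤))

  arranged : ∀ S C X v → Unique C → NonNeighbours C v (value (nonNeighboursᵀ ⟨ S , C , X ⟩ v))
  arranged S C X v C! rewrite value-filterᵀ {p = λ w → return (N v w)} {N v} (λ _ → refl) C = record
    { unique = Permutation.Unique-resp-↭ (setoid V) (↭⇒↭ₛ (↭-sym perm)) (Unique-filterᵇ⁺ (N v) C!)
    ; sound  = λ w∈ → ∈-filterᵇ⁻ (N v) C (∈-resp-↭ perm w∈)
    ; compl  = λ w∈ e → ∈-resp-↭ (↭-sym perm) (∈-filterᵇ⁺ (N v) w∈ e)
    ; len    = ↭-length perm
    }
    where
    perm : arrange G ⟨ S , C , X ⟩ (filterᵇ (N v) C) ↭ filterᵇ (N v) C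
    perm = arrange-↭ G ⟨ S , C , X ⟩ (filterᵇ (N v) C)

  TooSmall : List V → Set
  TooSmall W = length (filterᵇ (isLeft G) W) < τL ⊎ length (filterᵇ (isRight G) W) < τR

  output-of : List V → Timed (List (Subgraph G))
  output-of W = TwoBiplexProcedure.run twoBiplex G τL τR W

  -- `no-pivot` carries no time bound because `inside-twoBiplex` will refute it under the invariant.
  data StepSpec (S C X : List V) (q : ℕ) : Timed Action → Set where
    outputs   : ∀ {t} → IsTwoBiplex G (S ++ C) → X ≡ [] → t ≤ q + time (output-of (S ++ C)) →
                StepSpec S C X q (output (value (output-of (S ++ C))) ⧗ t)
    prunes    : ∀ {t} → TooSmall (S ++ C) ⊎ HasDominating C X → t ≤ q → StepSpec S C X q (prune ⧗ t)
    no-pivot  : ∀ {Bs t} → ¬ IsTwoBiplex G (S ++ C) → X ≡ [] → (∀ {v} → v ∈ C → ¬ NotC′ C X v) → StepSpec S C X q (branch Bs ⧗ t)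
    branchesX : ∀ {v vs t} → ¬ HasDominating C X → v ∈ X → Minimal C X v → NonNeighbours C v vs → t ≤ q →
                StepSpec S C X q (branch (children S C X [] vs) ⧗ t)
    branchesC : ∀ {v vs t} → ¬ HasDominating C X → v ∈ C → Candidate C X v → (∀ {x} → x ∈ X → d v C < d x C) →
                (∀ {y} → y ∈ C → Candidate C X y → d v C ≤ d y C) → NonNeighbours C v vs → t ≤ q →
                StepSpec S C X q (branch (children S C X [] (v ∷ vs)) ⧗ t)

  reindex : ∀ {S C X q Bs Bs′ t} → Bs ≡ Bs′ → StepSpec S C X q (branch Bs ⧗ t) → StepSpec S C X q (branch Bs′ ⧗ t)
  reindex refl spec = spec

  value-twoBiplex : ∀ W → value (twoBiplex?ᵀ W) ≡ null (filterᵇ (λ v → 2 <ᵇ d v W) W)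
  value-twoBiplex W = cong null (value-filterᵀ (λ v → cong (2 <ᵇ_) (value-d̄ᵀ v W)) W)

  twoBiplex-true : ∀ W → value (twoBiplex?ᵀ W) ≡ true → IsTwoBiplex G W
  twoBiplex-true W e = All.tabulate λ {v} v∈ → ≤2 v∈ refl
    where
    ≤2 : ∀ {v b} → v ∈ W → (2 <ᵇ d v W) ≡ b → d v W ≤ 2
    ≤2 {b = false} v∈ e′ = <ᵇ-false e′
    ≤2 {v} {true} v∈ e′ = contradiction (∈-filterᵇ⁺ (λ v → 2 <ᵇ d v W) v∈ e′)
      (subst (_ ∉_) (sym (null-true (trans (sym (value-twoBiplex W)) e))) λ ())

  twoBiplex-false : ∀ W → value (twoBiplex?ᵀ W) ≡ false → ¬ IsTwoBiplex G W
  twoBiplex-false W e biplex with filterᵇ (λ v → 2 <ᵇ d v W) W in eq | trans (sym (value-twoBiplex W)) e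
  ... | [] | ()
  ... | v ∷ _ | _ = let (v∈ , e′) = ∈-filterᵇ⁻ (λ v → 2 <ᵇ d v W) W (subst (v ∈_) (sym eq) (here refl)) in
    ℕ.<-irrefl refl (ℕ.<-≤-trans (<ᵇ-true e′) (All.lookup biplex v∈))

  nonMaximal-true : ∀ C X → value (nonMaximal?ᵀ C X) ≡ true → HasDominating C X
  nonMaximal-true C X e with value (filterᵀ (d̄-satisfiesᵀ (_≡ᵇ 0) C) X) in eq
  ... | x ∷ _ = let (x∈ , e′) = ∈-filterᵇ⁻ (λ v → d v C ≡ᵇ 0) X
                                  (subst (x ∈_) (trans (sym eq) (value-filterᵀ (λ v → cong (_≡ᵇ 0) (value-d̄ᵀ v C)) X)) (here refl))
    in x , x∈ , ℕ.≡ᵇ⇒≡ _ 0 (≡true⇒T e′)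

  nonMaximal-false : ∀ C X → value (nonMaximal?ᵀ C X) ≡ false → ¬ HasDominating C X
  nonMaximal-false C X e (x , x∈ , d≡0) with value (filterᵀ (d̄-satisfiesᵀ (_≡ᵇ 0) C) X) in eq
  ... | [] = contradiction (∈-filterᵇ⁺ (λ v → d v C ≡ᵇ 0) x∈ (T⇒≡true (ℕ.≡⇒≡ᵇ _ 0 d≡0)))
      (subst (x ∉_) (trans (sym eq) (value-filterᵀ (λ v → cong (_≡ᵇ 0) (value-d̄ᵀ v C)) X)) λ ())

  tooSmall-true : ∀ W → value (tooSmall?ᵀ W) ≡ true → TooSmall W
  tooSmall-true W e = Sum.map
    (λ e → ℕ.≤-trans (s≤s (ℕ.≤-reflexive (sym (value-countᵀ (isLeft G) W)))) (<ᵇ-true e))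
    (λ e → ℕ.≤-trans (s≤s (ℕ.≤-reflexive (sym (value-countᵀ (isRight G) W)))) (<ᵇ-true e))
    (∨-true e)

  step-spec : ∀ n S C X → length (S ++ C) ≤ n → length C ≤ n → length X ≤ n → Unique C →
              StepSpec S C X (64 * Times.σ n) (stepᵀ ⟨ S , C , X ⟩)
  step-spec n S C X SC≤ C≤ X≤ C! = go
    where
    open Times n
    t₁ : time (appendᵀ S C) ≤ 1 * σ
    t₁ = unit (ℕ.≤-trans (ℕ.≤-reflexive (time-appendᵀ S C)) (ℕ.≤-trans (s≤s (ℕ.≤-trans (ℕ.≤-trans (ℕ.m≤m+n (length S) _) (ℕ.≤-reflexive (sym (length-++ S)))) SC≤)) s≤σ))
    t₂ : time (twoBiplex?ᵀ (S ++ C)) ≤ 5 * σ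
    t₂ = +0 (time-filter (S ++ C) SC≤ (time-d̄-satisfies (2 <ᵇ_) (S ++ C) SC≤))
    t₃ : time (tooSmall?ᵀ (S ++ C)) ≤ 4 * σ
    t₃ = lin 4 (four (time-count (isLeft G) (S ++ C) SC≤) (+0 (time-count (isRight G) (S ++ C) SC≤)))
    t₄ : time (nonMaximal?ᵀ C X) ≤ 5 * σ
    t₄ = +0 (time-filter X X≤ (time-d̄-satisfies (_≡ᵇ 0) C C≤))
    checked : ∀ {t} → t ≤ 48 * σ → 1 + (time (appendᵀ S C) + (time (twoBiplex?ᵀ (S ++ C)) + (time (tooSmall?ᵀ (S ++ C)) + (time (nonMaximal?ᵀ C X) + t)))) ≤ 64 * σ
    checked t≤ = add 1 63 (unit 1≤σ) (add 1 62 t₁ (add 5 57 t₂ (add 4 53 t₃ (add 5 48 t₄ t≤))))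
    expanded : ∀ p → time (pivotᵀ ⟨ S , C , X ⟩) + (time (branchListᵀ ⟨ S , C , X ⟩ p) + (time (childrenᵀ S C X (value (branchListᵀ ⟨ S , C , X ⟩ p))) + 0)) ≤ 48 * σ
    expanded p = add 32 16 (time-pivot S C X C≤ X≤) (add 2 14 (time-branchList S C X p C≤)
      (+0 (time-children-σ S C X (value (branchListᵀ ⟨ S , C , X ⟩ p)) C≤ X≤ (length-branchList S C X p C≤))))
    open ℕ.≤-Reasoning
    finished : 1 + (time (appendᵀ S C) + (time (twoBiplex?ᵀ (S ++ C)) + (time (output-of (S ++ C)) + 0))) ≤ 64 * σ + time (output-of (S ++ C))
    finished = begin
      1 + (time (appendᵀ S C) + (time (twoBiplex?ᵀ (S ++ C)) + (time (output-of (S ++ C)) + 0)))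
        ≡⟨ solve 3 (λ a b c → con 1 :+ (a :+ (b :+ (c :+ con 0))) := con 1 :+ (a :+ b) :+ c) refl (time (appendᵀ S C)) (time (twoBiplex?ᵀ (S ++ C))) (time (output-of (S ++ C))) ⟩
      1 + (time (appendᵀ S C) + time (twoBiplex?ᵀ (S ++ C))) + time (output-of (S ++ C))
        ≤⟨ ℕ.+-monoˡ-≤ _ (ℕ.≤-trans (add 1 6 (unit 1≤σ) (add 1 5 t₁ t₂)) (ℕ.*-monoˡ-≤ σ {7} {64} (ℕ.≤ᵇ⇒≤ 7 64 tt))) ⟩
      64 * σ + time (output-of (S ++ C)) ∎
      where open ℕSolver.+-*-Solver
    go : StepSpec S C X (64 * σ) (stepᵀ ⟨ S , C , X ⟩)
    go with value (appendᵀ S C) | value-appendᵀ S C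
    ... | ._ | refl with value (twoBiplex?ᵀ (S ++ C)) ∧ null X in e₁
    ...   | true = outputs (twoBiplex-true (S ++ C) (proj₁ (∧-true e₁))) (null-true (proj₂ (∧-true {value (twoBiplex?ᵀ (S ++ C))} e₁))) finished
    ...   | false with value (tooSmall?ᵀ (S ++ C)) ∨ value (nonMaximal?ᵀ C X) in e₂
    ...     | true = prunes (Sum.map (tooSmall-true (S ++ C)) (nonMaximal-true C X) (∨-true e₂)) (checked z≤n)
    ...     | false with value (pivotᵀ ⟨ S , C , X ⟩) | pivot-spec S C X
    ...       | none | none X≡[] inside = no-pivot
      (twoBiplex-false (S ++ C) (∧-falseˡ (cong null X≡[]) e₁)) X≡[] inside
      where
      ∧-falseˡ : ∀ {a b} → b ≡ true → a ∧ b ≡ false → a ≡ false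
      ∧-falseˡ {false} _ _ = refl
      ∧-falseˡ {true} refl ()
    ...       | fromX v | fromX v∈X minimal = reindex
      (sym (value-childrenᵀ S C X [] (value (nonNeighboursᵀ ⟨ S , C , X ⟩ v))))
      (branchesX (nonMaximal-false C X (proj₂ (∨-false {value (tooSmall?ᵀ (S ++ C))} e₂))) v∈X minimal (arranged S C X v C!) (checked (expanded (fromX v))))
    ...       | fromC v | fromC v∈C candidate minX minC = reindex
      (sym (value-childrenᵀ S C X [] (v ∷ value (nonNeighboursᵀ ⟨ S , C , X ⟩ v))))
      (branchesC (nonMaximal-false C X (proj₂ (∨-false {value (tooSmall?ᵀ (S ++ C))} e₂))) v∈C candidate minX minC (arranged S C X v C!) (checked (expanded (fromC v))))

-- Correctness

Enumerates-⇔ : {A : Set} {P Q : A → Set} {xs : List A} → (∀ x → P x ⇔ Q x) → Enumerates P xs → Enumerates Q xs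
Enumerates-⇔ e (u , f) = u , λ x → mk⇔ (Equivalence.to (e x) ∘ Equivalence.to (f x)) (Equivalence.from (f x) ∘ Equivalence.from (e x))

Enumerates-[] : {A : Set} {P : A → Set} → (∀ x → ¬ P x) → Enumerates P []
Enumerates-[] empty = [] , λ x → mk⇔ (λ ()) (λ p → contradiction p (empty x))

Enumerates-++ : {A : Set} {P Q : A → Set} {xs ys : List A} → (∀ x → P x → ¬ Q x) →
                Enumerates P xs → Enumerates Q ys → Enumerates (λ x → P x ⊎ Q x) (xs ++ ys)
Enumerates-++ {xs = xs} disjoint (u , f) (v , g) =
  Unique-++⁺ u v (λ {x} x∈ x∈′ → disjoint x (Equivalence.to (f x) x∈) (Equivalence.to (g x) x∈′)) ,
  λ x → mk⇔ (λ x∈ → Sum.map (Equivalence.to (f x)) (Equivalence.to (g x)) (∈-++⁻ xs x∈))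
            Sum.[ ∈-++⁺ˡ ∘ Equivalence.from (f x) , ∈-++⁺ʳ xs ∘ Equivalence.from (g x) ]

length-cartesianProduct : {A B : Set} (xs : List A) (ys : List B) → length (cartesianProduct xs ys) ≡ length xs * length ys
length-cartesianProduct []       ys = refl
length-cartesianProduct (x ∷ xs) ys = trans (length-++ (map (x ,_) ys)) (cong₂ _+_ (length-map (x ,_) ys) (length-cartesianProduct xs ys))

length-allFin : ∀ n → length (allFin n) ≡ n
length-allFin n = length-tabulate {n = n} (λ i → i)

1≤∣p∣⇒nonempty : ∀ {n} (p : Subset n) → 1 ≤ ∣ p ∣ → ∃ λ x → x Subset.∈ p
1≤∣p∣⇒nonempty {n} p 1≤ with Subset.nonempty? p
... | yes ne = ne
... | no ¬ne = contradiction (subst (1 ≤_) (trans (cong ∣_∣ (Subset.Empty-unique ¬ne)) (Subset.∣⊥∣≡0 n)) 1≤) λ ()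

x∈p⇒1≤∣p∣ : ∀ {n} {p : Subset n} {x} → x Subset.∈ p → 1 ≤ ∣ p ∣
x∈p⇒1≤∣p∣ {p = p} {x} x∈p = subst (_≤ ∣ p ∣) (Subset.∣⁅x⁆∣≡1 x)
  (Subset.p⊆q⇒∣p∣≤∣q∣ λ y∈ → subst (Subset._∈ p) (sym (Subset.x∈⁅y⁆⇒x≡y x y∈)) x∈p)

∈-tabulate⁺ : ∀ {n} (f : Fin n → Bool) {x} → f x ≡ true → x Subset.∈ tabulate f
∈-tabulate⁺ f {x} e = Vec.lookup⇒[]= x (tabulate f) (trans (Vec.lookup∘tabulate f x) e)

∈-tabulate⁻ : ∀ {n} (f : Fin n → Bool) {x} → x Subset.∈ tabulate f → f x ≡ true
∈-tabulate⁻ f {x} x∈ = trans (sym (Vec.lookup∘tabulate f x)) (Vec.[]=⇒lookup x∈)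

module Correctness (G : BipartiteGraph) where
  open BipartiteGraph G
  open Branching G
  open Counting G
  open DecMembership _≟ᵛ_ using (_∈?_)

  private
    V : Set
    V = Vertex G

    N : V → V → Bool
    N = nonAdjacent G

    d : V → List V → ℕ
    d = d̄ G

    infix 4 _∈ᴴ_ _∈ᴴ?_
    _∈ᴴ_ : V → Subgraph G → Set
    _∈ᴴ_ = _∈ᴳ_ G

    _∈ᴴ?_ : ∀ v H → Dec (v ∈ᴴ H)
    inj₁ u ∈ᴴ? (A , B) = u Subset.∈? A
    inj₂ w ∈ᴴ? (A , B) = w Subset.∈? B

  ∈-vertices : ∀ v → v ∈ vertices G
  ∈-vertices (inj₁ u) = ∈-++⁺ˡ (∈-map⁺ inj₁ (∈-allFin u))
  ∈-vertices (inj₂ w) = ∈-++⁺ʳ (map inj₁ (allFin ∣L∣)) (∈-map⁺ inj₂ (∈-allFin w))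

  vertices-! : Unique (vertices G)
  vertices-! = Unique-++⁺ (Unique.map⁺ Sum.inj₁-injective (Unique.allFin⁺ ∣L∣)) (Unique.map⁺ Sum.inj₂-injective (Unique.allFin⁺ ∣R∣)) disjoint
    where
    disjoint : ∀ {x} → x ∈ map inj₁ (allFin ∣L∣) → x ∉ map inj₂ (allFin ∣R∣)
    disjoint x∈ x∈′ with ∈-map⁻ inj₁ x∈ | ∈-map⁻ inj₂ x∈′
    ... | _ , _ , refl | _ , _ , ()

  length-vertices : length (vertices G) ≡ order-of G
  length-vertices = trans (length-++ (map inj₁ (allFin ∣L∣)))
    (cong₂ _+_ (trans (length-map inj₁ (allFin ∣L∣)) (length-allFin ∣L∣)) (trans (length-map inj₂ (allFin ∣R∣)) (length-allFin ∣R∣)))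

  Unique⇒length≤order : ∀ {W} → Unique W → length W ≤ order-of G
  Unique⇒length≤order {W} W! = subst (length W ≤_) length-vertices (Unique-⊆⇒length≤ W! λ {v} _ → ∈-vertices v)

  biclique⇒adjacent : ∀ {H} → IsBiclique G H → ∀ {v w} → v ∈ᴴ H → w ∈ᴴ H → N v w ≡ false
  biclique⇒adjacent b {inj₁ u} {inj₁ w} _  _  = refl
  biclique⇒adjacent b {inj₁ u} {inj₂ w} u∈ w∈ = cong not (Equivalence.to T-≡ (b u w u∈ w∈))
  biclique⇒adjacent b {inj₂ u} {inj₁ w} u∈ w∈ = cong not (Equivalence.to T-≡ (b w u w∈ u∈))
  biclique⇒adjacent b {inj₂ u} {inj₂ w} _  _  = refl

  adjacent⇒biclique : ∀ {H} → (∀ {v w} → v ∈ᴴ H → w ∈ᴴ H → N v w ≡ false) → IsBiclique G H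
  adjacent⇒biclique adj u w u∈ w∈ = Equivalence.from T-≡ (not-injective (adj {inj₁ u} {inj₂ w} u∈ w∈))
    where
    not-injective : ∀ {b} → not b ≡ false → b ≡ true
    not-injective {true} _ = refl

  insert : V → Subgraph G → Subgraph G
  insert (inj₁ u) (A , B) = A ∪ ⁅ u ⁆ , B
  insert (inj₂ w) (A , B) = A , B ∪ ⁅ w ⁆

  ∈-insert⁺ : ∀ v {H w} → w ∈ᴴ H ⊎ w ≡ v → w ∈ᴴ insert v H
  ∈-insert⁺ (inj₁ u) {w = inj₁ _} (inj₁ w∈)   = Subset.x∈p∪q⁺ (inj₁ w∈)
  ∈-insert⁺ (inj₁ u) {w = inj₁ _} (inj₂ refl) = Subset.x∈p∪q⁺ (inj₂ (Subset.x∈⁅x⁆ u))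
  ∈-insert⁺ (inj₁ u) {w = inj₂ _} (inj₁ w∈)   = w∈
  ∈-insert⁺ (inj₂ u) {w = inj₂ _} (inj₁ w∈)   = Subset.x∈p∪q⁺ (inj₁ w∈)
  ∈-insert⁺ (inj₂ u) {w = inj₂ _} (inj₂ refl) = Subset.x∈p∪q⁺ (inj₂ (Subset.x∈⁅x⁆ u))
  ∈-insert⁺ (inj₂ u) {w = inj₁ _} (inj₁ w∈)   = w∈

  ∈-insert⁻ : ∀ v {H w} → w ∈ᴴ insert v H → w ∈ᴴ H ⊎ w ≡ v
  ∈-insert⁻ (inj₁ u) {A , B} {inj₁ w} w∈ = Sum.map₂ (cong inj₁ ∘ Subset.x∈⁅y⁆⇒x≡y u) (Subset.x∈p∪q⁻ A ⁅ u ⁆ w∈)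
  ∈-insert⁻ (inj₁ u) {A , B} {inj₂ w} w∈ = inj₁ w∈
  ∈-insert⁻ (inj₂ u) {A , B} {inj₂ w} w∈ = Sum.map₂ (cong inj₂ ∘ Subset.x∈⁅y⁆⇒x≡y u) (Subset.x∈p∪q⁻ B ⁅ u ⁆ w∈)
  ∈-insert⁻ (inj₂ u) {A , B} {inj₁ w} w∈ = inj₁ w∈

  maximal-absorbs : ∀ {W H v} → IsMaximalBicliqueOf G W H → v ∈ W → (∀ {w} → w ∈ᴴ H → N v w ≡ false) → v ∈ᴴ H
  maximal-absorbs {W} {H} {v} ((b , H⊆W) , maximal) v∈W adj = subst (v ∈ᴴ_)
    (maximal (insert v H) (adjacent⇒biclique {insert v H} adj′ , λ w w∈ → Sum.[ H⊆W w , (λ { refl → v∈W }) ] (∈-insert⁻ v w∈))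
      (λ w w∈ → ∈-insert⁺ v (inj₁ w∈)))
    (∈-insert⁺ v (inj₂ refl))
    where
    adj′ : ∀ {w x} → w ∈ᴴ insert v H → x ∈ᴴ insert v H → N w x ≡ false
    adj′ {w} {x} w∈ x∈ with ∈-insert⁻ v w∈ | ∈-insert⁻ v x∈
    ... | inj₁ w∈H | inj₁ x∈H = biclique⇒adjacent {H} b w∈H x∈H
    ... | inj₁ w∈H | inj₂ refl = nonAdjacent-flip {x} (adj w∈H)
    ... | inj₂ refl | inj₁ x∈H = adj x∈H
    ... | inj₂ refl | inj₂ refl = nonAdjacent-irrefl v

  -- The invariant of a branch and the bicliques it is responsible for

  record Invariant (S C X : List V) : Set where
    field
      S!       : Unique S
      C!       : Unique C
      X!       : Unique X
      S∌C      : ∀ {v} → v ∈ S → v ∉ C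
      S∌X      : ∀ {v} → v ∈ S → v ∉ X
      C∌X      : ∀ {v} → v ∈ C → v ∉ X
      adjacent : ∀ {s v} → s ∈ S → v ∈ S ⊎ v ∈ C ⊎ v ∈ X → N s v ≡ false
      complete : ∀ {v} → (∀ {s} → s ∈ S → N s v ≡ false) → v ∈ S ⊎ v ∈ C ⊎ v ∈ X

    SC! : Unique (S ++ C)
    SC! = Unique-++⁺ S! C! S∌C

  initial : Invariant [] (vertices G) []
  initial = record
    { S! = [] ; C! = vertices-! ; X! = [] ; S∌C = λ () ; S∌X = λ () ; C∌X = λ _ ()
    ; adjacent = λ () ; complete = λ {v} _ → inj₂ (inj₁ (∈-vertices v)) }

  record Prefix (C us : List V) : Set where
    field
      us!  : Unique us
      us⊆C : us ⊆ C

  child-invariant : ∀ {S C X us v} → Invariant S C X → Prefix C us → v ∈ C → v ∉ us →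
                    Invariant (v ∷ S) (childC C us v) (childX X us v)
  child-invariant {S} {C} {X} {us} {v} inv pre v∈C v∉us = record
    { S! = Unique-∷⁺ (λ v∈S → S∌C v∈S v∈C) S!
    ; C! = Unique-childC us v C!
    ; X! = Unique-filterᵇ⁺ _ (Unique-++⁺ us! X! λ u∈ → C∌X (us⊆C u∈))
    ; S∌C = λ { (here refl) w∈ → proj₁ (proj₂ (∈-childC⁻ {us = us} {v} w∈)) refl ; (there s∈) w∈ → S∌C s∈ (childC⊆C {us = us} {v} w∈) }
    ; S∌X = λ { (here refl) w∈ → Sum.[ v∉us , C∌X v∈C ] (proj₁ (∈-childX⁻ {us = us} {v} w∈))
              ; (there s∈) w∈ → Sum.[ (λ w∈us → S∌C s∈ (us⊆C w∈us)) , S∌X s∈ ] (proj₁ (∈-childX⁻ {us = us} {v} w∈)) }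
    ; C∌X = λ w∈C w∈X → let (w∈C′ , _ , w∉us , _) = ∈-childC⁻ {us = us} {v} w∈C in Sum.[ w∉us , C∌X w∈C′ ] (proj₁ (∈-childX⁻ {us = us} {v} w∈X))
    ; adjacent = adj
    ; complete = comp
    }
    where
    open Invariant inv
    open Prefix pre
    adj : ∀ {s w} → s ∈ v ∷ S → w ∈ v ∷ S ⊎ w ∈ childC C us v ⊎ w ∈ childX X us v → N s w ≡ false
    adj (here refl) (inj₁ (here refl)) = nonAdjacent-irrefl v
    adj {w = w} (here refl) (inj₁ (there w∈)) = nonAdjacent-flip {w} (adjacent w∈ (inj₂ (inj₁ v∈C)))
    adj (here refl) (inj₂ (inj₁ w∈)) = proj₂ (proj₂ (proj₂ (∈-childC⁻ {us = us} {v} w∈)))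
    adj (here refl) (inj₂ (inj₂ w∈)) = proj₂ (∈-childX⁻ {us = us} {v} w∈)
    adj (there s∈) (inj₁ (here refl)) = adjacent s∈ (inj₂ (inj₁ v∈C))
    adj (there s∈) (inj₁ (there w∈)) = adjacent s∈ (inj₁ w∈)
    adj (there s∈) (inj₂ (inj₁ w∈)) = adjacent s∈ (inj₂ (inj₁ (childC⊆C {us = us} {v} w∈)))
    adj (there s∈) (inj₂ (inj₂ w∈)) = adjacent s∈ (inj₂ (Sum.map us⊆C (λ w∈X → w∈X) (proj₁ (∈-childX⁻ {us = us} {v} w∈))))
    comp : ∀ {w} → (∀ {s} → s ∈ v ∷ S → N s w ≡ false) → w ∈ v ∷ S ⊎ w ∈ childC C us v ⊎ w ∈ childX X us v
    comp {w} a with complete {w} (λ s∈ → a (there s∈))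
    ... | inj₁ w∈S = inj₁ (there w∈S)
    ... | inj₂ (inj₂ w∈X) = inj₂ (inj₂ (∈-childX⁺ {us = us} {v} (inj₂ w∈X) (a (here refl))))
    ... | inj₂ (inj₁ w∈C) with w ≟ᵛ v | w ∈? us
    ...   | yes refl | _         = inj₁ (here refl)
    ...   | no _     | yes w∈us  = inj₂ (inj₂ (∈-childX⁺ {us = us} {v} (inj₁ w∈us) (a (here refl))))
    ...   | no w≢v   | no w∉us   = inj₂ (inj₁ (∈-childC⁺ {us = us} {v} w∈C w≢v w∉us (a (here refl))))

  -- Maximality refers to the whole graph, so each biclique listed at a leaf is one of those counted
  -- by β.
  Target : List V → List V → Subgraph G → Set
  Target S C H = IsLargeMaximalBicliqueOf G 1 1 (vertices G) H
    × (∀ {v} → v ∈ S → v ∈ᴴ H) × (∀ {v} → v ∈ᴴ H → v ∈ S ⊎ v ∈ C)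

  target-initial : ∀ H → Target [] (vertices G) H ⇔ IsLargeMaximalBicliqueOf G 1 1 (vertices G) H
  target-initial H = mk⇔ proj₁ λ large → large , (λ ()) , λ {v} _ → inj₂ (∈-vertices v)

  target-adjacent : ∀ {S C H} → Target S C H → ∀ {v w} → v ∈ᴴ H → w ∈ᴴ H → N v w ≡ false
  target-adjacent {H = H} ((((b , _) , _) , _) , _) = biclique⇒adjacent {H} b

  target-absorbs : ∀ {S C H v} → Target S C H → (∀ {w} → w ∈ᴴ H → N v w ≡ false) → v ∈ᴴ H
  target-absorbs {v = v} ((maximal , _) , _) adj = maximal-absorbs maximal (∈-vertices v) adj

  -- Sorts the targets by the first branching vertex they contain: those in `us` have been ruled
  -- out, one in `vs` is still to come.
  Remaining : List V → List V → List V → List V → Subgraph G → Set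
  Remaining S C us vs H = Target S C H × (∀ {u} → u ∈ us → ¬ u ∈ᴴ H) × ∃ λ v → v ∈ vs × v ∈ᴴ H

  remaining-∷ : ∀ {S C X us v vs} → Invariant S C X → Prefix C us → v ∈ C → v ∉ us → ∀ H →
                (Target (v ∷ S) (childC C us v) H ⊎ Remaining S C (v ∷ us) vs H) ⇔ Remaining S C us (v ∷ vs) H
  remaining-∷ {S} {C} {X} {us} {v} {vs} inv pre v∈C v∉us H = mk⇔ to from
    where
    open Invariant inv
    open Prefix pre
    to : Target (v ∷ S) (childC C us v) H ⊎ Remaining S C (v ∷ us) vs H → Remaining S C us (v ∷ vs) H
    to (inj₂ (t , avoid , w , w∈ , w∈H)) = t , avoid ∘ there , w , there w∈ , w∈H
    to (inj₁ (large , S⊆ , ⊆SC)) = (large , S⊆ ∘ there , within) , avoid , v , here refl , S⊆ (here refl)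
      where
      within : ∀ {w} → w ∈ᴴ H → w ∈ S ⊎ w ∈ C
      within w∈ with ⊆SC w∈
      ... | inj₁ (here refl) = inj₂ v∈C
      ... | inj₁ (there w∈S) = inj₁ w∈S
      ... | inj₂ w∈C = inj₂ (childC⊆C {us = us} {v} w∈C)
      avoid : ∀ {u} → u ∈ us → ¬ u ∈ᴴ H
      avoid u∈us u∈H with ⊆SC u∈H
      ... | inj₁ (here refl) = v∉us u∈us
      ... | inj₁ (there u∈S) = S∌C u∈S (us⊆C u∈us)
      ... | inj₂ u∈C = proj₁ (proj₂ (proj₂ (∈-childC⁻ {us = us} {v} u∈C))) u∈us
    from : Remaining S C us (v ∷ vs) H → Target (v ∷ S) (childC C us v) H ⊎ Remaining S C (v ∷ us) vs H
    from (t@(large , S⊆ , ⊆SC) , avoid , w , w∈ , w∈H) with v ∈ᴴ? H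
    ... | yes v∈H = inj₁ (large , (λ { (here refl) → v∈H ; (there s∈) → S⊆ s∈ }) , within)
      where
      within : ∀ {x} → x ∈ᴴ H → x ∈ v ∷ S ⊎ x ∈ childC C us v
      within {x} x∈H with x ≟ᵛ v | ⊆SC x∈H
      ... | yes refl | _ = inj₁ (here refl)
      ... | no _ | inj₁ x∈S = inj₁ (there x∈S)
      ... | no x≢v | inj₂ x∈C = inj₂ (∈-childC⁺ x∈C x≢v (λ x∈us → avoid x∈us x∈H) (target-adjacent t v∈H x∈H))
    ... | no v∉H = inj₂ (t , (λ { (here refl) → v∉H ; (there u∈) → avoid u∈ }) , w , later w∈ , w∈H)
      where
      later : w ∈ v ∷ vs → w ∈ vs
      later (here refl) = contradiction w∈H v∉H
      later (there w∈)  = w∈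

  remaining-disjoint : ∀ {S C us v vs} H → Target (v ∷ S) (childC C us v) H → ¬ Remaining S C (v ∷ us) vs H
  remaining-disjoint H (_ , S⊆ , _) (_ , avoid , _) = avoid (here refl) (S⊆ (here refl))

  -- A target that avoids all non-neighbours of the pivot contains the pivot.
  target-hit : ∀ {S C X v vs} → Invariant S C X → v ∈ C ⊎ v ∈ X → NonNeighbours C v vs → ∀ {H} → Target S C H →
               (∃ λ w → w ∈ vs × w ∈ᴴ H) ⊎ v ∈ᴴ H
  target-hit {v = v} {vs} inv v∈ nn {H} t@(large , S⊆ , ⊆SC) with Any.any? (_∈ᴴ? H) vs
  ... | yes any = inj₁ (find any)
  ... | no none = inj₂ (target-absorbs t adj)
    where
    open Invariant inv
    adj : ∀ {w} → w ∈ᴴ H → N v w ≡ false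
    adj {w} w∈H with ⊆SC w∈H
    ... | inj₁ w∈S = nonAdjacent-flip {w} (adjacent w∈S (inj₂ v∈))
    ... | inj₂ w∈C with N v w in e
    ...   | false = refl
    ...   | true  = contradiction (Any.map (λ { refl → w∈H }) (NonNeighbours.compl nn w∈C e)) none

  remaining-fromX : ∀ {S C X v vs} → Invariant S C X → v ∈ X → NonNeighbours C v vs → ∀ H → Remaining S C [] vs H ⇔ Target S C H
  remaining-fromX inv v∈X nn H = mk⇔ proj₁ λ t → t , (λ ()) , Sum.fromInj₁
    (λ v∈H → contradiction v∈X (Sum.[ S∌X , C∌X ] (proj₂ (proj₂ t) v∈H))) (target-hit inv (inj₂ v∈X) nn t)
    where open Invariant inv

  remaining-fromC : ∀ {S C X v vs} → Invariant S C X → v ∈ C → NonNeighbours C v vs → ∀ H → Remaining S C [] (v ∷ vs) H ⇔ Target S C H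
  remaining-fromC inv v∈C nn H = mk⇔ proj₁ λ t → t , (λ ()) ,
    Sum.[ (λ (w , w∈ , w∈H) → w , there w∈ , w∈H) , (λ v∈H → _ , here refl , v∈H) ] (target-hit inv (inj₁ v∈C) nn t)

  -- By maximality a target would contain the dominating vertex, which is outside S ∪ C.
  target-dominated : ∀ {S C X} → Invariant S C X → HasDominating C X → ∀ H → ¬ Target S C H
  target-dominated inv (x , x∈X , dx≡0) H t@(_ , _ , ⊆SC) = Sum.[ (λ x∈S → S∌X x∈S x∈X) , (λ x∈C → C∌X x∈C x∈X) ] (⊆SC (target-absorbs t adj))
    where
    open Invariant inv
    adj : ∀ {w} → w ∈ᴴ H → N x w ≡ false
    adj {w} w∈H with ⊆SC w∈H
    ... | inj₁ w∈S = nonAdjacent-flip {w} (adjacent w∈S (inj₂ (inj₂ x∈X)))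
    ... | inj₂ w∈C = length-filterᵇ-none (N x) _ dx≡0 w∈C

  target-tooSmall : ∀ {S C} → length (filterᵇ (isLeft G) (S ++ C)) < 1 ⊎ length (filterᵇ (isRight G) (S ++ C)) < 1 → ∀ H → ¬ Target S C H
  target-tooSmall {S} {C} (inj₁ (s≤s l≤0)) (A , B) ((_ , 1≤A , _) , _ , ⊆SC) =
    let (u , u∈A) = 1≤∣p∣⇒nonempty A 1≤A
    in true≢false refl (length-filterᵇ-none (isLeft G) (S ++ C) (ℕ.n≤0⇒n≡0 l≤0) {inj₁ u} (Sum.[ ∈-++⁺ˡ , ∈-++⁺ʳ S ] (⊆SC {inj₁ u} u∈A)))
  target-tooSmall {S} {C} (inj₂ (s≤s r≤0)) (A , B) ((_ , _ , 1≤B) , _ , ⊆SC) =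
    let (w , w∈B) = 1≤∣p∣⇒nonempty B 1≤B
    in true≢false refl (length-filterᵇ-none (isRight G) (S ++ C) (ℕ.n≤0⇒n≡0 r≤0) {inj₂ w} (Sum.[ ∈-++⁺ˡ , ∈-++⁺ʳ S ] (⊆SC {inj₂ w} w∈B)))

  -- With `X` empty, `complete` puts every vertex adjacent to all of S into S ∪ C. A maximal
  -- biclique of S ∪ C absorbs S, so any larger biclique of the graph still lies in S ∪ C.
  target-terminal : ∀ {S C} → Invariant S C [] → ∀ H → IsLargeMaximalBicliqueOf G 1 1 (S ++ C) H ⇔ Target S C H
  target-terminal {S} {C} inv H = mk⇔ to from
    where
    open Invariant inv
    to : IsLargeMaximalBicliqueOf G 1 1 (S ++ C) H → Target S C H
    to (m@((b , H⊆) , maximal) , sizes) = ((((b , λ v _ → ∈-vertices v) , maximal′) , sizes) , S⊆ , λ {v} v∈ → ∈-++⁻ S (H⊆ v v∈))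
      where
      S⊆ : ∀ {s} → s ∈ S → s ∈ᴴ H
      S⊆ s∈S = maximal-absorbs m (∈-++⁺ˡ s∈S) λ {w} w∈H → adjacent s∈S (Sum.map₂ inj₁ (∈-++⁻ S (H⊆ w w∈H)))
      maximal′ : ∀ H′ → IsBicliqueOf G (vertices G) H′ → _⊆ᴳ_ G H H′ → H′ ≡ H
      maximal′ H′ (b′ , _) H⊆H′ = maximal H′ (b′ , within) H⊆H′
        where
        within : ∀ v → v ∈ᴴ H′ → v ∈ S ++ C
        within v v∈ with complete {v} (λ {s} s∈S → biclique⇒adjacent {H′} b′ (H⊆H′ s (S⊆ s∈S)) v∈)
        ... | inj₁ v∈S = ∈-++⁺ˡ v∈S
        ... | inj₂ (inj₁ v∈C) = ∈-++⁺ʳ S v∈C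
    from : Target S C H → IsLargeMaximalBicliqueOf G 1 1 (S ++ C) H
    from ((((b , _) , maximal) , sizes) , _ , ⊆SC) =
      ((b , λ v v∈ → Sum.[ ∈-++⁺ˡ , ∈-++⁺ʳ S ] (⊆SC v∈)) , λ H′ (b′ , _) → maximal H′ (b′ , λ v _ → ∈-vertices v)) , sizes

  -- S contributes no non-neighbours, so only degrees within C count. Hence a missing pivot is
  -- impossible: the termination test would have succeeded.
  inside-twoBiplex : ∀ {S C X} → Invariant S C X → (∀ {v} → v ∈ C → ¬ NotC′ C X v) → IsTwoBiplex G (S ++ C)
  inside-twoBiplex {S} {C} inv inside = All.tabulate λ {v} v∈ → bound v (∈-++⁻ S v∈)
    where
    open Invariant inv
    d-++ : ∀ v → d v (S ++ C) ≡ d v S + d v C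
    d-++ v = trans (cong length (filterᵇ-++ (N v) S C)) (length-++ (filterᵇ (N v) S))
    none : ∀ v W → (∀ {w} → w ∈ W → N v w ≡ false) → d v W ≡ 0
    none v W a = ℕ.n≤0⇒n≡0 (ℕ.≮⇒≥ λ 1≤ → let (w , w∈ , e) = d̄-some {v} W 1≤ in true≢false e (a w∈))
    bound : ∀ v → v ∈ S ⊎ v ∈ C → d v (S ++ C) ≤ 2
    bound v (inj₁ v∈S) = subst (_≤ 2) (sym (none v (S ++ C) λ w∈ → adjacent v∈S (Sum.map₂ inj₁ (∈-++⁻ S w∈)))) z≤n
    bound v (inj₂ v∈C) = subst (_≤ 2) (sym (trans (d-++ v) (cong (_+ d v C) (none v S λ {w} w∈ → nonAdjacent-flip {w} (adjacent w∈ (inj₂ (inj₁ v∈C)))))))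
      (ℕ.≮⇒≥ λ 3≤ → inside v∈C (inj₂ 3≤))

  -- Maximal bicliques with an empty side

  leftSide rightSide : List V → Subgraph G
  leftSide  W = tabulate (λ u → does (inj₁ u ∈? W)) , Subset.⊥
  rightSide W = Subset.⊥ , tabulate (λ w → does (inj₂ w ∈? W))

  does-true : ∀ {P : Set} (p? : Dec P) → does p? ≡ true → P
  does-true (yes p) _ = p

  -- A biclique with an empty side lies within one full side of `W`, which is itself a biclique, so
  -- maximality forces equality.
  small-or-large : ∀ {W H} → IsMaximalBicliqueOf G W H → IsLargeMaximalBicliqueOf G 1 1 W H ⊎ H ∈ leftSide W ∷ rightSide W ∷ []
  small-or-large {W} {A , B} m@((b , H⊆) , maximal) with 1 ℕ.≤? ∣ A ∣ | 1 ℕ.≤? ∣ B ∣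
  ... | yes 1≤A | yes 1≤B = inj₁ (m , 1≤A , 1≤B)
  ... | _ | no ¬1≤B = inj₂ (here (sym (maximal (leftSide W) (left , within) larger)))
    where
    left : IsBiclique G (leftSide W)
    left _ _ _ w∈⊥ = contradiction w∈⊥ Subset.∉⊥
    within : ∀ v → v ∈ᴴ leftSide W → v ∈ W
    within (inj₁ u) u∈ = does-true (inj₁ u ∈? W) (∈-tabulate⁻ _ u∈)
    within (inj₂ w) w∈ = contradiction w∈ Subset.∉⊥
    larger : ∀ v → v ∈ᴴ (A , B) → v ∈ᴴ leftSide W
    larger (inj₁ u) u∈ = ∈-tabulate⁺ _ (dec-true (inj₁ u ∈? W) (H⊆ (inj₁ u) u∈))
    larger (inj₂ w) w∈ = contradiction (x∈p⇒1≤∣p∣ w∈) ¬1≤B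
  ... | no ¬1≤A | yes _ = inj₂ (there (here (sym (maximal (rightSide W) (right , within) larger))))
    where
    right : IsBiclique G (rightSide W)
    right _ _ u∈⊥ = contradiction u∈⊥ Subset.∉⊥
    within : ∀ v → v ∈ᴴ rightSide W → v ∈ W
    within (inj₂ w) w∈ = does-true (inj₂ w ∈? W) (∈-tabulate⁻ _ w∈)
    within (inj₁ u) u∈ = contradiction u∈ Subset.∉⊥
    larger : ∀ v → v ∈ᴴ (A , B) → v ∈ᴴ rightSide W
    larger (inj₂ w) w∈ = ∈-tabulate⁺ _ (dec-true (inj₂ w ∈? W) (H⊆ (inj₂ w) w∈))
    larger (inj₁ u) u∈ = contradiction (x∈p⇒1≤∣p∣ u∈) ¬1≤A

  edgeCount≤ : ∀ W → edgeCount G W ≤ length W * length W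
  edgeCount≤ W = ℕ.≤-trans (length-filterᵇ-≤ (isEdge G) (cartesianProduct W W)) (ℕ.≤-reflexive (length-cartesianProduct W W))

Enumerates-length≤ : {A : Set} {P : A → Set} {xs ys : List A} → Enumerates P xs → Enumerates P ys → length xs ≤ length ys
Enumerates-length≤ (u , f) (_ , g) = Unique-⊆⇒length≤ u λ {x} x∈ → Equivalence.from (g x) (Equivalence.to (f x) x∈)

-- The whole execution

module Recursion (impl : Implementation) (G : BipartiteGraph) where
  open Implementation impl
  open TwoBiplexProcedure twoBiplex using (κ; correct; bounded)
  open IPS impl G 1 1
  open Branching G
  open Counting G
  open Execution impl G 1 1
  open Steps impl G 1 1
  open Correctness G

  private
    V : Set
    V = Vertex G

  -- `q` bounds the work at a branch apart from the cost per biclique listed; its summand with κ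
  -- covers the fixed part of the 2-biplex procedure.
  n s q : ℕ
  n = order-of G
  s = suc n
  q = (64 + κ) * Times.σ n

  -- Pruned branches are missing from `nodes`, so each branch pays `q` for itself and every unpruned
  -- one reserves `s * q` for its children, of which there are at most `s`.
  record Result (S C X : List V) : Set where
    field
      {found}       : List (Subgraph G)
      {steps nodes} : ℕ
      run           : ⟨ S , C , X ⟩ ⇓ found ⧗ steps
      enumerates    : Enumerates (Target S C) found
      steps≤        : steps ≤ q + s * q * nodes + κ * n * length found
      count         : Count C X nodes

  record Results (S C X us vs : List V) : Set where
    field
      {found}    : List (Subgraph G)
      {steps}    : ℕ
      {nodes}    : List ℕ
      runs       : children S C X us vs ⇓* found ⧗ steps
      enumerates : Enumerates (Remaining S C us vs) found
      steps≤     : steps ≤ length vs * q + s * q * sum nodes + κ * n * length found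
      counts     : Pointwise CountOf (children S C X us vs) nodes

  module _ {S C X : List V} (inv : Invariant S C X)
           (solve : ∀ {us v} → Prefix C us → v ∈ C → v ∉ us → Result (v ∷ S) (childC C us v) (childX X us v)) where

    solve-children : ∀ {us} vs → Prefix C us → Unique vs → (∀ {v} → v ∈ vs → v ∈ C × v ∉ us) → Results S C X us vs
    solve-children [] pre vs! vs-ok = record
      { runs = [] ; enumerates = Enumerates-[] (λ { H (_ , _ , _ , () , _) }) ; steps≤ = z≤n ; counts = [] }
    solve-children {us} (v ∷ vs) pre vs!@(_ ∷ vs!′) vs-ok = record
      { runs       = R.run ∷ Rs.runs
      ; enumerates = Enumerates-⇔ (remaining-∷ inv pre v∈C v∉us) (Enumerates-++ remaining-disjoint R.enumerates Rs.enumerates)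
      ; steps≤     = begin
          R.steps + Rs.steps
            ≤⟨ ℕ.+-mono-≤ R.steps≤ Rs.steps≤ ⟩
          (q + s * q * R.nodes + κ * n * length R.found) + (length vs * q + s * q * sum Rs.nodes + κ * n * length Rs.found)
            ≡⟨ solve′ 8 (λ q Q a b k l c e → (q :+ Q :* a :+ k :* l) :+ (c :+ Q :* b :+ k :* e) := (q :+ c) :+ Q :* (a :+ b) :+ k :* (l :+ e)) refl
                 q (s * q) R.nodes (sum Rs.nodes) (κ * n) (length R.found) (length vs * q) (length Rs.found) ⟩
          (q + length vs * q) + s * q * (R.nodes + sum Rs.nodes) + κ * n * (length R.found + length Rs.found)
            ≡⟨ cong (λ z → (q + length vs * q) + s * q * (R.nodes + sum Rs.nodes) + κ * n * z) (length-++ R.found) ⟨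
          (q + length vs * q) + s * q * (R.nodes + sum Rs.nodes) + κ * n * length (R.found ++ Rs.found) ∎
      ; counts     = R.count ∷ Rs.counts
      }
      where
      open ℕ.≤-Reasoning
      open ℕSolver.+-*-Solver using (_:+_; _:*_; _:=_; con) renaming (solve to solve′)
      v∈C : v ∈ C
      v∈C = proj₁ (vs-ok (here refl))
      v∉us : v ∉ us
      v∉us = proj₂ (vs-ok (here refl))
      module R = Result (solve pre v∈C v∉us)
      pre′ : Prefix C (v ∷ us)
      pre′ = record { us! = Unique-∷⁺ v∉us (Prefix.us! pre) ; us⊆C = λ { (here refl) → v∈C ; (there u∈) → Prefix.us⊆C pre u∈ } }
      rest : Results S C X (v ∷ us) vs
      rest = solve-children vs pre′ vs!′ λ v∈ → proj₁ (vs-ok (there v∈)) , λ { (here refl) → Unique-∷⁻ vs! v∈ ; (there v∈us) → proj₂ (vs-ok (there v∈)) v∈us }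
      module Rs = Results rest

    solve-branch : ∀ {vs t} → Unique vs → vs ⊆ C → (∀ H → Remaining S C [] vs H ⇔ Target S C H) →
                   (∀ {ms} → Pointwise CountOf (children S C X [] vs) ms → Count C X (suc (sum ms))) →
                   stepᵀ ⟨ S , C , X ⟩ ≡ branch (children S C X [] vs) ⧗ t → t ≤ 64 * Times.σ n → Result S C X
    solve-branch {vs} {t} vs! vs⊆C remaining counting step t≤ = record
      { run        = branches step Rs.runs
      ; enumerates = Enumerates-⇔ remaining Rs.enumerates
      ; steps≤     = begin
          t + Rs.steps
            ≤⟨ ℕ.+-mono-≤ (ℕ.≤-trans t≤ (ℕ.*-monoˡ-≤ (Times.σ n) (ℕ.m≤m+n 64 κ))) Rs.steps≤ ⟩
          q + (length vs * q + s * q * sum Rs.nodes + κ * n * length Rs.found)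
            ≤⟨ ℕ.+-monoʳ-≤ q (ℕ.+-monoˡ-≤ (κ * n * length Rs.found) (ℕ.+-monoˡ-≤ (s * q * sum Rs.nodes) (ℕ.*-monoˡ-≤ q vs≤))) ⟩
          q + (s * q + s * q * sum Rs.nodes + κ * n * length Rs.found)
            ≡⟨ solve′ 4 (λ q Q a b → q :+ (Q :+ Q :* a :+ b) := q :+ Q :* (con 1 :+ a) :+ b) refl q (s * q) (sum Rs.nodes) (κ * n * length Rs.found) ⟩
          q + s * q * suc (sum Rs.nodes) + κ * n * length Rs.found ∎
      ; count      = counting Rs.counts
      }
      where
      open ℕ.≤-Reasoning
      open ℕSolver.+-*-Solver using (_:+_; _:*_; _:=_; con) renaming (solve to solve′)
      all-children : Results S C X [] vs
      all-children = solve-children vs (record { us! = [] ; us⊆C = λ () }) vs! (λ v∈ → vs⊆C v∈ , λ ())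
      module Rs = Results all-children
      vs≤ : length vs ≤ s
      vs≤ = ℕ.≤-trans (Unique⇒length≤order vs!) (ℕ.n≤1+n n)

  output-time : ∀ {W t} → Unique W → IsTwoBiplex G W → t ≤ 64 * Times.σ n + time (output-of W) →
                t ≤ q + s * q * 1 + κ * n * length (value (output-of W))
  output-time {W} {t} W! biplex t≤ = begin
    t                                                         ≤⟨ t≤ ⟩
    64 * σ + time (output-of W)                               ≤⟨ ℕ.+-monoʳ-≤ (64 * σ) (bounded G 1 1 W W! biplex b (every , every-enum , refl)) ⟩
    64 * σ + κ * (1 + edgeCount G W + length W * b)           ≤⟨ ℕ.+-monoʳ-≤ (64 * σ) (ℕ.*-monoʳ-≤ κ (ℕ.+-mono-≤ (ℕ.+-monoʳ-≤ 1 (ℕ.≤-trans (edgeCount≤ W) (ℕ.*-mono-≤ W≤ W≤))) (ℕ.*-mono-≤ W≤ b≤))) ⟩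
    -- The two bicliques with an empty side contribute 2 n, which completes 1 + n² to (n + 1)² and
    -- so fits into `q`.
    64 * σ + κ * (1 + n * n + n * (h + 2))                    ≡⟨ solve′ 3 (λ n k h → con 64 :* ((con 1 :+ n) :* (con 1 :+ n)) :+ k :* (con 1 :+ n :* n :+ n :* (h :+ con 2))
                                                                   := (con 64 :+ k) :* ((con 1 :+ n) :* (con 1 :+ n)) :+ k :* n :* h) refl n κ h ⟩
    q + κ * n * h                                             ≤⟨ ℕ.+-monoˡ-≤ (κ * n * h) (ℕ.m≤m+n q (s * q * 1)) ⟩
    q + s * q * 1 + κ * n * h                                 ∎
    where
    open ℕ.≤-Reasoning
    open ℕSolver.+-*-Solver using (_:+_; _:*_; _:=_; con) renaming (solve to solve′)
    σ h b : ℕ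
    σ = Times.σ n
    h = length (value (output-of W))
    -- Thresholds of zero make the procedure list all maximal bicliques, which yields the
    -- cardinality that `bounded` asks for.
    every : List (Subgraph G)
    every = value (TwoBiplexProcedure.run twoBiplex G 0 0 W)
    b = length every
    every-enum : Enumerates (IsMaximalBicliqueOf G W) every
    every-enum = Enumerates-⇔ (λ H → mk⇔ proj₁ λ m → m , z≤n , z≤n) (correct G 0 0 W W! biplex)
    W≤ : length W ≤ n
    W≤ = Unique⇒length≤order W!
    b≤ : b ≤ h + 2
    b≤ = ℕ.≤-trans (Unique-⊆⇒length≤ (proj₁ every-enum) λ {H} H∈ →
        Sum.[ (λ large → ∈-++⁺ˡ (Equivalence.from (proj₂ (correct G 1 1 W W! biplex) H) large)) , ∈-++⁺ʳ (value (output-of W)) ]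
          (small-or-large (Equivalence.to (proj₂ every-enum H) H∈)))
      (ℕ.≤-reflexive (length-++ (value (output-of W))))

  solve-step : ∀ {S C X} → Invariant S C X →
    (∀ {us v} → Prefix C us → v ∈ C → v ∉ us → Result (v ∷ S) (childC C us v) (childX X us v)) →
    ∀ {r} → StepSpec S C X (64 * Times.σ n) r → stepᵀ ⟨ S , C , X ⟩ ≡ r → Result S C X
  solve-step {S} {C} inv solve (outputs biplex refl t≤) step = record
    { run        = outputs step
    ; enumerates = Enumerates-⇔ (target-terminal inv) (correct G 1 1 (S ++ C) SC! biplex)
    ; steps≤     = output-time SC! biplex t≤
    ; count      = count-leaf
    }
    where open Invariant inv
  solve-step inv solve (prunes why t≤) step = record
    { run        = prunes step
    ; enumerates = Enumerates-[] (Sum.[ target-tooSmall , target-dominated inv ]′ why)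
    ; steps≤     = ℕ.≤-trans (ℕ.≤-trans t≤ (ℕ.*-monoˡ-≤ (Times.σ n) (ℕ.m≤m+n 64 κ)))
                     (ℕ.≤-trans (ℕ.m≤m+n q (s * q * 0)) (ℕ.m≤m+n _ (κ * n * 0)))
    ; count      = count-0
    }
  solve-step inv solve (no-pivot ¬biplex _ inside) step = contradiction (inside-twoBiplex inv inside) ¬biplex
  solve-step inv solve (branchesX undominated v∈X minimal nn t≤) step =
    solve-branch inv solve unique (proj₁ ∘ sound) (remaining-fromX inv v∈X nn) (count-fromX C! nn v∈X minimal undominated) step t≤
    where
    open Invariant inv
    open NonNeighbours nn
  solve-step inv solve (branchesC {v} undominated v∈C candidate minX minC nn t≤) step =
    solve-branch inv solve
      (Unique-∷⁺ (λ v∈ → true≢false (proj₂ (sound v∈)) (nonAdjacent-irrefl v)) unique)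
      (λ { (here refl) → v∈C ; (there w∈) → proj₁ (sound w∈) })
      (remaining-fromC inv v∈C nn) (count-fromC C! v∈C candidate minX minC undominated nn) step t≤
    where
    open Invariant inv
    open NonNeighbours nn

  -- The recursion is on a bound for the number of candidates, as each child loses its branching
  -- vertex.
  solve : ∀ f {S C X} → Invariant S C X → length C < f → Result S C X
  solve (suc f) {S} {C} {X} inv (s≤s C≤f) = solve-step inv
    (λ {us} {v} pre v∈C v∉us → solve f (child-invariant inv pre v∈C v∉us) (ℕ.≤-trans (shrinks us v v∈C) C≤f))
    (step-spec n S C X (Unique⇒length≤order SC!) (Unique⇒length≤order C!) (Unique⇒length≤order X!) C!) refl
    where
    open Invariant inv
    shrinks : ∀ us v → v ∈ C → suc (length (childC C us v)) ≤ length C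
    shrinks us v v∈C = Unique-⊆⇒length≤
      (Unique-∷⁺ (λ v∈ → proj₁ (proj₂ (∈-childC⁻ {us = us} {v} v∈)) refl) (Unique-childC us v C!))
      (λ { (here refl) → v∈C ; (there w∈) → childC⊆C {us = us} {v} w∈ })

  whole : Result [] (vertices G) []
  whole = solve (suc (length (vertices G))) initial (ℕ.n<1+n _)

  -- The 65th unit pays for building the initial candidate set. One copy of `absorbing` is for the
  -- polynomial cost on its own, the other for its product with the number of unpruned branches.
  constant : ℕ
  constant = (65 + κ) * (absorbing + absorbing)

  whole-bound : 1 ≤ size G → ∀ {β} → length (Result.found whole) ≡ β →
                const (fromℕ (n + Result.steps whole)) ≤ᴿ
                  (λ k → fromℕ constant ℚ.* (fromℕ (size G) ℚ.* (bisect k ^ℚ n) ℚ.+ fromℕ (n * β)))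
  whole-bound 1≤m {β} refl = ≤ᴿ-bound {n + R.steps} {constant} {n} {size G} {n * β} 1≤m (begin
    (n + R.steps) * 10000 ^ n
      ≤⟨ ℕ.*-monoˡ-≤ D (ℕ.+-monoʳ-≤ n R.steps≤) ⟩
    (n + (q + s * q * R.nodes + κ * n * β)) * D
      ≤⟨ ℕ.*-monoˡ-≤ D polynomial ⟩
    (K * (s ^ 5 * 1 + s ^ 5 * R.nodes) + κ * n * β) * D
      ≡⟨ solve′ 6 (λ K a b k n D → (K :* (a :+ b) :+ k :* n) :* D := K :* (a :* D :+ b :* D) :+ k :* n :* D) refl K (s ^ 5 * 1) (s ^ 5 * R.nodes) (κ * n) β D ⟩
    K * (s ^ 5 * 1 * D + s ^ 5 * R.nodes * D) + κ * n * β * D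
      ≤⟨ ℕ.+-mono-≤ (ℕ.*-monoʳ-≤ K (ℕ.+-mono-≤ (Fits-absorb n (Fits-1 (8 * n))) (Fits-absorb n nodes-fit))) (ℕ.*-monoˡ-≤ D outputs≤) ⟩
    K * (absorbing * E + absorbing * E) + constant * (n * β) * D
      ≡⟨ cong (_+ constant * (n * β) * D) (solve′ 3 (λ K A E → K :* (A :* E :+ A :* E) := K :* (A :+ A) :* E) refl K absorbing E) ⟩
    constant * E + constant * (n * β) * D ∎)
    where
    open ℕ.≤-Reasoning
    open ℕSolver.+-*-Solver using (_:+_; _:*_; _:=_; con) renaming (solve to solve′)
    module R = Result whole
    D E K : ℕ
    D = 10000 ^ n
    E = 13953 ^ n
    K = 65 + κ
    -- Initially `X` is empty and each vertex weighs at most 8, whence the exponent 8 n.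
    nodes-fit : Fits R.nodes (8 * n)
    nodes-fit = Fits-mono (ℕ.≤-trans (measure-initial (vertices G)) (ℕ.≤-reflexive (cong (8 *_) length-vertices))) (Below⇒Fits (Count.general R.count))
    outputs≤ : κ * n * β ≤ constant * (n * β)
    outputs≤ = ℕ.≤-trans (ℕ.≤-reflexive (ℕ.*-assoc κ n β)) (ℕ.*-monoˡ-≤ (n * β)
      (ℕ.≤-trans (ℕ.m≤n+m κ 65) (ℕ.≤-trans (ℕ.≤-reflexive (sym (ℕ.*-identityʳ K))) (ℕ.*-monoʳ-≤ K (ℕ.≤-trans 1≤absorbing (ℕ.m≤m+n absorbing absorbing))))))
    s² s³ : ℕ
    s² = s * s
    s³ = s * s²
    grow : ∀ a → a ≤ s * a
    grow a = ℕ.m≤m+n a (n * a)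
    s²≤s⁵ : s² ≤ s ^ 5
    s²≤s⁵ = ℕ.≤-trans (grow s²) (ℕ.≤-trans (grow s³) (ℕ.≤-trans (grow (s * s³)) (ℕ.≤-reflexive
      (solve′ 1 (λ s → s :* (s :* (s :* (s :* s))) := s :* (s :* (s :* (s :* (s :* con 1))))) refl s))))
    s³≤s⁵ : s³ ≤ s ^ 5
    s³≤s⁵ = ℕ.≤-trans (grow s³) (ℕ.≤-trans (grow (s * s³)) (ℕ.≤-reflexive
      (solve′ 1 (λ s → s :* (s :* (s :* (s :* s))) := s :* (s :* (s :* (s :* (s :* con 1))))) refl s)))
    n≤s⁵ : n ≤ s ^ 5
    n≤s⁵ = ℕ.≤-trans (ℕ.n≤1+n n) (ℕ.≤-trans (grow s) s²≤s⁵)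
    polynomial : n + (q + s * q * R.nodes + κ * n * β) ≤ K * (s ^ 5 * 1 + s ^ 5 * R.nodes) + κ * n * β
    polynomial = begin
      n + (q + s * q * R.nodes + κ * n * β)
        ≡⟨ solve′ 6 (λ n k s² s m o → n :+ ((con 64 :+ k) :* s² :+ s :* ((con 64 :+ k) :* s²) :* m :+ o)
             := (n :+ (con 64 :+ k) :* s²) :+ (con 64 :+ k) :* (s :* s² :* m) :+ o) refl n κ s² s R.nodes (κ * n * β) ⟩
      (n + (64 + κ) * s²) + (64 + κ) * (s³ * R.nodes) + κ * n * β
        ≤⟨ ℕ.+-monoˡ-≤ (κ * n * β) (ℕ.+-mono-≤ (ℕ.+-mono-≤ n≤s⁵ (ℕ.*-monoʳ-≤ (64 + κ) s²≤s⁵))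
             (ℕ.*-mono-≤ (ℕ.n≤1+n (64 + κ)) (ℕ.*-monoˡ-≤ R.nodes s³≤s⁵))) ⟩
      (s ^ 5 + (64 + κ) * s ^ 5) + (65 + κ) * (s ^ 5 * R.nodes) + κ * n * β
        ≡⟨ cong (_+ κ * n * β) (solve′ 3 (λ k a m → (a :+ (con 64 :+ k) :* a) :+ (con 65 :+ k) :* (a :* m) := (con 65 :+ k) :* (a :* con 1 :+ a :* m)) refl κ (s ^ 5) R.nodes) ⟩
      K * (s ^ 5 * 1 + s ^ 5 * R.nodes) + κ * n * β ∎

theorem3p2 : ∃ λ (α : ℝ) →
    IsLargestPositiveRoot α
    × (const (+ 13953 ℚ./ 10000) ≤ᴿ approx α)
    × (approx α ≤ᴿ const (+ 13955 ℚ./ 10000))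
    × (∀ (impl : Implementation) →
    ∃ λ (c : ℕ) →
    ∀ (G : BipartiteGraph) → 1 ≤ size G →
    ∀ (β : ℕ) → HasCardinality (IsLargeMaximalBicliqueOf G 1 1 (vertices G)) β →
    ∃ λ Hs → ∃ λ t →
    Executes impl G 1 1 Hs t
    × Enumerates (IsLargeMaximalBicliqueOf G 1 1 (vertices G)) Hs
    × (const (fromℕ t)
    ≤ᴿ (λ k → fromℕ c ℚ.* (fromℕ (size G) ℚ.* (approx α k ^ℚ order-of G)
    ℚ.+ fromℕ (order-of G * β)))))
theorem3p2 = root , root-isLargest
  , ≤⇒≤ᴿ {const (+ 13953 ℚ./ 10000)} {bisect} lower≤bisect
  , ≤⇒≤ᴿ {bisect} {const (+ 13955 ℚ./ 10000)} bisect≤upper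
  , λ impl → (65 + TwoBiplexProcedure.κ (Implementation.twoBiplex impl)) * (absorbing + absorbing) , λ G 1≤m β (Hs , enum , ∣Hs∣≡β) →
      let open Recursion impl G
          open Correctness G
          module R = Result whole
          found = Enumerates-⇔ target-initial R.enumerates
      in R.found , order-of G + R.steps , (R.steps , R.run , refl) , found
         -- β is given by some other enumeration of the same bicliques, so the two lists have equal
         -- length.
         , whole-bound 1≤m (trans (ℕ.≤-antisym (Enumerates-length≤ found enum) (Enumerates-length≤ enum found)) ∣Hs∣≡β)
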